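{- Let $a=(a_i)_{i\in\mathbb Z}$ and $b=(b_i)_{i\in\mathbb Z}$ be two sequences of complex numbers, and write $s_{\mu;a}=\sum_\nu c_{\mu\nu}(a,b)\,s_{\nu;b}$ (expansion in the basis $\{s_{\nu;b}\}$ of $\Lambda$). Then $c_{\mu\nu}(a,b)=0$ unless $\nu\subseteq\mu$ and $d(\nu)=d(\mu)$. If $d(\nu)=d(\mu)=d$ and $\mu=(p_1,\dots,p_d\mid q_1,\dots,q_d)$, $\nu=(p'_1,\dots,p'_d\mid q'_1,\dots,q'_d)$ in Frobenius notation, then $$c_{\mu\nu}(a,b)=\det[c_{p_i,p'_j}(a,b)]_{i,j=1}^d\,\det[c_{q_i,q'_j}(\widehat a,\widehat b)]_{i,j=1}^d,$$ where for integers $p\ge p'\ge0$, $c_{pp'}(a,b)=h_{p-p'}(b_1,\dots,b_{p'+1};-a_1,\dots,-a_p)$, and $c_{pp'}(a,b)=0$ if $p'>p$.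
   Context: $\Lambda$ is the algebra of symmetric functions over $\mathbb C$ with complete homogeneous $h_k$, elementary $e_k$, power sums $\mathbf p_k$. For a sequence $a=(a_i)_{i\in\mathbb Z}$ define $h_{k;a}=\sum_{i=1}^k(-1)^{k-i}e_{k-i}(a_1,\dots,a_{k-1})h_i$ for $k\ge1$, $h_{0;a}=1$, $h_{k;a}=0$ for $k<0$; let $(\tau^ra)_i=a_{i+r}$; and set $s_{\mu;a}=\det[h_{\mu_i-i+j;\,\tau^{1-j}a}]_{i,j=1}^N$ for any $N\ge\ell(\mu)$; these form a basis of $\Lambda$. The dual sequence is $\widehat a_i=-a_{1-i}$. Supersymmetric evaluation: $f\in\Lambda$ is evaluated at $(x;y)=(x_1,\dots,x_m;y_1,\dots,y_n)$ via $\mathbf p_k\mapsto\sum_ix_i^k+(-1)^{k-1}\sum_jy_j^k$; in particular $h_k(x;y)=\sum_{r=0}^kh_{k-r}(x_1,\dots,x_m)e_r(y_1,\dots,y_n)$. Frobenius notation: a diagram with $d$ diagonal boxes is $(p_1,\dots,p_d\mid q_1,\dots,q_d)$, $p_i=\mu_i-i$, $q_i=\mu'_i-i$; $d(\mu)$ denotes the number of diagonal boxes. -}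

module Defs where

open import Algebra.Bundles using (CommutativeRing; RawRing)
open import Data.Bool using (if_then_else_)
open import Data.Fin using (Fin; zero; suc; toℕ; punchIn)
open import Data.Integer as ℤ using (ℤ; +_; -[1+_])
open import Data.List using (List; []; _∷_; applyUpTo; filter; foldr; length; map; upTo)
open import Data.List.Membership.Propositional using (_∉_)
open import Data.List.Relation.Binary.Permutation.Propositional using (_↭_; refl; prep; swap; trans)
open import Data.List.Relation.Unary.All using (All)
open import Data.List.Relation.Unary.Linked using (Linked)
open import Data.List.Relation.Unary.Unique.Propositional using (Unique)
open import Data.Nat as ℕ using (ℕ; zero; suc; _∸_; _≤_; _<_; _≥_; _≤?_; _<?_; _≟_)
import Data.Nat.Properties as ℕₚ
open import Data.Nat.ListAction using () renaming (sum to sumℕ)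
open import Data.Nat.ListAction.Properties using (sum-↭)
open import Level using (_⊔_)
open import Relation.Binary.PropositionalEquality as ≡ using (_≡_)
open import Relation.Nullary.Decidable using (⌊_⌋; yes; no)
open import Relation.Nullary.Negation using (contradiction)

record Partition : Set where
  field
    parts    : List ℕ
    sorted   : Linked _≥_ parts
    positive : All (0 <_) parts

open Partition public

ℓ[_] : Partition → ℕ
ℓ[ μ ] = length (parts μ)

entry : List ℕ → ℕ → ℕ
entry []       _       = 0
entry (x ∷ xs) zero    = x
entry (x ∷ xs) (suc i) = entry xs i

-- Rows and columns are numbered from 0: row μ i is μ_{i+1}, col μ j is μ'_{j+1}.
row : Partition → ℕ → ℕ
row μ = entry (parts μ)

col : Partition → ℕ → ℕ
col μ j = length (filter (j <?_) (parts μ))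

infix 4 _⊆_
_⊆_ : Partition → Partition → Set
ν ⊆ μ = ∀ i → row ν i ≤ row μ i

diag : Partition → ℕ
diag μ = length (filter (λ i → i <? row μ i) (upTo ℓ[ μ ]))

-- Frobenius coordinates p_{i+1} and q_{i+1}; only used for i < diag μ, where
-- the subtraction does not truncate.
arm leg : Partition → ℕ → ℕ
arm μ i = row μ i ∸ suc i
leg μ i = col μ i ∸ suc i

module _ {c ℓ} (R : RawRing c ℓ) where
  open RawRing R
  open import Algebra.Definitions.RawMonoid +-rawMonoid using (sum)
  open import Algebra.Definitions.RawSemiring rawSemiring using (_^_)

  det : ∀ {n} → (Fin n → Fin n → Carrier) → Carrier
  det {zero}  M = 1#
  det {suc n} M = sum λ j →
    (((- 1#) ^ toℕ j) * M zero j) * det (λ i k → M (suc i) (punchIn j k))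

module SymmetricFunctions {c ℓ} (K : CommutativeRing c ℓ) where
  open CommutativeRing K renaming (refl to ≈-refl; sym to ≈-sym; trans to ≈-trans)
  open import Algebra.Definitions.RawMonoid +-rawMonoid using (sum)
  open import Algebra.Definitions.RawSemiring (RawRing.rawSemiring rawRing) using (_^_)
  open import Algebra.Properties.CommutativeMonoid.Sum +-commutativeMonoid using (∑-comm; sum-cong-≋; sum-replicate-zero)
  open import Algebra.Properties.Ring ring using (-0#≈0#)

  -- A family of formal power series, one in K[[x_1,…,x_n]] for each n: the value
  -- at α₁ ∷ … ∷ αₙ ∷ [] is the coefficient of x_1^α₁ ⋯ x_n^αₙ.
  Series : Set c
  Series = List ℕ → Carrier

  infixl 7 _⊛_
  _⊛_ : Series → Series → Series
  (f ⊛ g) []      = f [] * g []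
  (f ⊛ g) (n ∷ α) = sum {suc n} λ i →
    ((λ β → f (toℕ i ∷ β)) ⊛ (λ γ → g (n ∸ toℕ i ∷ γ))) α

  Symmetric Stable : Series → Set ℓ
  Symmetric f = ∀ {α β} → α ↭ β → f α ≈ f β
  -- Together with symmetry: setting any one variable to 0 gives the series in
  -- the remaining variables.
  Stable f = ∀ α → f (0 ∷ α) ≈ f α

  Bounded : ℕ → Series → Set ℓ
  Bounded d f = ∀ α → d < sumℕ α → f α ≈ 0#

  ⊛-cong : ∀ {f f′ g g′} → (∀ α → f α ≈ f′ α) → (∀ α → g α ≈ g′ α) →
           ∀ α → (f ⊛ g) α ≈ (f′ ⊛ g′) α
  ⊛-cong p q []      = *-cong (p []) (q [])
  ⊛-cong p q (n ∷ α) = sum-cong-≋ {suc n} λ i →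
    ⊛-cong (λ β → p (toℕ i ∷ β)) (λ γ → q (n ∸ toℕ i ∷ γ)) α

  ⊛-symmetric : ∀ {f g} → Symmetric f → Symmetric g → Symmetric (f ⊛ g)
  ⊛-symmetric p q refl = ≈-refl
  ⊛-symmetric p q (prep n α↭β) = sum-cong-≋ {suc n} λ i →
    ⊛-symmetric (λ r → p (prep (toℕ i) r)) (λ r → q (prep (n ∸ toℕ i) r)) α↭β
  ⊛-symmetric {f} {g} p q {_ ∷ _ ∷ α} {_ ∷ _ ∷ β} (swap m n α↭β) = ≈-trans
    (∑-comm {suc m} {suc n} λ i j →
      ((λ γ → f (toℕ i ∷ toℕ j ∷ γ)) ⊛ (λ γ → g (m ∸ toℕ i ∷ n ∸ toℕ j ∷ γ))) α)
    (sum-cong-≋ {suc n} λ j → sum-cong-≋ {suc m} λ i → ≈-trans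
      (⊛-cong (λ γ → p (swap (toℕ i) (toℕ j) refl))
              (λ γ → q (swap (m ∸ toℕ i) (n ∸ toℕ j) refl)) α)
      (⊛-symmetric (λ r → p (prep (toℕ j) (prep (toℕ i) r)))
                   (λ r → q (prep (n ∸ toℕ j) (prep (m ∸ toℕ i) r))) α↭β))
  ⊛-symmetric p q (trans r s) = ≈-trans (⊛-symmetric p q r) (⊛-symmetric p q s)

  ⊛-stable : ∀ {f g} → Stable f → Stable g → Stable (f ⊛ g)
  ⊛-stable p q α = ≈-trans (+-identityʳ _) (⊛-cong p q α)

  -- Stated with an offset on the total degree so that the induction on the
  -- number of variables goes through.
  ⊛-bounded : ∀ {f g} d e u v →
    (∀ α → d < u ℕ.+ sumℕ α → f α ≈ 0#) →
    (∀ α → e < v ℕ.+ sumℕ α → g α ≈ 0#) →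
    ∀ α → d ℕ.+ e < (u ℕ.+ v) ℕ.+ sumℕ α → (f ⊛ g) α ≈ 0#
  ⊛-bounded d e u v p q [] lt with d <? u
  ... | yes d<u = ≈-trans (*-congʳ (p [] (≡.subst (d <_) (≡.sym (ℕₚ.+-identityʳ u)) d<u))) (zeroˡ _)
  ... | no  d≮u with e <? v
  ...   | yes e<v = ≈-trans (*-congˡ (q [] (≡.subst (e <_) (≡.sym (ℕₚ.+-identityʳ v)) e<v))) (zeroʳ _)
  ...   | no  e≮v = contradiction
          (≡.subst (_≤ d ℕ.+ e) (≡.sym (ℕₚ.+-identityʳ (u ℕ.+ v)))
            (ℕₚ.+-mono-≤ (ℕₚ.≮⇒≥ d≮u) (ℕₚ.≮⇒≥ e≮v)))
          (ℕₚ.<⇒≱ lt)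
  ⊛-bounded d e u v p q (n ∷ α) lt = ≈-trans
    (sum-cong-≋ {suc n} λ i → ⊛-bounded d e (u ℕ.+ toℕ i) (v ℕ.+ (n ∸ toℕ i))
      (λ β lt′ → p (toℕ i ∷ β) (≡.subst (d <_) (ℕₚ.+-assoc u _ _) lt′))
      (λ γ lt′ → q (n ∸ toℕ i ∷ γ) (≡.subst (e <_) (ℕₚ.+-assoc v _ _) lt′))
      α (≡.subst (d ℕ.+ e <_) (total i) lt))
    (sum-replicate-zero (suc n))
    where
    open import Data.Fin.Properties using (toℕ≤pred[n])
    open import Algebra.Properties.CommutativeSemigroup ℕₚ.+-commutativeSemigroup using (interchange)
    total : ∀ (i : Fin (suc n)) → (u ℕ.+ v) ℕ.+ (n ℕ.+ sumℕ α) ≡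
                    ((u ℕ.+ toℕ i) ℕ.+ (v ℕ.+ (n ∸ toℕ i))) ℕ.+ sumℕ α
    total i = ≡.trans (≡.sym (ℕₚ.+-assoc (u ℕ.+ v) n (sumℕ α)))
      (≡.cong (ℕ._+ sumℕ α)
        (≡.trans (≡.cong ((u ℕ.+ v) ℕ.+_) (≡.sym (ℕₚ.m+[n∸m]≡n (toℕ≤pred[n] i))))
                 (interchange u v (toℕ i) (n ∸ toℕ i))))

  record Λ : Set (c ⊔ ℓ) where
    field
      coeff     : Series
      symmetric : Symmetric coeff
      stable    : Stable coeff
      degree    : ℕ
      bounded   : Bounded degree coeff

  open Λ public

  infix 4 _≈Λ_
  _≈Λ_ : Λ → Λ → Set ℓ
  f ≈Λ g = ∀ α → coeff f α ≈ coeff g α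

  0Λ : Λ
  0Λ = record
    { coeff     = λ _ → 0#
    ; symmetric = λ _ → ≈-refl
    ; stable    = λ _ → ≈-refl
    ; degree    = 0
    ; bounded   = λ _ _ → ≈-refl
    }

  -- The sum of all monomials of degree k.
  h : ℕ → Λ
  h k = record
    { coeff     = λ α → if ⌊ sumℕ α ≟ k ⌋ then 1# else 0#
    ; symmetric = λ r → reflexive (≡.cong (λ s → if ⌊ s ≟ k ⌋ then 1# else 0#) (sum-↭ r))
    ; stable    = λ _ → ≈-refl
    ; degree    = k
    ; bounded   = vanishes
    }
    where
    vanishes : ∀ α → k < sumℕ α → (if ⌊ sumℕ α ≟ k ⌋ then 1# else 0#) ≈ 0#
    vanishes α k<s with sumℕ α ≟ k
    ... | yes s≡k = contradiction (≡.sym s≡k) (ℕₚ.<⇒≢ k<s)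
    ... | no  _   = ≈-refl

  1Λ : Λ
  1Λ = h 0

  infixl 6 _+Λ_
  _+Λ_ : Λ → Λ → Λ
  f +Λ g = record
    { coeff     = λ α → coeff f α + coeff g α
    ; symmetric = λ r → +-cong (symmetric f r) (symmetric g r)
    ; stable    = λ α → +-cong (stable f α) (stable g α)
    ; degree    = degree f ℕ.⊔ degree g
    ; bounded   = λ α lt → ≈-trans
        (+-cong (bounded f α (ℕₚ.≤-<-trans (ℕₚ.m≤m⊔n _ _) lt))
                (bounded g α (ℕₚ.≤-<-trans (ℕₚ.m≤n⊔m (degree f) _) lt)))
        (+-identityˡ 0#)
    }

  infixl 7 _*Λ_
  _*Λ_ : Λ → Λ → Λ
  f *Λ g = record
    { coeff     = coeff f ⊛ coeff g
    ; symmetric = ⊛-symmetric (symmetric f) (symmetric g)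
    ; stable    = ⊛-stable (stable f) (stable g)
    ; degree    = degree f ℕ.+ degree g
    ; bounded   = ⊛-bounded (degree f) (degree g) 0 0 (bounded f) (bounded g)
    }

  -Λ_ : Λ → Λ
  -Λ f = record
    { coeff     = λ α → - coeff f α
    ; symmetric = λ r → -‿cong (symmetric f r)
    ; stable    = λ α → -‿cong (stable f α)
    ; degree    = degree f
    ; bounded   = λ α lt → ≈-trans (-‿cong (bounded f α lt)) -0#≈0#
    }

  infixr 7 _•_
  _•_ : Carrier → Λ → Λ
  x • f = record
    { coeff     = λ α → x * coeff f α
    ; symmetric = λ r → *-congˡ (symmetric f r)
    ; stable    = λ α → *-congˡ (stable f α)
    ; degree    = degree f
    ; bounded   = λ α lt → ≈-trans (*-congˡ (bounded f α lt)) (zeroʳ x)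
    }

  Λ-rawRing : RawRing (c ⊔ ℓ) ℓ
  Λ-rawRing = record
    { Carrier = Λ
    ; _≈_     = _≈Λ_
    ; _+_     = _+Λ_
    ; _*_     = _*Λ_
    ; -_      = -Λ_
    ; 0#      = 0Λ
    ; 1#      = 1Λ
    }

  open import Algebra.Definitions.RawMonoid (RawRing.+-rawMonoid Λ-rawRing) using () renaming (sum to sumΛ)

  -- Elementary and complete homogeneous polynomials evaluated at finitely many scalars.
  e[_] h[_] : ℕ → List Carrier → Carrier
  e[ zero ]  _        = 1#
  e[ suc k ] []       = 0#
  e[ suc k ] (x ∷ xs) = e[ suc k ] xs + x * e[ k ] xs

  h[ zero ]  _        = 1#
  h[ suc k ] []       = 0#
  h[ suc k ] (x ∷ xs) = h[ suc k ] xs + x * h[ k ] (x ∷ xs)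

  -- Supersymmetric evaluation h_k(x;y), under p_k ↦ Σ x_i^k + (-1)^{k-1} Σ y_j^k.
  h[_]⟨_∣_⟩ : ℕ → List Carrier → List Carrier → Carrier
  h[ k ]⟨ x ∣ y ⟩ = sum {suc k} λ r → h[ k ∸ toℕ r ] x * e[ toℕ r ] y

  Sequence : Set c
  Sequence = ℤ → Carrier

  first : Sequence → ℕ → List Carrier
  first a = applyUpTo (λ i → a (+ suc i))

  τ : ℤ → Sequence → Sequence
  τ r a i = a (i ℤ.+ r)

  dual : Sequence → Sequence
  dual a i = - a (+ 1 ℤ.- i)

  -- In the last clause the summation index is suc (toℕ i), running from 1 to suc k.
  hₐ : ℤ → Sequence → Λ
  hₐ -[1+ _ ]  a = 0Λ
  hₐ (+ zero)  a = 1Λ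
  hₐ (+ suc k) a = sumΛ {suc k} λ i →
    (((- 1#) ^ (k ∸ toℕ i)) * e[ k ∸ toℕ i ] (first a k)) • h (suc (toℕ i))

  -- The multiparameter Jacobi–Trudi determinant of size N = ℓ(μ); any larger N gives the
  -- same element.  With i and j numbered from 0, μ_i - i + j keeps its form and
  -- τ^{1-j} becomes τ^{-j}.
  s : Partition → Sequence → Λ
  s μ a = det Λ-rawRing {ℓ[ μ ]} λ i j →
    hₐ (+ row μ (toℕ i) ℤ.- + toℕ i ℤ.+ + toℕ j) (τ (ℤ.- (+ toℕ j)) a)

  -- f = Σ_ν coef ν s_{ν;b}, a finite sum.
  record Expands (f : Λ) (b : Sequence) (coef : Partition → Carrier) : Set (c ⊔ ℓ) where
    field
      support  : List Partition
      distinct : Unique support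
      vanishes : ∀ ν → ν ∉ support → coef ν ≈ 0#
      expands  : f ≈Λ foldr (λ ν g → coef ν • s ν b +Λ g) 0Λ support

  -- The coefficient c_{p,p'}(a,b).
  hookCoef : Sequence → Sequence → ℕ → ℕ → Carrier
  hookCoef a b p p′ =
    if ⌊ p′ ≤? p ⌋
      then h[ p ∸ p′ ]⟨ first b (suc p′) ∣ map (-_) (first a p) ⟩
      else 0#

{-# OPTIONS --safe #-}

-- With H(u) = Σ h_k u^{-k}, the Jacobi–Trudi matrix of s_{μ;a} has the entries
-- Res H(u) (u|a)^{μ_i-i} / (u|a)^{1-j}. Unitriangular column operations over Λ
-- turn the rows with μ_i ≤ i - 1 into multiples of unit vectors, and the other
-- rows into values, at the polynomials (u|a)^p and (u|â)^q, of a bilinear form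
-- independent of a: its value at (u^k, u^l) is the hook Schur function s_(k|l).
-- This gives the Giambelli formula s_{μ;a} = det [s_{(p_i|q_j);a}]. Since
-- c_{pp'}(a,b) is the coefficient of (u|b)^{p'} in (u|a)^p, the expansion follows
-- by Cauchy–Binet, applied to the rows and to the columns of this determinant;
-- it involves only ν ⊆ μ because (c_{pp'}) is triangular.
--
-- The coefficients are unique because the coefficient of x^ν in s_{κ;b} is 1 for
-- κ = ν and 0 for κ lexicographically smaller than ν: column operations remove
-- the variable x_1 from all columns of the Jacobi–Trudi matrix but the first.
module Submission where

open import Defs
open import Algebra.Bundles using (CommutativeRing; RawRing)
open import Data.Bool using (if_then_else_)
open import Data.Fin as Fin using (Fin; toℕ; punchIn)
open import Data.Integer as ℤ using (ℤ; +_; -[1+_])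
import Data.Integer.Properties as ℤₚ
open import Data.List using (List; []; _∷_; [_]; _++_; map; foldr; length; applyUpTo; upTo; downFrom; tabulate; filter; replicate; cartesianProduct; deduplicate)
open import Data.List.Extrema.Nat using (max; xs≤max; ⊥≤max; max≤v⁺)
import Data.List.Membership.DecPropositional as DecMembership
open import Data.List.Membership.Propositional using (_∈_; _∉_)
import Data.List.Membership.Propositional.Properties as ∈ₚ
import Data.List.Properties as Listₚ
open import Data.List.Relation.Binary.Lex.Strict using (Lex-<; this; next; halt; base; <-compare; <-transitive)
open import Data.List.Relation.Binary.Pointwise using (Pointwise; []; _∷_; Pointwise-≡⇒≡)
open import Data.List.Relation.Unary.All as All using (All; []; _∷_)
import Data.List.Relation.Unary.All.Properties as Allₚ
open import Data.List.Relation.Unary.AllPairs as AllPairs using (AllPairs; []; _∷_)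
import Data.List.Relation.Unary.AllPairs.Properties as AllPairsₚ
open import Data.List.Relation.Unary.Any using (here; there)
import Data.List.Relation.Unary.Linked as Linked
import Data.List.Relation.Unary.Linked.Properties as Linkedₚ
open import Data.List.Relation.Unary.Unique.DecPropositional.Properties using (deduplicate-!)
open import Data.List.Relation.Unary.Unique.Propositional using (Unique)
import Data.List.Relation.Unary.Unique.Propositional.Properties as Uniqueₚ
open import Data.Maybe using (just; nothing)
open import Data.Nat as ℕ using (ℕ; zero; suc; _∸_; _<_; _>_; _≤_; _≥_; _≤?_; _<?_; _≟_; z≤n; s≤s)
open import Data.Nat.ListAction using () renaming (sum to sumℕ)
import Data.Nat.Properties as ℕₚ
open import Data.Product using (Σ; ∃; ∃₂; _×_; _,_; proj₁; proj₂)
open import Data.Sum using (_⊎_; inj₁; inj₂)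
open import Function using (_∘_; _$_; flip; id)
open import Level using (_⊔_)
open import Relation.Binary.Definitions using (DecidableEquality; WeaklyDecidable; tri<; tri≈; tri>)
open import Relation.Binary.PropositionalEquality as ≡ using (_≡_; _≢_)
import Relation.Binary.Reasoning.Setoid as SetoidReasoning
open import Relation.Nullary.Decidable using (⌊_⌋; isYes≗does; yes; no; map′)
open import Relation.Nullary.Negation using (contradiction; ¬_)
open import Relation.Unary using (Pred; Decidable)

-- The dual sequence arises as follows. Column q of the Jacobi-Trudi matrix carries the factor (u -
-- a_0)...(u - a_{1-q}). In the hook form, multiplying the second argument by its variable v amounts
-- to multiplying the first by -u, up to the rank-one term of h_{k+1} e_{l+1} = s_(k|l+1) +
-- s_(k+1|l). The rank-one terms are multiples of the zeroth column; they make the modified column q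
-- vanish at every nonpositive content except -q. The columns that survive are the legs, because the
-- legs are the numbers j < ℓ(μ) for which -j is not a content. Residues do not occur in the code. A
-- polynomial is represented by its effect on functionals u^i ↦ χ i, so multiplication by u is a
-- shift of χ; the negative powers of (u|a) enter through the values 1 and 0 of the zeroth column at
-- nonpositive contents. `Λ` comes only as a raw ring, so the algebra takes place in the commutative
-- ring of coefficient series. Determinants are taken over lists of rows and columns instead of
-- finite index types, since deleting and appending labelled rows is most of the work.

module IntegerSolver {c ℓ} (R : CommutativeRing c ℓ) where
  open CommutativeRing R
  open import Algebra.Properties.Ring ring
  open import Algebra.Properties.AbelianGroup +-abelianGroup using (⁻¹-∙-comm)
  open import Algebra.Properties.Semiring.Mult.TCOptimised semiring renaming (_×_ to _·_)
  open import Algebra.Solver.Ring.AlmostCommutativeRing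
    using (fromCommutativeRing; _-Raw-AlmostCommutative⟶_; Induced-equivalence)
  open SetoidReasoning setoid

  private
    ⟦_⟧ℤ : ℤ → Carrier
    ⟦ + n ⟧ℤ      = n · 1#
    ⟦ -[1+ n ] ⟧ℤ = - (suc n · 1#)

    ⊖-homo : ∀ m n → ⟦ m ℤ.⊖ n ⟧ℤ ≈ m · 1# - n · 1#
    ⊖-homo zero    zero    = sym (-‿inverseʳ 0#)
    ⊖-homo zero    (suc n) = sym (+-identityˡ _)
    ⊖-homo (suc m) zero    = sym (trans (+-congˡ -0#≈0#) (+-identityʳ _))
    ⊖-homo (suc m) (suc n) = begin
      ⟦ suc m ℤ.⊖ suc n ⟧ℤ                  ≡⟨ ≡.cong ⟦_⟧ℤ (ℤₚ.[1+m]⊖[1+n]≡m⊖n m n) ⟩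
      ⟦ m ℤ.⊖ n ⟧ℤ                          ≈⟨ ⊖-homo m n ⟩
      m · 1# - n · 1#                       ≈⟨ +-congʳ (+-identityˡ _) ⟨
      (0# + m · 1#) - n · 1#                ≈⟨ +-congʳ (+-congʳ (-‿inverseʳ 1#)) ⟨
      (1# - 1# + m · 1#) - n · 1#           ≈⟨ +-congʳ (trans (+-assoc _ _ _) (+-congˡ (+-comm _ _))) ⟩
      (1# + (m · 1# - 1#)) - n · 1#         ≈⟨ trans (+-congʳ (sym (+-assoc _ _ _))) (+-assoc _ _ _) ⟩
      (1# + m · 1#) + (- 1# - n · 1#)       ≈⟨ +-congˡ (⁻¹-∙-comm _ _) ⟩
      (1# + m · 1#) - (1# + n · 1#)         ≈⟨ +-cong (1+× m 1#) (-‿cong (1+× n 1#)) ⟨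
      suc m · 1# - suc n · 1#               ∎

    -‿homo : ∀ i → ⟦ ℤ.- i ⟧ℤ ≈ - ⟦ i ⟧ℤ
    -‿homo (+ zero)  = sym -0#≈0#
    -‿homo (+ suc n) = refl
    -‿homo -[1+ n ]  = sym (-‿involutive _)

    +-homo : ∀ i j → ⟦ i ℤ.+ j ⟧ℤ ≈ ⟦ i ⟧ℤ + ⟦ j ⟧ℤ
    +-homo (+ m)    (+ n)    = ×-homo-+ 1# m n
    +-homo (+ m)    -[1+ n ] = ⊖-homo m (suc n)
    +-homo -[1+ m ] (+ n)    = trans (⊖-homo n (suc m)) (+-comm _ _)
    +-homo -[1+ m ] -[1+ n ] = begin
      - (suc (suc (m ℕ.+ n)) · 1#)          ≡⟨ ≡.cong (λ k → - (k · 1#)) (≡.cong suc (ℕₚ.+-suc m n)) ⟨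
      - ((suc m ℕ.+ suc n) · 1#)            ≈⟨ -‿cong (×-homo-+ 1# (suc m) (suc n)) ⟩
      - (suc m · 1# + suc n · 1#)           ≈⟨ ⁻¹-∙-comm _ _ ⟨
      - (suc m · 1#) - suc n · 1#           ∎
      where import Data.Nat.Properties as ℕₚ

    *-homo⁺ : ∀ m j → ⟦ + m ℤ.* j ⟧ℤ ≈ m · 1# * ⟦ j ⟧ℤ
    *-homo⁺ m (+ n)    = begin
      ⟦ + m ℤ.* + n ⟧ℤ                      ≡⟨ ≡.cong ⟦_⟧ℤ (ℤₚ.pos-* m n) ⟨
      (m ℕ.* n) · 1#                        ≈⟨ ×1-homo-* m n ⟩
      m · 1# * n · 1#                       ∎
    *-homo⁺ m -[1+ n ] = begin
      ⟦ + m ℤ.* -[1+ n ] ⟧ℤ                 ≡⟨ ≡.cong ⟦_⟧ℤ (ℤₚ.neg-distribʳ-* (+ m) (+ suc n)) ⟨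
      ⟦ ℤ.- (+ m ℤ.* + suc n) ⟧ℤ            ≈⟨ -‿homo (+ m ℤ.* + suc n) ⟩
      - ⟦ + m ℤ.* + suc n ⟧ℤ                ≈⟨ -‿cong (*-homo⁺ m (+ suc n)) ⟩
      - (m · 1# * suc n · 1#)               ≈⟨ -‿distribʳ-* _ _ ⟩
      m · 1# * (- (suc n · 1#))             ∎

    *-homo : ∀ i j → ⟦ i ℤ.* j ⟧ℤ ≈ ⟦ i ⟧ℤ * ⟦ j ⟧ℤ
    *-homo (+ m)    j = *-homo⁺ m j
    *-homo -[1+ m ] j = begin
      ⟦ -[1+ m ] ℤ.* j ⟧ℤ                   ≡⟨ ≡.cong ⟦_⟧ℤ (ℤₚ.neg-distribˡ-* (+ suc m) j) ⟨
      ⟦ ℤ.- (+ suc m ℤ.* j) ⟧ℤ              ≈⟨ -‿homo (+ suc m ℤ.* j) ⟩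
      - ⟦ + suc m ℤ.* j ⟧ℤ                  ≈⟨ -‿cong (*-homo⁺ (suc m) j) ⟩
      - (suc m · 1# * ⟦ j ⟧ℤ)               ≈⟨ -‿distribˡ-* _ _ ⟩
      - (suc m · 1#) * ⟦ j ⟧ℤ               ∎

    morphism : ℤ.+-*-rawRing -Raw-AlmostCommutative⟶ fromCommutativeRing R
    morphism = record
      { ⟦_⟧ = ⟦_⟧ℤ ; +-homo = +-homo ; *-homo = *-homo ; -‿homo = -‿homo
      ; 0-homo = refl ; 1-homo = refl }

    weaklyDec : WeaklyDecidable (Induced-equivalence morphism)
    weaklyDec i j with i ℤ.≟ j
    ... | yes ≡.refl = just refl
    -- Different integers may have the same image, for instance in positive characteristic.
    ... | no  _      = nothing

  open import Algebra.Solver.Ring ℤ.+-*-rawRing (fromCommutativeRing R) morphism weaklyDec public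
    using (solve; _:=_; _:+_; _:*_; :-_; _:-_; con)

-- Sublists of a fixed length and sums over lists.

sublists : ∀ {a} {A : Set a} → ℕ → List A → List (List A)
sublists zero    _        = [ [] ]
sublists (suc d) []       = []
sublists (suc d) (k ∷ ks) = map (k ∷_) (sublists d ks) ++ sublists (suc d) ks

module ListSum {c ℓ} (R : CommutativeRing c ℓ) where
  open CommutativeRing R hiding (zero)
  open IntegerSolver R

  Σ[_] : ∀ {a} {A : Set a} → List A → (A → Carrier) → Carrier
  Σ[ []     ] f = 0#
  Σ[ x ∷ xs ] f = f x + Σ[ xs ] f

  module _ {a} {A : Set a} where

    Σ-cong : ∀ (xs : List A) {f g} → (∀ x → x ∈ xs → f x ≈ g x) → Σ[ xs ] f ≈ Σ[ xs ] g
    Σ-cong []       p = refl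
    Σ-cong (x ∷ xs) p = +-cong (p x (here ≡.refl)) (Σ-cong xs λ y → p y ∘ there)

    Σ-zero : ∀ (xs : List A) {f} → (∀ x → x ∈ xs → f x ≈ 0#) → Σ[ xs ] f ≈ 0#
    Σ-zero []       p = refl
    Σ-zero (x ∷ xs) p = trans (+-cong (p x (here ≡.refl)) (Σ-zero xs λ y → p y ∘ there)) (+-identityˡ 0#)

    Σ-++ : ∀ (xs ys : List A) f → Σ[ xs ++ ys ] f ≈ Σ[ xs ] f + Σ[ ys ] f
    Σ-++ []       ys f = sym (+-identityˡ _)
    Σ-++ (x ∷ xs) ys f = trans (+-congˡ (Σ-++ xs ys f)) (sym (+-assoc _ _ _))

    Σ-map : ∀ {b} {B : Set b} (h : B → A) (xs : List B) f → Σ[ map h xs ] f ≈ Σ[ xs ] (f ∘ h)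
    Σ-map h []       f = refl
    Σ-map h (x ∷ xs) f = +-congˡ (Σ-map h xs f)

    Σ-*ˡ : ∀ (xs : List A) x f → Σ[ xs ] (λ k → x * f k) ≈ x * Σ[ xs ] f
    Σ-*ˡ []       x f = sym (zeroʳ x)
    Σ-*ˡ (k ∷ xs) x f = trans (+-congˡ (Σ-*ˡ xs x f)) (sym (distribˡ x _ _))

    Σ-+ : ∀ (xs : List A) f g → Σ[ xs ] (λ k → f k + g k) ≈ Σ[ xs ] f + Σ[ xs ] g
    Σ-+ []       f g = sym (+-identityˡ 0#)
    Σ-+ (k ∷ xs) f g = trans (+-congˡ (Σ-+ xs f g))
      (solve 4 (λ a b x y → (a :+ b) :+ (x :+ y) := (a :+ x) :+ (b :+ y)) refl _ _ _ _)

-- Determinants as iterated contractions, and the Cauchy-Binet formula.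

module Contraction {c ℓ} (R : CommutativeRing c ℓ) where
  open CommutativeRing R hiding (zero)
  open IntegerSolver R
  open ListSum R
  open import Algebra.Properties.Ring ring
  open SetoidReasoning setoid

  sgn : ℕ → Carrier
  sgn zero    = 1#
  sgn (suc n) = - sgn n

  sgn-square : ∀ n → sgn n * sgn n ≈ 1#
  sgn-square zero    = *-identityˡ 1#
  sgn-square (suc n) = trans (solve 1 (λ s → (:- s) :* (:- s) := s :* s) refl (sgn n)) (sgn-square n)

  infixr 6 _⌟_
  -- Expansion along a row f: the signed sum over the ways to remove one entry from the list. `Φ` is
  -- any function of lists; the sign rules below come from positions alone, so it need not be
  -- alternating.
  _⌟_ : ∀ {b} {B : Set b} → (B → Carrier) → (List B → Carrier) → List B → Carrier
  (f ⌟ Φ) []       = 0#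
  (f ⌟ Φ) (b ∷ bs) = f b * Φ bs - (f ⌟ (Φ ∘ (b ∷_))) bs

  -- Zero on nonempty lists, so that `Δ` vanishes whenever the numbers of rows and columns differ.
  𝟙 : ∀ {b} {B : Set b} → List B → Carrier
  𝟙 []      = 1#
  𝟙 (_ ∷ _) = 0#

  -- The determinant of the matrix with entries M a b, rows a and columns b
  -- running through two lists, by expansion along the first row.
  Δ : ∀ {a b} {A : Set a} {B : Set b} → (A → B → Carrier) → List A → List B → Carrier
  Δ M []       = 𝟙
  Δ M (a ∷ as) = M a ⌟ Δ M as

  module _ {b} {B : Set b} where

    -- The contraction reads `Φ` only on lists one entry shorter than `bs`; this allows induction
    -- hypotheses that carry a condition on lengths.
    ⌟-cong-length : ∀ {f g : B → Carrier} {Φ Ψ} bs → (∀ b → f b ≈ g b) →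
                    (∀ bs′ → suc (length bs′) ≡ length bs → Φ bs′ ≈ Ψ bs′) → (f ⌟ Φ) bs ≈ (g ⌟ Ψ) bs
    ⌟-cong-length []       p q = refl
    ⌟-cong-length (b ∷ bs) p q = +-cong (*-cong (p b) (q bs ≡.refl))
      (-‿cong (⌟-cong-length bs p λ bs′ e → q (b ∷ bs′) (≡.cong suc e)))

    ⌟-cong : ∀ {f g : B → Carrier} {Φ Ψ} → (∀ b → f b ≈ g b) →
             (∀ bs → Φ bs ≈ Ψ bs) → ∀ bs → (f ⌟ Φ) bs ≈ (g ⌟ Ψ) bs
    ⌟-cong p q bs = ⌟-cong-length bs p λ bs′ _ → q bs′

    ⌟-congˡ : ∀ {f g : B → Carrier} {Φ} → (∀ b → f b ≈ g b) → ∀ bs → (f ⌟ Φ) bs ≈ (g ⌟ Φ) bs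
    ⌟-congˡ p = ⌟-cong p λ _ → refl

    ⌟-congʳ : ∀ {f : B → Carrier} {Φ Ψ} → (∀ bs → Φ bs ≈ Ψ bs) → ∀ bs → (f ⌟ Φ) bs ≈ (f ⌟ Ψ) bs
    ⌟-congʳ = ⌟-cong λ _ → refl

    ⌟-linearˡ : ∀ x (f g : B → Carrier) Φ bs →
                ((λ b → x * f b + g b) ⌟ Φ) bs ≈ x * (f ⌟ Φ) bs + (g ⌟ Φ) bs
    ⌟-linearˡ x f g Φ []       = solve 1 (λ x → con (+ 0) := x :* con (+ 0) :+ con (+ 0)) refl x
    ⌟-linearˡ x f g Φ (b ∷ bs) = trans (+-congˡ (-‿cong (⌟-linearˡ x f g (Φ ∘ (b ∷_)) bs)))
      (solve 6 (λ x f g Φ F G → (x :* f :+ g) :* Φ :- (x :* F :+ G)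
                             := x :* (f :* Φ :- F) :+ (g :* Φ :- G)) refl x _ _ _ _ _)

    ⌟-linearʳ : ∀ x (f : B → Carrier) Φ Ψ bs →
                (f ⌟ (λ bs → x * Φ bs + Ψ bs)) bs ≈ x * (f ⌟ Φ) bs + (f ⌟ Ψ) bs
    ⌟-linearʳ x f Φ Ψ []       = solve 1 (λ x → con (+ 0) := x :* con (+ 0) :+ con (+ 0)) refl x
    ⌟-linearʳ x f Φ Ψ (b ∷ bs) = trans (+-congˡ (-‿cong (⌟-linearʳ x f _ _ bs)))
      (solve 6 (λ x f Φ Ψ F G → f :* (x :* Φ :+ Ψ) :- (x :* F :+ G)
                             := x :* (f :* Φ :- F) :+ (f :* Ψ :- G)) refl x _ _ _ _ _)

    ⌟-minusʳ : ∀ x (f : B → Carrier) Φ Ψ bs →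
               (f ⌟ (λ bs → x * Φ bs - Ψ bs)) bs ≈ x * (f ⌟ Φ) bs - (f ⌟ Ψ) bs
    ⌟-minusʳ x f Φ Ψ []       = solve 1 (λ x → con (+ 0) := x :* con (+ 0) :- con (+ 0)) refl x
    ⌟-minusʳ x f Φ Ψ (b ∷ bs) = trans (+-congˡ (-‿cong (⌟-minusʳ x f _ _ bs)))
      (solve 6 (λ x f Φ Ψ F G → f :* (x :* Φ :- Ψ) :- (x :* F :- G)
                             := x :* (f :* Φ :- F) :- (f :* Ψ :- G)) refl x _ _ _ _ _)

    ⌟-zeroˡ : ∀ {f : B → Carrier} {Φ} {bs} → All (λ b → f b ≈ 0#) bs → (f ⌟ Φ) bs ≈ 0#
    ⌟-zeroˡ []       = refl
    ⌟-zeroˡ (p ∷ ps) = trans (+-cong (*-congʳ p) (-‿cong (⌟-zeroˡ ps)))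
      (trans (+-cong (zeroˡ _) -0#≈0#) (+-identityˡ 0#))

    ⌟-zeroʳ : ∀ {f : B → Carrier} {Φ} → (∀ bs → Φ bs ≈ 0#) → ∀ bs → (f ⌟ Φ) bs ≈ 0#
    ⌟-zeroʳ p []       = refl
    ⌟-zeroʳ p (b ∷ bs) = trans (+-cong (*-congˡ (p bs)) (-‿cong (⌟-zeroʳ (p ∘ (b ∷_)) bs)))
      (trans (+-cong (zeroʳ _) -0#≈0#) (+-identityˡ 0#))

    -- Split by the use of the first entry b: taken by f, taken by g, or left in place. The first
    -- two kinds of terms carry opposite signs; the last is the induction hypothesis.
    ⌟-anticomm : ∀ (f g : B → Carrier) Φ bs → (f ⌟ g ⌟ Φ) bs ≈ - (g ⌟ f ⌟ Φ) bs
    ⌟-anticomm f g Φ []       = sym -0#≈0#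
    ⌟-anticomm f g Φ (b ∷ bs) = begin
      f b * (g ⌟ Φ) bs - (f ⌟ (λ bs → g b * Φ bs - (g ⌟ Φ ∘ (b ∷_)) bs)) bs
        ≈⟨ +-congˡ (-‿cong (trans (⌟-minusʳ _ f _ _ bs) (+-congˡ (-‿cong (⌟-anticomm f g _ bs))))) ⟩
      f b * (g ⌟ Φ) bs - (g b * (f ⌟ Φ) bs - - (g ⌟ f ⌟ Φ ∘ (b ∷_)) bs)
        ≈⟨ solve 3 (λ x y z → x :- (y :- (:- z)) := :- (y :- (x :- z))) refl _ _ _ ⟩
      - (g b * (f ⌟ Φ) bs - (f b * (g ⌟ Φ) bs - (g ⌟ f ⌟ Φ ∘ (b ∷_)) bs))
        ≈⟨ -‿cong (+-congˡ (-‿cong (⌟-minusʳ _ g _ _ bs))) ⟨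
      - (g ⌟ f ⌟ Φ) (b ∷ bs) ∎

    -- Anticommutation yields only 2x = 0, which does not suffice over a general ring, hence a
    -- separate induction.
    ⌟-square : ∀ (f : B → Carrier) Φ bs → (f ⌟ f ⌟ Φ) bs ≈ 0#
    ⌟-square f Φ []       = refl
    ⌟-square f Φ (b ∷ bs) = begin
      f b * (f ⌟ Φ) bs - (f ⌟ (λ bs → f b * Φ bs - (f ⌟ Φ ∘ (b ∷_)) bs)) bs
        ≈⟨ +-congˡ (-‿cong (trans (⌟-minusʳ _ f _ _ bs) (+-congˡ (-‿cong (⌟-square f _ bs))))) ⟩
      f b * (f ⌟ Φ) bs - (f b * (f ⌟ Φ) bs - 0#)
        ≈⟨ solve 1 (λ x → x :- (x :- con (+ 0)) := con (+ 0)) refl _ ⟩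
      0# ∎

    -- Terms in which the last column survives vanish by hypothesis.
    ⌟-last : ∀ (f : B → Carrier) Φ u → (∀ bs → Φ (bs ++ [ u ]) ≈ 0#) →
             ∀ bs → (f ⌟ Φ) (bs ++ [ u ]) ≈ sgn (length bs) * (f u * Φ bs)
    ⌟-last f Φ u p []       = solve 1 (λ x → x :- con (+ 0) := con (+ 1) :* x) refl _
    ⌟-last f Φ u p (b ∷ bs) = begin
      f b * Φ (bs ++ [ u ]) - (f ⌟ Φ ∘ (b ∷_)) (bs ++ [ u ])
        ≈⟨ +-cong (*-congˡ (p bs)) (-‿cong (⌟-last f _ u (p ∘ (b ∷_)) bs)) ⟩
      f b * 0# - sgn (length bs) * (f u * Φ (b ∷ bs))
        ≈⟨ solve 3 (λ x y z → x :* con (+ 0) :- y :* z := (:- y) :* z) refl _ _ _ ⟩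
      (- sgn (length bs)) * (f u * Φ (b ∷ bs)) ∎

    ⌟-++ : ∀ (f : B → Carrier) Φ bs {us} → All (λ u → f u ≈ 0#) us →
           (f ⌟ Φ) (bs ++ us) ≈ (f ⌟ (λ bs → Φ (bs ++ us))) bs
    ⌟-++ f Φ []       p = ⌟-zeroˡ p
    ⌟-++ f Φ (b ∷ bs) p = +-congˡ (-‿cong (⌟-++ f (Φ ∘ (b ∷_)) bs p))

    ⌟-Σ : ∀ {k} {K : Set k} (f : B → Carrier) (ks : List K) (t : K → List B → Carrier) bs →
          (f ⌟ (λ bs → Σ[ ks ] (λ k → t k bs))) bs ≈ Σ[ ks ] (λ k → (f ⌟ t k) bs)
    ⌟-Σ f []       t bs = ⌟-zeroʳ (λ _ → refl) bs
    ⌟-Σ f (k ∷ ks) t bs = begin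
      (f ⌟ (λ bs → t k bs + Σ[ ks ] (λ k → t k bs))) bs
        ≈⟨ ⌟-congʳ (λ bs → +-congʳ (sym (*-identityˡ (t k bs)))) bs ⟩
      (f ⌟ (λ bs → 1# * t k bs + Σ[ ks ] (λ k → t k bs))) bs
        ≈⟨ ⌟-linearʳ 1# f (t k) _ bs ⟩
      1# * (f ⌟ t k) bs + (f ⌟ (λ bs → Σ[ ks ] (λ k → t k bs))) bs
        ≈⟨ +-cong (*-identityˡ _) (⌟-Σ f ks t bs) ⟩
      (f ⌟ t k) bs + Σ[ ks ] (λ k → (f ⌟ t k) bs) ∎

    ⌟-*ʳ : ∀ x (f : B → Carrier) Φ bs → (f ⌟ (λ bs → x * Φ bs)) bs ≈ x * (f ⌟ Φ) bs
    ⌟-*ʳ x f Φ []       = sym (zeroʳ x)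
    ⌟-*ʳ x f Φ (b ∷ bs) = trans (+-congˡ (-‿cong (⌟-*ʳ x f _ bs)))
      (solve 4 (λ x f Φ F → f :* (x :* Φ) :- x :* F := x :* (f :* Φ :- F)) refl x _ _ _)

  module _ {a b} {A : Set a} {B : Set b} where

    -- Removals from two different lists are independent of each other. This is what makes expansion
    -- along rows agree with expansion along columns.
    ⌟-exchange : ∀ (f : B → Carrier) (g : A → Carrier) (Φ : List B → List A → Carrier) bs as →
                 (f ⌟ (λ bs → (g ⌟ Φ bs) as)) bs ≈ (g ⌟ (λ as → (f ⌟ (λ bs → Φ bs as)) bs)) as
    ⌟-exchange f g Φ []       as = sym (⌟-zeroʳ (λ _ → refl) as)
    ⌟-exchange f g Φ (b ∷ bs) as =
      trans (+-congˡ (-‿cong (⌟-exchange f g (Φ ∘ (b ∷_)) bs as))) (sym (⌟-minusʳ (f b) g _ _ as))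

  module _ {a b} {A : Set a} {B : Set b} where

    Δ-column : ∀ (M : A → B → Carrier) bs a as →
               Δ (flip M) bs (a ∷ as) ≈ (M a ⌟ (λ bs → Δ (flip M) bs as)) bs
    Δ-column M []       a as = refl
    Δ-column M (b ∷ bs) a as = +-congˡ $ -‿cong $ trans
      (⌟-congʳ (Δ-column M bs a) as)
      (⌟-exchange (flip M b) (M a) (λ as bs → Δ (flip M) bs as) as bs)

    Δ-transpose : ∀ (M : A → B → Carrier) as bs → Δ M as bs ≈ Δ (flip M) bs as
    Δ-transpose M []       []       = refl
    Δ-transpose M []       (b ∷ bs) = refl
    Δ-transpose M (a ∷ as) bs       =
      trans (⌟-congʳ (Δ-transpose M as) bs) (sym (Δ-column M bs a as))

    Δ-cong : ∀ {M N : A → B → Carrier} → (∀ a b → M a b ≈ N a b) → ∀ as bs → Δ M as bs ≈ Δ N as bs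
    Δ-cong p []       bs = refl
    Δ-cong p (a ∷ as) bs = ⌟-cong (p a) (Δ-cong p as) bs

    Δ-map : ∀ {k} {K : Set k} (M : A → B → Carrier) (h : K → A) ks bs → Δ M (map h ks) bs ≈ Δ (M ∘ h) ks bs
    Δ-map M h []       bs = refl
    Δ-map M h (k ∷ ks) bs = ⌟-congʳ (Δ-map M h ks) bs

    Δ-repeat : ∀ (M : A → B → Carrier) {a as} → a ∈ as → ∀ bs → (M a ⌟ Δ M as) bs ≈ 0#
    Δ-repeat M     (here ≡.refl) bs = ⌟-square (M _) _ bs
    Δ-repeat M {a} (there {x = a′} a∈as) bs = trans (⌟-anticomm (M a) (M a′) _ bs)
      (trans (-‿cong (⌟-zeroʳ (Δ-repeat M a∈as) bs)) -0#≈0#)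

    -- The last row anticommutes past all the others on its way to the front.
    Δ-snoc : ∀ (M : A → B → Carrier) as a bs → Δ M (as ++ [ a ]) bs ≈ sgn (length as) * (M a ⌟ Δ M as) bs
    Δ-snoc M []        a bs = sym (*-identityˡ _)
    Δ-snoc M (a′ ∷ as) a bs = begin
      (M a′ ⌟ Δ M (as ++ [ a ])) bs                             ≈⟨ ⌟-congʳ (Δ-snoc M as a) bs ⟩
      (M a′ ⌟ (λ bs → sgn (length as) * (M a ⌟ Δ M as) bs)) bs  ≈⟨ ⌟-*ʳ _ (M a′) _ bs ⟩
      sgn (length as) * (M a′ ⌟ M a ⌟ Δ M as) bs                ≈⟨ *-congˡ (⌟-anticomm (M a′) (M a) _ bs) ⟩
      sgn (length as) * - (M a ⌟ M a′ ⌟ Δ M as) bs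
        ≈⟨ solve 2 (λ x y → x :* (:- y) := (:- x) :* y) refl _ _ ⟩
      (- sgn (length as)) * (M a ⌟ M a′ ⌟ Δ M as) bs            ∎

    Δ-zero-last : ∀ (M : A → B → Carrier) as u → All (λ a → M a u ≈ 0#) as →
                  ∀ bs → Δ M as (bs ++ [ u ]) ≈ 0#
    Δ-zero-last M []       u p []      = refl
    Δ-zero-last M []       u p (_ ∷ _) = refl
    Δ-zero-last M (a ∷ as) u (p ∷ ps) bs = begin
      (M a ⌟ Δ M as) (bs ++ [ u ])               ≈⟨ ⌟-last (M a) _ u (Δ-zero-last M as u ps) bs ⟩
      sgn (length bs) * (M a u * Δ M as bs)      ≈⟨ *-congˡ (trans (*-congʳ p) (zeroˡ _)) ⟩
      sgn (length bs) * 0#                       ≈⟨ zeroʳ _ ⟩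
      0#                                         ∎

    -- Functoriality of exterior powers, by induction on the rows. `T` pairs a function of sublists
    -- with the minors of `N`, and `T-⌟` says that it turns contraction by coefficients c into
    -- contraction by the combined row Σ c k · N k.
    cauchyBinet : ∀ {k} {K : Set k} (M : A → B → Carrier) (C : A → K → Carrier) (N : K → B → Carrier) ks as →
      All (λ a → ∀ b → M a b ≈ Σ[ ks ] (λ k → C a k * N k b)) as →
      ∀ bs → Δ M as bs ≈ Σ[ sublists (length as) ks ] (λ κ → Δ C as κ * Δ N κ bs)
    cauchyBinet {K = K} M C N ks []       []       bs = solve 1 (λ x → x := con (+ 1) :* x :+ con (+ 0)) refl (𝟙 bs)
    cauchyBinet {K = K} M C N ks (a ∷ as) (p ∷ ps) bs = begin
      (M a ⌟ Δ M as) bs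
        ≈⟨ ⌟-cong p (cauchyBinet M C N ks as ps) bs ⟩
      ((λ b → Σ[ ks ] (λ k → C a k * N k b)) ⌟ T (length as) ks (Δ C as)) bs
        ≈⟨ T-⌟ (length as) ks (Δ C as) bs ⟨
      T (suc (length as)) ks (C a ⌟ Δ C as) bs ∎
      where
      T : ℕ → List K → (List K → Carrier) → List B → Carrier
      T d ks Φ bs = Σ[ sublists d ks ] (λ κ → Φ κ * Δ N κ bs)

      T-minus : ∀ d ks x Φ Ψ bs → T d ks (λ κ → x * Φ κ - Ψ κ) bs ≈ x * T d ks Φ bs - T d ks Ψ bs
      T-minus d ks x Φ Ψ bs = begin
        T d ks (λ κ → x * Φ κ - Ψ κ) bs
          ≈⟨ Σ-cong (sublists d ks) (λ κ _ → solve 4 (λ x p q d → (x :* p :- q) :* d := x :* (p :* d) :+ (con -[1+ 0 ] :* (q :* d))) refl _ _ _ _) ⟩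
        Σ[ sublists d ks ] (λ κ → x * (Φ κ * Δ N κ bs) + (- 1# * (Ψ κ * Δ N κ bs)))
          ≈⟨ trans (Σ-+ (sublists d ks) _ _) (+-cong (Σ-*ˡ (sublists d ks) x _) (Σ-*ˡ (sublists d ks) (- 1#) _)) ⟩
        x * T d ks Φ bs + - 1# * T d ks Ψ bs
          ≈⟨ +-congˡ (-1*x≈-x _) ⟩
        x * T d ks Φ bs - T d ks Ψ bs ∎

      T-∷ : ∀ d k ks Φ bs → T (suc d) (k ∷ ks) Φ bs ≈ (N k ⌟ T d ks (Φ ∘ (k ∷_))) bs + T (suc d) ks Φ bs
      T-∷ d k ks Φ bs = begin
        T (suc d) (k ∷ ks) Φ bs
          ≈⟨ Σ-++ (map (k ∷_) (sublists d ks)) _ _ ⟩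
        Σ[ map (k ∷_) (sublists d ks) ] (λ κ → Φ κ * Δ N κ bs) + T (suc d) ks Φ bs
          ≈⟨ +-congʳ (Σ-map (k ∷_) (sublists d ks) _) ⟩
        Σ[ sublists d ks ] (λ κ → Φ (k ∷ κ) * (N k ⌟ Δ N κ) bs) + T (suc d) ks Φ bs
          ≈⟨ +-congʳ (Σ-cong (sublists d ks) λ κ _ → ⌟-*ʳ _ (N k) _ bs) ⟨
        Σ[ sublists d ks ] (λ κ → (N k ⌟ (λ bs → Φ (k ∷ κ) * Δ N κ bs)) bs) + T (suc d) ks Φ bs
          ≈⟨ +-congʳ (⌟-Σ (N k) (sublists d ks) _ bs) ⟨
        (N k ⌟ T d ks (Φ ∘ (k ∷_))) bs + T (suc d) ks Φ bs ∎

      T-⌟ : ∀ {c : K → Carrier} d ks Φ bs →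
            T (suc d) ks (c ⌟ Φ) bs ≈ ((λ b → Σ[ ks ] (λ k → c k * N k b)) ⌟ T d ks Φ) bs
      T-⌟     d       []       Φ bs = sym (⌟-zeroˡ (All.universal (λ _ → refl) bs))
      T-⌟ {c} zero    (k ∷ ks) Φ bs = begin
        T 1 (k ∷ ks) (c ⌟ Φ) bs
          ≈⟨ trans (T-∷ 0 k ks (c ⌟ Φ) bs) (+-congˡ (T-⌟ zero ks Φ bs)) ⟩
        (N k ⌟ T 0 ks (λ κ → c k * Φ κ - (c ⌟ Φ ∘ (k ∷_)) κ)) bs + (G ⌟ T 0 ks Φ) bs
          ≈⟨ +-congʳ (trans (⌟-congʳ (λ bs → solve 3 (λ c p d → (c :* p :- con (+ 0)) :* d :+ con (+ 0) := c :* (p :* d :+ con (+ 0))) refl _ _ _) bs)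
                            (⌟-*ʳ (c k) (N k) _ bs)) ⟩
        c k * (N k ⌟ T 0 ks Φ) bs + (G ⌟ T 0 ks Φ) bs
          ≈⟨ ⌟-linearˡ (c k) (N k) G _ bs ⟨
        ((λ b → c k * N k b + G b) ⌟ T 0 ks Φ) bs ∎
        where G = λ b → Σ[ ks ] (λ k → c k * N k b)
      T-⌟ {c} (suc d) (k ∷ ks) Φ bs = begin
        T (2 ℕ.+ d) (k ∷ ks) (c ⌟ Φ) bs
          ≈⟨ trans (T-∷ (suc d) k ks (c ⌟ Φ) bs) (+-congˡ (T-⌟ (suc d) ks Φ bs)) ⟩
        (N k ⌟ T (suc d) ks (λ κ → c k * Φ κ - (c ⌟ Φ ∘ (k ∷_)) κ)) bs + g T′
          ≈⟨ +-congʳ (trans (⌟-congʳ (λ bs → trans (T-minus (suc d) ks (c k) Φ _ bs)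
               (+-congˡ (-‿cong (T-⌟ d ks (Φ ∘ (k ∷_)) bs)))) bs) (⌟-minusʳ (c k) (N k) _ _ bs)) ⟩
        (c k * n T′ - (N k ⌟ G ⌟ T d ks (Φ ∘ (k ∷_))) bs) + g T′
          ≈⟨ +-congʳ (+-congˡ (-‿cong (⌟-anticomm (N k) G _ bs))) ⟩
        (c k * n T′ - - g S) + g T′
          ≈⟨ solve 4 (λ c n x g → (c :* n :- (:- x)) :+ g := (c :* con (+ 0) :+ x) :+ (c :* n :+ g)) refl _ _ _ _ ⟩
        -- The zero stands for `n S`, where the row `N k` would occur twice. Inserting it completes
        -- both halves to contractions by the full row c k * N k + G.
        (c k * 0# + g S) + (c k * n T′ + g T′)
          ≈⟨ +-congʳ (+-congʳ (*-congˡ (⌟-square (N k) _ bs))) ⟨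
        (c k * n S + g S) + (c k * n T′ + g T′)
          ≈⟨ +-cong (⌟-linearˡ (c k) (N k) G _ bs) (⌟-linearˡ (c k) (N k) G _ bs) ⟨
        ((λ b → c k * N k b + G b) ⌟ S) bs + ((λ b → c k * N k b + G b) ⌟ T′) bs
          ≈⟨ trans (+-congʳ (sym (*-identityˡ _))) (sym (⌟-linearʳ 1# _ S T′ bs)) ⟩
        ((λ b → c k * N k b + G b) ⌟ (λ bs → 1# * S bs + T′ bs)) bs
          ≈⟨ ⌟-congʳ (λ bs → trans (+-congʳ (*-identityˡ _)) (sym (T-∷ d k ks Φ bs))) bs ⟩
        ((λ b → c k * N k b + G b) ⌟ T (suc d) (k ∷ ks) Φ) bs ∎
        where
        G = λ b → Σ[ ks ] (λ k → c k * N k b)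
        S  = N k ⌟ T d ks (Φ ∘ (k ∷_))
        T′ = T (suc d) ks Φ
        g n : (List B → Carrier) → Carrier
        g Ψ = (G ⌟ Ψ) bs
        n Ψ = (N k ⌟ Ψ) bs

-- Determinants under column operations, with unit columns, and of triangular matrices.

tabulate-toℕ : ∀ {a} {A : Set a} (f : ℕ → A) n → tabulate {n = n} (f ∘ toℕ) ≡ applyUpTo f n
tabulate-toℕ f zero    = ≡.refl
tabulate-toℕ f (suc n) = ≡.cong (f 0 ∷_) (tabulate-toℕ (f ∘ suc) n)

-- Maya n holes beads: {0,…,n-1} is the disjoint union of the decreasing list of
-- holes and the increasing list of beads.
data Maya : ℕ → List ℕ → List ℕ → Set where
  empty : Maya 0 [] []
  hole  : ∀ {n hs us} → Maya n hs us → Maya (suc n) (n ∷ hs) us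
  bead  : ∀ {n hs us} → Maya n hs us → Maya (suc n) hs (us ++ [ n ])

Maya-length : ∀ {n hs us} → Maya n hs us → length hs ℕ.+ length us ≡ n
Maya-length empty    = ≡.refl
Maya-length (hole m) = ≡.cong suc (Maya-length m)
Maya-length {hs = hs} (bead {n} {us = us} m) = begin
  length hs ℕ.+ length (us ++ [ n ])  ≡⟨ ≡.cong (length hs ℕ.+_) (Listₚ.length-++ us) ⟩
  length hs ℕ.+ (length us ℕ.+ 1)     ≡⟨ ≡.cong (length hs ℕ.+_) (ℕₚ.+-comm (length us) 1) ⟩
  length hs ℕ.+ suc (length us)       ≡⟨ ℕₚ.+-suc (length hs) (length us) ⟩
  suc (length hs ℕ.+ length us)       ≡⟨ ≡.cong suc (Maya-length m) ⟩
  suc n                               ∎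
  where open ≡.≡-Reasoning

Maya-bounded : ∀ {n hs us} → Maya n hs us → All (_< n) us
Maya-bounded empty    = []
Maya-bounded (hole m) = All.map ℕₚ.m≤n⇒m≤1+n (Maya-bounded m)
Maya-bounded (bead m) = Allₚ.++⁺ (All.map ℕₚ.m≤n⇒m≤1+n (Maya-bounded m)) (ℕₚ.≤-refl ∷ [])

-- The obstruction to `qs` lying below `ps` entry by entry; minors of a triangular matrix with such
-- coordinates vanish.
data Exceeds : List ℕ → List ℕ → Set where
  now   : ∀ {p q ps qs} → p < q → Exceeds (p ∷ ps) (q ∷ qs)
  later : ∀ {p q ps qs} → Exceeds ps qs → Exceeds (p ∷ ps) (q ∷ qs)

module Determinants {c ℓ} (R : CommutativeRing c ℓ) where
  open CommutativeRing R hiding (zero)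
  open IntegerSolver R
  open Contraction R
  open import Algebra.Properties.Ring ring
  open import Algebra.Definitions.RawMonoid +-rawMonoid using (sum)
  open import Algebra.Definitions.RawSemiring (RawRing.rawSemiring rawRing) using (_^_)
  open import Algebra.Properties.CommutativeMonoid.Sum +-commutativeMonoid using (sum-cong-≋)
  open import Algebra.Properties.Semiring.Sum semiring using (*-distribˡ-sum)
  open SetoidReasoning setoid

  ⌟-tabulate : ∀ {b} {B : Set b} {n} (f : B → Carrier) Φ (σ : Fin (suc n) → B) →
    (f ⌟ Φ) (tabulate σ) ≈ sum λ j → (((- 1#) ^ toℕ j) * f (σ j)) * Φ (tabulate (σ ∘ punchIn j))
  ⌟-tabulate {n = zero}  f Φ σ = solve 2 (λ x y → x :* y :- con (+ 0) := (con (+ 1) :* x) :* y :+ con (+ 0)) refl _ _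
  ⌟-tabulate {n = suc n} f Φ σ = +-cong (*-congʳ (sym (*-identityˡ _))) (begin
    - (f ⌟ Φ ∘ (σ Fin.zero ∷_)) (tabulate (σ ∘ Fin.suc))
      ≈⟨ trans (-‿cong (⌟-tabulate f (Φ ∘ (σ Fin.zero ∷_)) (σ ∘ Fin.suc))) (sym (-1*x≈-x (sum t))) ⟩
    - 1# * sum t
      ≈⟨ *-distribˡ-sum (- 1#) t ⟩
    sum (λ j → - 1# * t j)
      ≈⟨ sum-cong-≋ {suc n} (λ j → trans (sym (*-assoc (- 1#) _ (Ψ j))) (*-congʳ {Ψ j} (sym (*-assoc (- 1#) ((- 1#) ^ toℕ j) (f (σ (Fin.suc j))))))) ⟩
    sum (λ j → (((- 1#) ^ toℕ (Fin.suc j)) * f (σ (Fin.suc j))) * Ψ j) ∎)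
    where
    Ψ t : Fin (suc n) → Carrier
    Ψ j = Φ (tabulate (σ ∘ punchIn (Fin.suc j)))
    t j = (((- 1#) ^ toℕ j) * f (σ (Fin.suc j))) * Ψ j

  -- Rows and columns are labelled through ρ and σ, so that a minor, which replaces σ by
  -- `σ ∘ punchIn j`, has the same form again.
  det≈Δ : ∀ {a b} {A : Set a} {B : Set b} (M : A → B → Carrier) n (ρ : Fin n → A) (σ : Fin n → B) →
          det rawRing (λ i j → M (ρ i) (σ j)) ≈ Δ M (tabulate ρ) (tabulate σ)
  det≈Δ M zero    ρ σ = refl
  det≈Δ M (suc n) ρ σ = trans
    (sum-cong-≋ {suc n} λ j → *-congˡ {((- 1#) ^ toℕ j) * M (ρ Fin.zero) (σ j)} (det≈Δ M n (ρ ∘ Fin.suc) (σ ∘ punchIn j)))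
    (sym (⌟-tabulate (M (ρ Fin.zero)) (Δ M (tabulate (ρ ∘ Fin.suc))) σ))

  -- The matrix is transposed here: the columns of a Jacobi-Trudi matrix become functions `x j`, and
  -- its rows become the points at which they are evaluated.
  det-columns : ∀ {b} {B : Set b} (x : ℕ → B → Carrier) n (ρ : Fin n → B) →
                det rawRing (λ i j → x (toℕ j) (ρ i)) ≈ Δ x (upTo n) (tabulate ρ)
  det-columns x n ρ = begin
    det rawRing (λ i j → x (toℕ j) (ρ i))           ≈⟨ det≈Δ (flip x) n ρ toℕ ⟩
    Δ (flip x) (tabulate ρ) (tabulate {n = n} toℕ)  ≈⟨ Δ-transpose (flip x) (tabulate ρ) (tabulate {n = n} toℕ) ⟩
    Δ x (tabulate {n = n} toℕ) (tabulate ρ)         ≡⟨ ≡.cong (λ l → Δ x l (tabulate ρ)) (tabulate-toℕ id n) ⟩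
    Δ x (upTo n) (tabulate ρ)                       ∎

  -- Linear combinations of `x r` for r < n. Each constructor compares functions by their values,
  -- since no equality of functions is available.
  data InSpan {b} {B : Set b} (x : ℕ → B → Carrier) : ℕ → (B → Carrier) → Set (b ⊔ c ⊔ ℓ) where
    zeroₛ : ∀ {n g} → (∀ b → g b ≈ 0#) → InSpan x n g
    addₛ  : ∀ {n g g′ r} s → r < n → InSpan x n g → (∀ b → g′ b ≈ s * x r b + g b) → InSpan x n g′

  module _ {b} {B : Set b} {x : ℕ → B → Carrier} where

    ⌟-InSpan : ∀ {n g} → InSpan x n g → ∀ bs → (g ⌟ Δ x (upTo n)) bs ≈ 0#
    ⌟-InSpan (zeroₛ p) bs = ⌟-zeroˡ (All.universal p bs)
    ⌟-InSpan {n} (addₛ {g = g} {r = r} s r<n sp p) bs = begin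
      (_ ⌟ Δ x (upTo n)) bs
        ≈⟨ ⌟-congˡ p bs ⟩
      ((λ b → s * x r b + g b) ⌟ Δ x (upTo n)) bs
        ≈⟨ ⌟-linearˡ s (x r) g _ bs ⟩
      s * (x r ⌟ Δ x (upTo n)) bs + (g ⌟ Δ x (upTo n)) bs
        ≈⟨ +-cong (*-congˡ (Δ-repeat x (∈ₚ.∈-upTo⁺ r<n) bs)) (⌟-InSpan sp bs) ⟩
      s * 0# + 0#
        ≈⟨ solve 1 (λ s → s :* con (+ 0) :+ con (+ 0) := con (+ 0)) refl s ⟩
      0# ∎

    -- The signs are those of the reversal of the list of rows.
    Δ-unitriangular : ∀ {y g : ℕ → B → Carrier} → (∀ q b → y q b ≈ sgn q * x q b + g q b) →
      (∀ q → InSpan x q (g q)) → ∀ n bs → Δ y (downFrom n) bs ≈ Δ x (upTo n) bs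
    Δ-unitriangular y≈ sp zero    bs = refl
    Δ-unitriangular {y} {g} y≈ sp (suc n) bs = begin
      (y n ⌟ Δ y (downFrom n)) bs
        ≈⟨ ⌟-cong (y≈ n) (Δ-unitriangular y≈ sp n) bs ⟩
      ((λ b → sgn n * x n b + g n b) ⌟ Δ x (upTo n)) bs
        ≈⟨ ⌟-linearˡ (sgn n) (x n) (g n) _ bs ⟩
      sgn n * (x n ⌟ Δ x (upTo n)) bs + (g n ⌟ Δ x (upTo n)) bs
        ≈⟨ trans (+-congˡ (⌟-InSpan (sp n) bs)) (+-identityʳ _) ⟩
      sgn n * (x n ⌟ Δ x (upTo n)) bs
        ≡⟨ ≡.cong (λ k → sgn k * (x n ⌟ Δ x (upTo n)) bs) (Listₚ.length-upTo n) ⟨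
      sgn (length (upTo n)) * (x n ⌟ Δ x (upTo n)) bs
        ≈⟨ Δ-snoc x (upTo n) n bs ⟨
      Δ x (upTo n ++ [ n ]) bs
        ≡⟨ ≡.cong (λ l → Δ x l bs) (Listₚ.upTo-∷ʳ n) ⟩
      Δ x (upTo (suc n)) bs ∎

  module _ {b} {B : Set b} (y : ℕ → B → Carrier) (v : ℕ → B)
           (diagonal : ∀ j → y j (v j) ≈ sgn j)
           (off-diagonal : ∀ {j q} → j ≢ q → y q (v j) ≈ 0#) where

    -- Proceed down from the largest row. At a bead n, the column `v n` is a multiple of a unit
    -- vector and disappears together with row n. At a hole n, row n vanishes on all remaining
    -- columns v j and sees only `ps`. No sign is left over: `v n` stands in position n, and the
    -- sign of that position is cancelled by the entry `y n (v n)`.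
    Δ-Maya : ∀ {n hs us} → Maya n hs us → ∀ ps → length ps ≡ length hs →
             Δ y (downFrom n) (ps ++ map v us) ≈ Δ y hs ps
    Δ-Maya empty [] _ = refl
    Δ-Maya (hole {n} {hs} {us} m) ps e = begin
      (y n ⌟ Δ y (downFrom n)) (ps ++ map v us)
        ≈⟨ ⌟-++ (y n) _ ps (Allₚ.map⁺ (All.map (off-diagonal ∘ ℕₚ.<⇒≢) (Maya-bounded m))) ⟩
      (y n ⌟ (λ ps → Δ y (downFrom n) (ps ++ map v us))) ps
        ≈⟨ ⌟-cong-length ps (λ _ → refl) (λ ps′ e′ → Δ-Maya m ps′ (ℕₚ.suc-injective (≡.trans e′ e))) ⟩
      (y n ⌟ Δ y hs) ps ∎
    Δ-Maya (bead {n} {hs} {us} m) ps e = begin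
      (y n ⌟ Δ y (downFrom n)) (ps ++ map v (us ++ [ n ]))
        ≡⟨ ≡.cong (y n ⌟ Δ y (downFrom n)) (≡.trans (≡.cong (ps ++_) (Listₚ.map-++ v us [ n ])) (≡.sym (Listₚ.++-assoc ps _ _))) ⟩
      (y n ⌟ Δ y (downFrom n)) ((ps ++ map v us) ++ [ v n ])
        ≈⟨ ⌟-last (y n) _ (v n) (Δ-zero-last y (downFrom n) (v n) (All.tabulate λ q∈ → off-diagonal λ e → ℕₚ.<⇒≢ (∈ₚ.∈-downFrom⁻ q∈) (≡.sym e))) (ps ++ map v us) ⟩
      sgn (length (ps ++ map v us)) * (y n (v n) * Δ y (downFrom n) (ps ++ map v us))
        ≡⟨ ≡.cong (λ k → sgn k * (y n (v n) * Δ y (downFrom n) (ps ++ map v us))) length≡ ⟩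
      sgn n * (y n (v n) * Δ y (downFrom n) (ps ++ map v us))
        ≈⟨ trans (*-congˡ (*-congʳ (diagonal n))) (sym (*-assoc _ _ _)) ⟩
      (sgn n * sgn n) * Δ y (downFrom n) (ps ++ map v us)
        ≈⟨ trans (*-congʳ (sgn-square n)) (*-identityˡ _) ⟩
      Δ y (downFrom n) (ps ++ map v us)
        ≈⟨ Δ-Maya m ps e ⟩
      Δ y hs ps ∎
      where
      length≡ : length (ps ++ map v us) ≡ n
      length≡ = ≡.trans (Listₚ.length-++ ps) (≡.trans
        (≡.cong₂ ℕ._+_ e (Listₚ.length-map v us)) (Maya-length m))

  module _ (C : ℕ → ℕ → Carrier) (triangular : ∀ {p q} → p < q → C p q ≈ 0#) where

    private
      data _⊝_ : List ℕ → List ℕ → Set where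
        drop : ∀ {q qs} → (q ∷ qs) ⊝ qs
        keep : ∀ {q qs qs′} → qs ⊝ qs′ → (q ∷ qs) ⊝ (q ∷ qs′)

      ⊝-All : ∀ {p} {P : ℕ → Set p} {qs qs′} → qs ⊝ qs′ → All P qs → All P qs′
      ⊝-All drop     (_ ∷ ps) = ps
      ⊝-All (keep d) (p ∷ ps) = p ∷ ⊝-All d ps

      ⊝-AllPairs : ∀ {qs qs′} → qs ⊝ qs′ → AllPairs _>_ qs → AllPairs _>_ qs′
      ⊝-AllPairs drop     (_ ∷ ps) = ps
      ⊝-AllPairs (keep d) (p ∷ ps) = ⊝-All d p ∷ ⊝-AllPairs d ps

      ⌟-⊝ : ∀ (f : ℕ → Carrier) Φ qs → (∀ {qs′} → qs ⊝ qs′ → Φ qs′ ≈ 0#) → (f ⌟ Φ) qs ≈ 0#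
      ⌟-⊝ f Φ []       p = refl
      ⌟-⊝ f Φ (q ∷ qs) p = trans
        (+-cong (*-congˡ (p drop)) (-‿cong (⌟-⊝ f _ qs (p ∘ keep))))
        (solve 1 (λ x → x :* con (+ 0) :- con (+ 0) := con (+ 0)) refl (f q))

      -- Deleting a column leaves, at the exceeding position or before it, a larger entry.
      Exceeds-⊝ : ∀ {ps q qs qs′} → AllPairs _>_ (q ∷ qs) → Exceeds ps qs → (q ∷ qs) ⊝ qs′ → Exceeds ps qs′
      Exceeds-⊝ s e                            drop     = e
      Exceeds-⊝ ((q>q₁ ∷ _) ∷ s) (now p<q₁)    (keep d) = now (ℕₚ.<-trans p<q₁ q>q₁)
      Exceeds-⊝ ((q>q₁ ∷ _) ∷ s) (later e)     (keep d) = later (Exceeds-⊝ s e d)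

    -- If p < q at the head, the whole first column vanishes, because no row index is larger than p.
    -- Otherwise every minor in the expansion along the first row still has an exceeding position.
    Δ-Exceeds : ∀ {ps qs} → AllPairs _>_ ps → AllPairs _>_ qs → Exceeds ps qs → Δ C ps qs ≈ 0#
    Δ-Exceeds {p ∷ ps} {q ∷ qs} (p>ps ∷ _) _ (now p<q) = trans
      (Δ-transpose C (p ∷ ps) (q ∷ qs))
      (⌟-zeroˡ {Φ = Δ (flip C) qs} (triangular p<q ∷ All.map (λ p′<p → triangular (ℕₚ.<-trans p′<p p<q)) p>ps))
    Δ-Exceeds {p ∷ ps} {q ∷ qs} (_ ∷ s) t (later e) =
      ⌟-⊝ (C p) (Δ C ps) (q ∷ qs) λ d → Δ-Exceeds s (⊝-AllPairs d t) (Exceeds-⊝ t e d)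

-- Determinants under ring homomorphisms.

module _ {a ℓ₁ c ℓ} (A : RawRing a ℓ₁) (R : CommutativeRing c ℓ) where
  private module A = RawRing A
  open CommutativeRing R hiding (zero)
  open import Algebra.Definitions.RawMonoid A.+-rawMonoid using () renaming (sum to sumA)
  open import Algebra.Definitions.RawMonoid +-rawMonoid using (sum)
  open import Algebra.Definitions.RawSemiring A.rawSemiring using () renaming (_^_ to _^A_)
  open import Algebra.Definitions.RawSemiring (RawRing.rawSemiring rawRing) using (_^_)
  open import Algebra.Properties.CommutativeMonoid.Sum +-commutativeMonoid using (sum-cong-≋)

  -- The source is a raw ring so that `coeff`, defined on `Λ-rawRing`, is an instance.
  record IsHomomorphic (φ : A.Carrier → Carrier) : Set (a ⊔ ℓ) where
    field
      +-homo : ∀ x y → φ (x A.+ y) ≈ φ x + φ y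
      *-homo : ∀ x y → φ (x A.* y) ≈ φ x * φ y
      -‿homo : ∀ x → φ (A.- x) ≈ - φ x
      0-homo : φ A.0# ≈ 0#
      1-homo : φ A.1# ≈ 1#

  module _ {φ} (homo : IsHomomorphic φ) where
    open IsHomomorphic homo

    sum-homo : ∀ {n} (t : Fin n → A.Carrier) → φ (sumA t) ≈ sum (φ ∘ t)
    sum-homo {zero}  t = 0-homo
    sum-homo {suc n} t = trans (+-homo _ _) (+-congˡ (sum-homo (t ∘ Fin.suc)))

    sign-homo : ∀ n → φ ((A.- A.1#) ^A n) ≈ (- 1#) ^ n
    sign-homo zero    = 1-homo
    sign-homo (suc n) = trans (*-homo _ _) (*-cong (trans (-‿homo _) (-‿cong 1-homo)) (sign-homo n))

    det-homo : ∀ {n} (M : Fin n → Fin n → A.Carrier) → φ (det A M) ≈ det rawRing (λ i j → φ (M i j))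
    det-homo {zero}  M = 1-homo
    det-homo {suc n} M = trans (sum-homo {suc n} t) (sum-cong-≋ {suc n} λ j → trans (*-homo _ (minor j))
      (*-cong (trans (*-homo _ (M Fin.zero j)) (*-congʳ (sign-homo (toℕ j)))) (det-homo λ i k → M (Fin.suc i) (punchIn j k))))
      where
      minor t : Fin (suc n) → A.Carrier
      minor j = det A λ i k → M (Fin.suc i) (punchIn j k)
      t j = (((A.- A.1#) ^A toℕ j) A.* M Fin.zero j) A.* minor j

module _ {a ℓ₁ c ℓ} (A : CommutativeRing a ℓ₁) (R : CommutativeRing c ℓ) where
  open CommutativeRing R hiding (zero)
  private module A = CommutativeRing A
  private module CA = Contraction A
  open Contraction R

  Δ-homo : ∀ {φ} → IsHomomorphic A.rawRing R φ → ∀ {k l} {K : Set k} {L : Set l}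
           (M : K → L → A.Carrier) ks ls → φ (CA.Δ M ks ls) ≈ Δ (λ k l → φ (M k l)) ks ls
  Δ-homo homo M []       []      = IsHomomorphic.1-homo homo
  Δ-homo homo M []       (_ ∷ _) = IsHomomorphic.0-homo homo
  Δ-homo {φ} homo {L = L} M (k ∷ ks) ls =
    trans (⌟-homo (M k) (CA.Δ M ks) ls) (⌟-congʳ (Δ-homo homo M ks) ls)
    where
    open IsHomomorphic homo
    ⌟-homo : ∀ (f : L → A.Carrier) Φ ls → φ ((f CA.⌟ Φ) ls) ≈ ((φ ∘ f) ⌟ (φ ∘ Φ)) ls
    ⌟-homo f Φ []       = 0-homo
    ⌟-homo f Φ (l ∷ ls) = trans (+-homo _ _) (+-cong (*-homo _ _)
      (trans (-‿homo _) (-‿cong (⌟-homo f (Φ ∘ (l ∷_)) ls))))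

-- The commutative ring of formal power series.

module SeriesRing {c ℓ} (K : CommutativeRing c ℓ) where
  open CommutativeRing K hiding (zero)
  open SymmetricFunctions K
  open IntegerSolver K
  open import Algebra.Definitions.RawMonoid +-rawMonoid using (sum)
  open import Algebra.Properties.CommutativeMonoid.Sum +-commutativeMonoid using (∑-distrib-+; sum-cong-≋; sum-replicate-zero)
  open import Algebra.Properties.Semiring.Sum semiring using (*-distribˡ-sum)
  open SetoidReasoning setoid

  infix 4 _≈ₛ_
  _≈ₛ_ : Series → Series → Set ℓ
  f ≈ₛ g = ∀ α → f α ≈ g α

  0ₛ 1ₛ : Series
  0ₛ = coeff 0Λ
  1ₛ = coeff 1Λ

  infixl 6 _+ₛ_
  _+ₛ_ : Series → Series → Series
  (f +ₛ g) α = f α + g α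

  -ₛ_ : Series → Series
  (-ₛ f) α = - f α

  infixr 7 _•ₛ_
  _•ₛ_ : Carrier → Series → Series
  (x •ₛ f) α = x * f α

  ⊛-distribʳ : ∀ h f g → (f +ₛ g) ⊛ h ≈ₛ (f ⊛ h) +ₛ (g ⊛ h)
  ⊛-distribʳ h f g []      = distribʳ _ _ _
  ⊛-distribʳ h f g (n ∷ α) = trans
    (sum-cong-≋ {suc n} λ i → ⊛-distribʳ (λ γ → h (n ∸ toℕ i ∷ γ)) (λ β → f (toℕ i ∷ β)) (λ β → g (toℕ i ∷ β)) α)
    (∑-distrib-+ {suc n}
      (λ i → ((λ β → f (toℕ i ∷ β)) ⊛ (λ γ → h (n ∸ toℕ i ∷ γ))) α)
      (λ i → ((λ β → g (toℕ i ∷ β)) ⊛ (λ γ → h (n ∸ toℕ i ∷ γ))) α))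

  ⊛-zeroˡ : ∀ g → 0ₛ ⊛ g ≈ₛ 0ₛ
  ⊛-zeroˡ g []      = zeroˡ _
  ⊛-zeroˡ g (n ∷ α) = trans (sum-cong-≋ {suc n} λ i → ⊛-zeroˡ (λ γ → g (n ∸ toℕ i ∷ γ)) α) (sum-replicate-zero (suc n))

  ⊛-identityˡ : ∀ g → 1ₛ ⊛ g ≈ₛ g
  ⊛-identityˡ g []      = *-identityˡ _
  ⊛-identityˡ g (n ∷ α) = trans
    (+-cong (⊛-identityˡ (λ γ → g (n ∷ γ)) α) (trans (sum-cong-≋ {n} λ i → ⊛-zeroˡ (λ γ → g (n ∸ suc (toℕ i) ∷ γ)) α) (sum-replicate-zero n)))
    (+-identityʳ _)

  •-⊛ : ∀ x f g → (x •ₛ f) ⊛ g ≈ₛ x •ₛ (f ⊛ g)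
  •-⊛ x f g []      = *-assoc _ _ _
  •-⊛ x f g (n ∷ α) = trans
    (sum-cong-≋ {suc n} λ i → •-⊛ x (λ β → f (toℕ i ∷ β)) (λ γ → g (n ∸ toℕ i ∷ γ)) α)
    (sym (*-distribˡ-sum {suc n} x λ i → ((λ β → f (toℕ i ∷ β)) ⊛ (λ γ → g (n ∸ toℕ i ∷ γ))) α))

  private
    -- (f ⊛ g) (n ∷ α) is conv (slice f) (slice g) n α by definition.
    slice : Series → ℕ → Series
    slice f i β = f (i ∷ β)

    conv : (ℕ → Series) → (ℕ → Series) → ℕ → Series
    conv F G n α = sum {suc n} λ i → (F (toℕ i) ⊛ G (n ∸ toℕ i)) α

    conv-+ˡ : ∀ F F′ G n → conv (λ i → F i +ₛ F′ i) G n ≈ₛ conv F G n +ₛ conv F′ G n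
    conv-+ˡ F F′ G n α = trans
      (sum-cong-≋ {suc n} λ i → ⊛-distribʳ (G (n ∸ toℕ i)) (F (toℕ i)) (F′ (toℕ i)) α)
      (∑-distrib-+ {suc n} (λ i → (F (toℕ i) ⊛ G (n ∸ toℕ i)) α) (λ i → (F′ (toℕ i) ⊛ G (n ∸ toℕ i)) α))

    conv-last : ∀ F G n → conv F G (suc n) ≈ₛ conv F (G ∘ suc) n +ₛ (F (suc n) ⊛ G 0)
    conv-last F G zero    α = solve 2 (λ x y → x :+ (y :+ con (+ 0)) := (x :+ con (+ 0)) :+ y) refl _ _
    conv-last F G (suc n) α = trans (+-congˡ (conv-last (F ∘ suc) G n α)) (sym (+-assoc _ _ _))

    -- The outer induction is on the number of variables, so commutativity at the tail α is a
    -- hypothesis. The induction here is on the exponent n of the first variable: the first term of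
    -- one side is matched with the last term of the other.
    conv-comm : ∀ α → (∀ f g → (f ⊛ g) α ≈ (g ⊛ f) α) → ∀ F G n → conv F G n α ≈ conv G F n α
    conv-comm α comm F G zero    = +-congʳ (comm (F 0) (G 0))
    conv-comm α comm F G (suc n) = begin
      (F 0 ⊛ G (suc n)) α + conv (F ∘ suc) G n α  ≈⟨ +-cong (comm (F 0) (G (suc n))) (conv-comm α comm (F ∘ suc) G n) ⟩
      (G (suc n) ⊛ F 0) α + conv G (F ∘ suc) n α  ≈⟨ +-comm _ _ ⟩
      conv G (F ∘ suc) n α + (G (suc n) ⊛ F 0) α  ≈⟨ conv-last G F n α ⟨
      conv G F (suc n) α                          ∎

  ⊛-comm : ∀ f g → f ⊛ g ≈ₛ g ⊛ f
  ⊛-comm f g []      = *-comm _ _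
  ⊛-comm f g (n ∷ α) = conv-comm α (λ f g → ⊛-comm f g α) (slice f) (slice g) n

  ⊛-distribˡ : ∀ h f g → h ⊛ (f +ₛ g) ≈ₛ (h ⊛ f) +ₛ (h ⊛ g)
  ⊛-distribˡ h f g α = trans (⊛-comm h (f +ₛ g) α)
    (trans (⊛-distribʳ h f g α) (+-cong (⊛-comm f h α) (⊛-comm g h α)))

  private
    ⊛-sumʳ : ∀ {n} f (g : Fin n → Series) α → (f ⊛ (λ β → sum λ i → g i β)) α ≈ sum λ i → (f ⊛ g i) α
    ⊛-sumʳ {zero}  f g α = trans (⊛-comm f 0ₛ α) (⊛-zeroˡ f α)
    ⊛-sumʳ {suc n} f g α = trans (⊛-distribˡ f (g Fin.zero) (λ β → sum λ i → g (Fin.suc i) β) α)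
      (+-congˡ (⊛-sumʳ f (g ∘ Fin.suc) α))

    -- The terms containing `F 0` are collected, by distributivity, into `F 0` times the product of
    -- G and H; the others form the same identity for the tail of F.
    conv-assoc : ∀ α → (∀ f g h → ((f ⊛ g) ⊛ h) α ≈ (f ⊛ (g ⊛ h)) α) →
                 ∀ F G H n → conv (conv F G) H n α ≈ conv F (conv G H) n α
    conv-assoc α assoc F G H zero = +-congʳ (begin
      ((λ β → (F 0 ⊛ G 0) β + 0#) ⊛ H 0) α  ≈⟨ ⊛-cong (λ β → +-identityʳ _) (λ _ → refl) α ⟩
      ((F 0 ⊛ G 0) ⊛ H 0) α                 ≈⟨ assoc (F 0) (G 0) (H 0) ⟩
      (F 0 ⊛ (G 0 ⊛ H 0)) α                 ≈⟨ ⊛-cong {F 0} (λ _ → refl) (λ β → +-identityʳ _) α ⟨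
      (F 0 ⊛ (λ β → (G 0 ⊛ H 0) β + 0#)) α  ∎)
    conv-assoc α assoc F G H (suc n) = begin
      (conv F G 0 ⊛ H (suc n)) α + conv (λ i → conv F G (suc i)) H n α
        ≈⟨ +-cong (trans (⊛-cong {g = H (suc n)} (λ β → +-identityʳ _) (λ _ → refl) α) (assoc (F 0) (G 0) (H (suc n))))
                  (conv-+ˡ (λ i → F 0 ⊛ G (suc i)) (conv (F ∘ suc) G) H n α) ⟩
      (F 0 ⊛ (G 0 ⊛ H (suc n))) α + (conv (λ i → F 0 ⊛ G (suc i)) H n α + conv (conv (F ∘ suc) G) H n α)
        ≈⟨ +-congˡ (+-cong
             (trans (sum-cong-≋ {suc n} λ i → assoc (F 0) (G (suc (toℕ i))) (H (n ∸ toℕ i)))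
                    (sym (⊛-sumʳ {suc n} (F 0) (λ i → G (suc (toℕ i)) ⊛ H (n ∸ toℕ i)) α)))
             (conv-assoc α assoc (F ∘ suc) G H n)) ⟩
      (F 0 ⊛ (G 0 ⊛ H (suc n))) α + ((F 0 ⊛ conv (G ∘ suc) H n) α + conv (F ∘ suc) (conv G H) n α)
        ≈⟨ +-assoc _ _ _ ⟨
      ((F 0 ⊛ (G 0 ⊛ H (suc n))) α + (F 0 ⊛ conv (G ∘ suc) H n) α) + conv (F ∘ suc) (conv G H) n α
        ≈⟨ +-congʳ (⊛-distribˡ (F 0) (G 0 ⊛ H (suc n)) (conv (G ∘ suc) H n) α) ⟨
      conv F (conv G H) (suc n) α ∎

  ⊛-assoc : ∀ f g h → (f ⊛ g) ⊛ h ≈ₛ f ⊛ (g ⊛ h)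
  ⊛-assoc f g h []      = *-assoc _ _ _
  ⊛-assoc f g h (n ∷ α) = conv-assoc α (λ f g h → ⊛-assoc f g h α) (slice f) (slice g) (slice h) n

  seriesRing : CommutativeRing c ℓ
  seriesRing = record
    { Carrier = Series ; _≈_ = _≈ₛ_ ; _+_ = _+ₛ_ ; _*_ = _⊛_ ; -_ = -ₛ_ ; 0# = 0ₛ ; 1# = 1ₛ
    ; isCommutativeRing = record
      { isRing = record
        { +-isAbelianGroup = record
          { isGroup = record
            { isMonoid = record
              { isSemigroup = record
                { isMagma = record
                  { isEquivalence = record
                    { refl = λ _ → refl ; sym = λ p α → sym (p α) ; trans = λ p q α → trans (p α) (q α) }
                  ; ∙-cong = λ p q α → +-cong (p α) (q α) }
                ; assoc = λ _ _ _ _ → +-assoc _ _ _ }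
              ; identity = (λ _ _ → +-identityˡ _) , (λ _ _ → +-identityʳ _) }
            ; inverse = (λ _ _ → -‿inverseˡ _) , (λ _ _ → -‿inverseʳ _)
            ; ⁻¹-cong = λ p α → -‿cong (p α) }
          ; comm = λ _ _ _ → +-comm _ _ }
        ; *-cong = ⊛-cong
        ; *-assoc = ⊛-assoc
        ; *-identity = ⊛-identityˡ , λ f α → trans (⊛-comm f 1ₛ α) (⊛-identityˡ f α)
        ; distrib = ⊛-distribˡ , ⊛-distribʳ }
      ; *-comm = ⊛-comm } }

-- Factorial powers (u|α)^p and the change from one sequence to another.

module Moments {c ℓ} (R : CommutativeRing c ℓ) where
  open CommutativeRing R hiding (zero)
  open IntegerSolver R
  open ListSum R
  open SetoidReasoning setoid

  -- The functional u^i ↦ χ i applied to the polynomial (u - α 0) ⋯ (u - α (p - 1)).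
  factorial : (ℕ → Carrier) → ℕ → (ℕ → Carrier) → Carrier
  factorial α zero    χ = χ 0
  factorial α (suc p) χ = factorial α p (χ ∘ suc) - α p * factorial α p χ

  factorial-cong : ∀ {α β χ ψ} → (∀ i → α i ≈ β i) → (∀ i → χ i ≈ ψ i) → ∀ p →
                   factorial α p χ ≈ factorial β p ψ
  factorial-cong α≈β χ≈ψ zero    = χ≈ψ 0
  factorial-cong α≈β χ≈ψ (suc p) = +-cong (factorial-cong α≈β (χ≈ψ ∘ suc) p)
    (-‿cong (*-cong (α≈β p) (factorial-cong α≈β χ≈ψ p)))

  factorial-linear : ∀ α x y χ ψ p →
    factorial α p (λ i → x * χ i + y * ψ i) ≈ x * factorial α p χ + y * factorial α p ψ
  factorial-linear α x y χ ψ zero    = refl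
  factorial-linear α x y χ ψ (suc p) = trans
    (+-cong (factorial-linear α x y (χ ∘ suc) (ψ ∘ suc) p) (-‿cong (*-congˡ (factorial-linear α x y χ ψ p))))
    (solve 7 (λ x y a X Y U V → (x :* X :+ y :* Y) :- a :* (x :* U :+ y :* V)
                             := x :* (X :- a :* U) :+ y :* (Y :- a :* V)) refl x y (α p) _ _ _ _)

  -- The definition splits off the last factor u - α p; shifting the sequence calls for splitting
  -- off the first one.
  factorial-first : ∀ α p χ →
    factorial α (suc p) χ ≈ factorial (α ∘ suc) p (χ ∘ suc) - α 0 * factorial (α ∘ suc) p χ
  factorial-first α zero    χ = refl
  factorial-first α (suc p) χ = trans
    (+-cong (factorial-first α p (χ ∘ suc)) (-‿cong (*-congˡ (factorial-first α p χ))))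
    (solve 5 (λ a b X Y Z → (X :- a :* Y) :- b :* (Y :- a :* Z)
                          := (X :- b :* Y) :- a :* (Y :- b :* Z)) refl (α 0) (α (suc p)) _ _ _)

  -- The recursion for the coefficients of (u - α 0)⋯(u - α (p - 1)) in terms of
  -- the polynomials (u - β 0)⋯(u - β (q - 1)).
  record IsTransition (α β : ℕ → Carrier) (C : ℕ → ℕ → Carrier) : Set ℓ where
    field
      C00 : C 0 0 ≈ 1#
      Cs0 : ∀ p → C (suc p) 0 ≈ (β 0 - α p) * C p 0
      Css : ∀ p q → C (suc p) (suc q) ≈ C p q + (β (suc q) - α p) * C p (suc q)
      C<  : ∀ {p q} → p < q → C p q ≈ 0#

  module _ {α β C} (isTransition : IsTransition α β C) where
    open IsTransition isTransition

    -- Combine (u|α)^{p+1} = (u - α p)(u|α)^p with u (u|β)^q = (u|β)^{q+1} + β q (u|β)^q. The sum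
    -- runs downwards because Cauchy-Binet then produces decreasing lists, as Frobenius coordinates
    -- are.
    factorial-transition : ∀ p m χ → p < m → factorial α p χ ≈ Σ[ downFrom m ] (λ q → C p q * factorial β q χ)
    factorial-transition zero (suc m) χ _ = sym (first-term m)
      where
      first-term : ∀ m → Σ[ downFrom (suc m) ] (λ q → C 0 q * factorial β q χ) ≈ χ 0
      first-term zero    = trans (+-identityʳ _) (trans (*-congʳ C00) (*-identityˡ _))
      first-term (suc m) = trans (+-cong (trans (*-congʳ (C< (s≤s z≤n))) (zeroˡ _)) (first-term m)) (+-identityˡ _)
    factorial-transition (suc p) (suc m) χ (s≤s p<m) = begin
      factorial α p (χ ∘ suc) - α p * factorial α p χ
        ≈⟨ +-cong (factorial-transition p (suc m) (χ ∘ suc) p<sm) (-‿cong (*-congˡ (factorial-transition p (suc m) χ p<sm))) ⟩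
      S (suc m) - α p * T (suc m)
        ≈⟨ telescope m ⟩
      Σ[ downFrom (suc m) ] (λ q → C (suc p) q * factorial β q χ) + C p m * factorial β (suc m) χ
        ≈⟨ +-congˡ (trans (*-congʳ (C< p<m)) (zeroˡ _)) ⟩
      Σ[ downFrom (suc m) ] (λ q → C (suc p) q * factorial β q χ) + 0#
        ≈⟨ +-identityʳ _ ⟩
      Σ[ downFrom (suc m) ] (λ q → C (suc p) q * factorial β q χ) ∎
      where
      p<sm = ℕₚ.m<n⇒m<1+n p<m
      S T : ℕ → Carrier
      S m = Σ[ downFrom m ] (λ q → C p q * factorial β q (χ ∘ suc))
      T m = Σ[ downFrom m ] (λ q → C p q * factorial β q χ)
      -- Multiplication by u pushes the top term of a partial sum one degree too high; the overflow
      -- at (u|β)^{m+1} is the last summand, which vanishes once p < m.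
      telescope : ∀ m → S (suc m) - α p * T (suc m) ≈
        Σ[ downFrom (suc m) ] (λ q → C (suc p) q * factorial β q χ) + C p m * factorial β (suc m) χ
      telescope zero = begin
        (C p 0 * χ 1 + 0#) - α p * (C p 0 * χ 0 + 0#)
          ≈⟨ solve 5 (λ c x y a b → (c :* x :+ con (+ 0)) :- a :* (c :* y :+ con (+ 0))
                                  := (((b :- a) :* c) :* y :+ con (+ 0)) :+ c :* (x :- b :* y)) refl _ _ _ _ (β 0) ⟩
        (((β 0 - α p) * C p 0) * χ 0 + 0#) + C p 0 * (χ 1 - β 0 * χ 0)
          ≈⟨ +-congʳ (+-congʳ (*-congʳ (Cs0 p))) ⟨
        (C (suc p) 0 * χ 0 + 0#) + C p 0 * (χ 1 - β 0 * χ 0) ∎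
      telescope (suc m) = begin
        (C p (suc m) * X + S (suc m)) - α p * (C p (suc m) * Y + T (suc m))
          ≈⟨ solve 7 (λ c x y a b s t → (c :* x :+ s) :- a :* (c :* y :+ t)
                                      := (s :- a :* t) :+ (((b :- a) :* c) :* y :+ c :* (x :- b :* y))) refl _ _ _ _ (β (suc m)) _ _ ⟩
        (S (suc m) - α p * T (suc m)) + (((β (suc m) - α p) * C p (suc m)) * Y + C p (suc m) * (X - β (suc m) * Y))
          ≈⟨ +-congʳ (telescope m) ⟩
        (Z + C p m * Y) + (((β (suc m) - α p) * C p (suc m)) * Y + C p (suc m) * (X - β (suc m) * Y))
          ≈⟨ solve 5 (λ z c y d w → (z :+ c :* y) :+ (d :* y :+ w) := ((c :+ d) :* y :+ z) :+ w) refl _ _ _ _ _ ⟩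
        ((C p m + (β (suc m) - α p) * C p (suc m)) * Y + Z) + C p (suc m) * (X - β (suc m) * Y)
          ≈⟨ +-congʳ (+-congʳ (*-congʳ (Css p m))) ⟨
        (C (suc p) (suc m) * Y + Z) + C p (suc m) * (X - β (suc m) * Y) ∎
        where
        X = factorial β (suc m) (χ ∘ suc)
        Y = factorial β (suc m) χ
        Z = Σ[ downFrom (suc m) ] (λ q → C (suc p) q * factorial β q χ)

-- The coefficients c_{pp'} and their recursion.

module HookCoefficients {c ℓ} (K : CommutativeRing c ℓ) where
  open CommutativeRing K hiding (zero)
  open SymmetricFunctions K
  open IntegerSolver K
  open Moments K
  open import Algebra.Definitions.RawMonoid +-rawMonoid using (sum)
  open import Algebra.Properties.CommutativeMonoid.Sum +-commutativeMonoid using (∑-distrib-+; sum-cong-≋)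
  open import Algebra.Properties.Semiring.Sum semiring using (*-distribˡ-sum)
  open SetoidReasoning setoid

  e-snoc : ∀ k xs x → e[ suc k ] (xs ++ [ x ]) ≈ e[ suc k ] xs + x * e[ k ] xs
  e-snoc k       []       x = refl
  e-snoc zero    (y ∷ xs) x = trans (+-congʳ (e-snoc zero xs x))
    (solve 3 (λ e x y → (e :+ x :* con (+ 1)) :+ y :* con (+ 1) := (e :+ y :* con (+ 1)) :+ x :* con (+ 1)) refl _ x y)
  e-snoc (suc k) (y ∷ xs) x = trans (+-cong (e-snoc (suc k) xs x) (*-congˡ (e-snoc k xs x)))
    (solve 5 (λ e f g x y → (e :+ x :* f) :+ y :* (f :+ x :* g) := (e :+ y :* f) :+ x :* (f :+ y :* g)) refl _ _ _ x y)

  e-vanishes : ∀ k xs → length xs < k → e[ k ] xs ≈ 0#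
  e-vanishes (suc k) []       _       = refl
  e-vanishes (suc k) (x ∷ xs) (s≤s p) = trans
    (+-cong (e-vanishes (suc k) xs (ℕₚ.m<n⇒m<1+n p)) (*-congˡ (e-vanishes k xs p)))
    (solve 1 (λ x → con (+ 0) :+ x :* con (+ 0) := con (+ 0)) refl x)

  h-snoc : ∀ k xs x → h[ suc k ] (xs ++ [ x ]) ≈ h[ suc k ] xs + x * h[ k ] (xs ++ [ x ])
  h-snoc k       []       x = refl
  h-snoc zero    (y ∷ xs) x = trans (+-congʳ (h-snoc zero xs x))
    (solve 3 (λ h x y → (h :+ x :* con (+ 1)) :+ y :* con (+ 1) := (h :+ y :* con (+ 1)) :+ x :* con (+ 1)) refl _ x y)
  h-snoc (suc k) (y ∷ xs) x = trans (+-cong (h-snoc (suc k) xs x) (*-congˡ (h-snoc k (y ∷ xs) x)))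
    (solve 6 (λ h f g x y z → (h :+ x :* f) :+ y :* (g :+ x :* z) := (h :+ y :* g) :+ x :* (f :+ y :* z)) refl _ _ _ x y _)

  module _ (xs : List Carrier) where
    private
      conv : ℕ → (ℕ → Carrier) → List Carrier → Carrier
      conv k E xs = sum {suc k} λ r → h[ k ∸ toℕ r ] xs * E (toℕ r)

    -- In the generating function Σ h_k(x;y) t^k a new variable on the left contributes the factor
    -- 1/(1 - xt); on the right, in the lemma that follows, it contributes 1 + yt.
    supersymmetric-snocˣ : ∀ k x ys → h[ suc k ]⟨ xs ++ [ x ] ∣ ys ⟩ ≈ h[ suc k ]⟨ xs ∣ ys ⟩ + x * h[ k ]⟨ xs ++ [ x ] ∣ ys ⟩
    supersymmetric-snocˣ k x ys = go k λ r → e[ r ] ys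
      where
      -- The elementary polynomials are generalised to any sequence E, because the induction on k
      -- replaces it by its tail.
      go : ∀ k E → conv (suc k) E (xs ++ [ x ]) ≈ conv (suc k) E xs + x * conv k E (xs ++ [ x ])
      go zero    E = trans (+-congʳ (*-congʳ (h-snoc 0 xs x)))
        (solve 4 (λ h x e f → (h :+ x :* con (+ 1)) :* e :+ f := (h :* e :+ f) :+ x :* (con (+ 1) :* e :+ con (+ 0))) refl _ x (E 0) _)
      go (suc k) E = trans (+-cong (*-congʳ (h-snoc (suc k) xs x)) (go k (E ∘ suc)))
        (solve 6 (λ h x g e f f′ → (h :+ x :* g) :* e :+ (f :+ x :* f′) := (h :* e :+ f) :+ x :* (g :* e :+ f′)) refl _ x _ (E 0) _ _)

    supersymmetric-snocʸ : ∀ k ys y → h[ suc k ]⟨ xs ∣ ys ++ [ y ] ⟩ ≈ h[ suc k ]⟨ xs ∣ ys ⟩ + y * h[ k ]⟨ xs ∣ ys ⟩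
    supersymmetric-snocʸ k ys y = begin
      h₀ * 1# + sum (λ r → t r * e[ suc (toℕ r) ] (ys ++ [ y ]))
        ≈⟨ +-congˡ (sum-cong-≋ {suc k} λ r → trans (*-congˡ (e-snoc (toℕ r) ys y))
             (solve 4 (λ t e y f → t :* (e :+ y :* f) := t :* e :+ y :* (t :* f)) refl (t r) _ y _)) ⟩
      h₀ * 1# + sum (λ r → t r * e[ suc (toℕ r) ] ys + y * (t r * e[ toℕ r ] ys))
        ≈⟨ +-congˡ (∑-distrib-+ {suc k} (λ r → t r * e[ suc (toℕ r) ] ys) (λ r → y * (t r * e[ toℕ r ] ys))) ⟩
      h₀ * 1# + (sum (λ r → t r * e[ suc (toℕ r) ] ys) + sum (λ r → y * (t r * e[ toℕ r ] ys)))
        ≈⟨ trans (sym (+-assoc _ _ _)) (+-congˡ (sym (*-distribˡ-sum {suc k} y λ r → t r * e[ toℕ r ] ys))) ⟩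
      h[ suc k ]⟨ xs ∣ ys ⟩ + y * h[ k ]⟨ xs ∣ ys ⟩ ∎
      where
      h₀ = h[ suc k ] xs
      t : Fin (suc k) → Carrier
      t r = h[ k ∸ toℕ r ] xs

  supersymmetric-[] : ∀ k ys → h[ k ]⟨ [] ∣ ys ⟩ ≈ e[ k ] ys
  supersymmetric-[] k ys = go k λ r → e[ r ] ys
    where
    go : ∀ k (E : ℕ → Carrier) → sum {suc k} (λ r → h[ k ∸ toℕ r ] [] * E (toℕ r)) ≈ E k
    go zero    E = solve 1 (λ e → con (+ 1) :* e :+ con (+ 0) := e) refl (E 0)
    go (suc k) E = trans (+-cong (zeroˡ _) (go k (E ∘ suc))) (+-identityˡ _)

  hookCoef-≤ : ∀ a b {p q} → q ≤ p → hookCoef a b p q ≡ h[ p ∸ q ]⟨ first b (suc q) ∣ map (-_) (first a p) ⟩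
  hookCoef-≤ a b {p} {q} q≤p with q ≤? p
  ... | yes _   = ≡.refl
  ... | no  q≰p = contradiction q≤p q≰p

  hookCoef-> : ∀ a b {p q} → p < q → hookCoef a b p q ≈ 0#
  hookCoef-> a b {p} {q} p<q with q ≤? p
  ... | yes q≤p = contradiction q≤p (ℕₚ.<⇒≱ p<q)
  ... | no  _   = refl

  hookCoef-diagonal : ∀ a b p → hookCoef a b p p ≈ 1#
  hookCoef-diagonal a b p = begin
    hookCoef a b p p                                        ≡⟨ hookCoef-≤ a b ℕₚ.≤-refl ⟩
    h[ p ∸ p ]⟨ first b (suc p) ∣ map (-_) (first a p) ⟩    ≡⟨ ≡.cong h[_]⟨ first b (suc p) ∣ map (-_) (first a p) ⟩ (ℕₚ.n∸n≡0 p) ⟩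
    1# * 1# + 0#                                            ≈⟨ solve 0 (con (+ 1) :* con (+ 1) :+ con (+ 0) := con (+ 1)) refl ⟩
    1#                                                      ∎

  first-suc : ∀ a n → first a (suc n) ≡ first a n ++ [ a (+ suc n) ]
  first-suc a n = ≡.sym (Listₚ.applyUpTo-∷ʳ (λ i → a (+ suc i)) n)

  negated-first-suc : ∀ a n → map (-_) (first a (suc n)) ≡ map (-_) (first a n) ++ [ - a (+ suc n) ]
  negated-first-suc a n = ≡.trans (≡.cong (map (-_)) (first-suc a n)) (Listₚ.map-++ (-_) (first a n) _)

  -- Passing from p to p+1 multiplies the generating function of h_k(b;-a) by 1 - a_{p+1} t, and
  -- passing from p' to p'+1 multiplies it by 1/(1 - b_{p'+2} t). Together the two factors give the
  -- recursion for the coefficients of (u|a)^p in the basis (u|b)^{p'}.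
  hookCoef-isTransition : ∀ a b → IsTransition (λ i → a (+ suc i)) (λ i → b (+ suc i)) (hookCoef a b)
  hookCoef-isTransition a b = record
    { C00 = hookCoef-diagonal a b 0 ; Cs0 = zeroth ; Css = step ; C< = hookCoef-> a b }
    where
    zeroth : ∀ p → hookCoef a b (suc p) 0 ≈ (b (+ 1) - a (+ suc p)) * hookCoef a b p 0
    zeroth p = begin
      h[ suc p ]⟨ first b 1 ∣ map (-_) (first a (suc p)) ⟩
        ≡⟨ ≡.cong h[ suc p ]⟨ first b 1 ∣_⟩ (negated-first-suc a p) ⟩
      h[ suc p ]⟨ first b 1 ∣ ys ++ [ - a (+ suc p) ] ⟩
        ≈⟨ supersymmetric-snocʸ (first b 1) p ys (- a (+ suc p)) ⟩
      h[ suc p ]⟨ first b 1 ∣ ys ⟩ + (- a (+ suc p)) * h[ p ]⟨ first b 1 ∣ ys ⟩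
        ≈⟨ +-congʳ (supersymmetric-snocˣ [] p (b (+ 1)) ys) ⟩
      (h[ suc p ]⟨ [] ∣ ys ⟩ + b (+ 1) * h[ p ]⟨ first b 1 ∣ ys ⟩) + (- a (+ suc p)) * h[ p ]⟨ first b 1 ∣ ys ⟩
        -- With the variable b_1 removed there remains e_{p+1} of the p variables `ys`, which is
        -- zero.
        ≈⟨ +-congʳ (+-congʳ (trans (supersymmetric-[] (suc p) ys) (e-vanishes (suc p) ys (s≤s (ℕₚ.≤-reflexive length-ys))))) ⟩
      (0# + b (+ 1) * h[ p ]⟨ first b 1 ∣ ys ⟩) + (- a (+ suc p)) * h[ p ]⟨ first b 1 ∣ ys ⟩
        ≈⟨ solve 3 (λ b h a → (con (+ 0) :+ b :* h) :+ (:- a) :* h := (b :- a) :* h) refl _ _ _ ⟩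
      (b (+ 1) - a (+ suc p)) * hookCoef a b p 0 ∎
      where
      ys = map (-_) (first a p)
      length-ys : length ys ≡ p
      length-ys = ≡.trans (Listₚ.length-map (-_) (first a p)) (Listₚ.length-applyUpTo (λ i → a (+ suc i)) p)

    step : ∀ p q → hookCoef a b (suc p) (suc q) ≈ hookCoef a b p q + (b (+ suc (suc q)) - a (+ suc p)) * hookCoef a b p (suc q)
    step p q with ℕₚ.<-cmp p q
    ... | tri< p<q _ _ = trans (hookCoef-> a b (s≤s p<q)) (sym (trans
          (+-cong (hookCoef-> a b p<q) (*-congˡ (hookCoef-> a b (ℕₚ.m<n⇒m<1+n p<q))))
          (solve 1 (λ x → con (+ 0) :+ x :* con (+ 0) := con (+ 0)) refl _)))
    ... | tri≈ _ ≡.refl _ = trans (hookCoef-diagonal a b (suc p)) (sym (trans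
          (+-cong (hookCoef-diagonal a b p) (*-congˡ (hookCoef-> a b ℕₚ.≤-refl)))
          (solve 1 (λ x → con (+ 1) :+ x :* con (+ 0) := con (+ 1)) refl _)))
    ... | tri> _ _ q<p = begin
      hookCoef a b (suc p) (suc q)
        ≡⟨ hookCoef-≤ a b (s≤s (ℕₚ.<⇒≤ q<p)) ⟩
      h[ p ∸ q ]⟨ xs⁺ ∣ map (-_) (first a (suc p)) ⟩
        ≡⟨ ≡.cong₂ h[_]⟨ xs⁺ ∣_⟩ p∸q (negated-first-suc a p) ⟩
      h[ suc k ]⟨ xs⁺ ∣ ys ++ [ - a (+ suc p) ] ⟩
        ≈⟨ supersymmetric-snocʸ xs⁺ k ys (- a (+ suc p)) ⟩
      h[ suc k ]⟨ xs⁺ ∣ ys ⟩ + (- a (+ suc p)) * h[ k ]⟨ xs⁺ ∣ ys ⟩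
        ≡⟨ ≡.cong (λ l → h[ suc k ]⟨ l ∣ ys ⟩ + (- a (+ suc p)) * h[ k ]⟨ xs⁺ ∣ ys ⟩) (first-suc b (suc q)) ⟩
      h[ suc k ]⟨ xs ++ [ b (+ suc (suc q)) ] ∣ ys ⟩ + (- a (+ suc p)) * h[ k ]⟨ xs⁺ ∣ ys ⟩
        ≈⟨ +-congʳ (supersymmetric-snocˣ xs k (b (+ suc (suc q))) ys) ⟩
      (h[ suc k ]⟨ xs ∣ ys ⟩ + b (+ suc (suc q)) * h[ k ]⟨ xs ++ [ b (+ suc (suc q)) ] ∣ ys ⟩) + (- a (+ suc p)) * h[ k ]⟨ xs⁺ ∣ ys ⟩
        ≡⟨ ≡.cong (λ l → (h[ suc k ]⟨ xs ∣ ys ⟩ + b (+ suc (suc q)) * h[ k ]⟨ l ∣ ys ⟩) + (- a (+ suc p)) * h[ k ]⟨ xs⁺ ∣ ys ⟩) (first-suc b (suc q)) ⟨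
      (h[ suc k ]⟨ xs ∣ ys ⟩ + b (+ suc (suc q)) * h[ k ]⟨ xs⁺ ∣ ys ⟩) + (- a (+ suc p)) * h[ k ]⟨ xs⁺ ∣ ys ⟩
        ≈⟨ solve 4 (λ x b h a → (x :+ b :* h) :+ (:- a) :* h := x :+ (b :- a) :* h) refl _ _ _ _ ⟩
      h[ suc k ]⟨ xs ∣ ys ⟩ + (b (+ suc (suc q)) - a (+ suc p)) * h[ k ]⟨ xs⁺ ∣ ys ⟩
        ≡⟨ ≡.cong₂ (λ x y → x + (b (+ suc (suc q)) - a (+ suc p)) * y)
             (≡.trans (hookCoef-≤ a b (ℕₚ.<⇒≤ q<p)) (≡.cong h[_]⟨ xs ∣ ys ⟩ p∸q)) (hookCoef-≤ a b q<p) ⟨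
      hookCoef a b p q + (b (+ suc (suc q)) - a (+ suc p)) * hookCoef a b p (suc q) ∎
      where
      k   = p ∸ suc q
      xs  = first b (suc q)
      xs⁺ = first b (suc (suc q))
      ys  = map (-_) (first a p)
      p∸q : p ∸ q ≡ suc k
      p∸q = ℕₚ.+-∸-assoc 1 q<p

-- Partitions in Frobenius coordinates.

module Partitions where
  open import Data.Nat using (_+_)
  open ≡ using (refl; sym; trans; cong; cong₂; subst)

  sublists-length : ∀ {a} {A : Set a} d (ks : List A) {κ} → κ ∈ sublists d ks → length κ ≡ d
  sublists-length zero    ks       (here refl) = refl
  sublists-length (suc d) (k ∷ ks) κ∈ with ∈ₚ.∈-++⁻ (map (k ∷_) (sublists d ks)) κ∈
  ... | inj₂ κ∈′ = sublists-length (suc d) ks κ∈′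
  ... | inj₁ κ∈′ with ∈ₚ.∈-map⁻ (k ∷_) κ∈′
  ...   | _ , κ′∈ , refl = cong suc (sublists-length d ks κ′∈)

  sublists-All : ∀ {a p} {A : Set a} {P : Pred A p} d {ks : List A} → All P ks → ∀ {κ} → κ ∈ sublists d ks → All P κ
  sublists-All zero    _                   (here refl) = []
  sublists-All (suc d) {k ∷ ks} (pk ∷ pks) κ∈ with ∈ₚ.∈-++⁻ (map (k ∷_) (sublists d ks)) κ∈
  ... | inj₂ κ∈′ = sublists-All (suc d) pks κ∈′
  ... | inj₁ κ∈′ with ∈ₚ.∈-map⁻ (k ∷_) κ∈′
  ...   | _ , κ′∈ , refl = pk ∷ sublists-All d pks κ′∈

  sublists-AllPairs : ∀ {a r} {A : Set a} {_~_ : A → A → Set r} d {ks} → AllPairs _~_ ks →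
                      ∀ {κ} → κ ∈ sublists d ks → AllPairs _~_ κ
  sublists-AllPairs zero    _                    (here refl) = []
  sublists-AllPairs (suc d) {k ∷ ks} (k~ks ∷ ps) κ∈ with ∈ₚ.∈-++⁻ (map (k ∷_) (sublists d ks)) κ∈
  ... | inj₂ κ∈′ = sublists-AllPairs (suc d) ps κ∈′
  ... | inj₁ κ∈′ with ∈ₚ.∈-map⁻ (k ∷_) κ∈′
  ...   | _ , κ′∈ , refl = sublists-All d k~ks κ′∈ ∷ sublists-AllPairs d ps κ′∈

  sublists-unique : ∀ {a} {A : Set a} d {ks : List A} → Unique ks → Unique (sublists d ks)
  sublists-unique zero    _             = [] ∷ []
  sublists-unique (suc d) {[]}     _    = []
  sublists-unique (suc d) {k ∷ ks} (k≢ks ∷ u) = Uniqueₚ.++⁺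
    (Uniqueₚ.map⁺ Listₚ.∷-injectiveʳ (sublists-unique d u)) (sublists-unique (suc d) u) disjoint
    where
    disjoint : ∀ {κ} → κ ∈ map (k ∷_) (sublists d ks) × κ ∈ sublists (suc d) ks → _
    disjoint (κ∈ , κ∈′) with ∈ₚ.∈-map⁻ (k ∷_) κ∈
    ... | _ , _ , refl = All.head (sublists-All (suc d) k≢ks κ∈′) refl

  -- Lets the Cauchy-Binet sum over sublists of `downFrom m` be read as a sum over Frobenius
  -- coordinates: no strictly decreasing list below m is missed.
  decreasing∈sublists : ∀ m {κ} → AllPairs _>_ κ → All (_< m) κ → κ ∈ sublists (length κ) (downFrom m)
  decreasing∈sublists m       []          _             = here refl
  decreasing∈sublists (suc m) {k ∷ κ} (k>κ ∷ s) (k<sm ∷ _) with k ℕ.≟ m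
  ... | yes refl = ∈ₚ.∈-++⁺ˡ (∈ₚ.∈-map⁺ (k ∷_) (decreasing∈sublists m s k>κ))
  ... | no  k≢m  = ∈ₚ.∈-++⁺ʳ (map (m ∷_) (sublists (length κ) (downFrom m)))
    (decreasing∈sublists m (k>κ ∷ s) (k<m ∷ All.map (λ x<k → ℕₚ.<-trans x<k k<m) k>κ))
    where k<m = ℕₚ.≤∧≢⇒< (ℕₚ.≤-pred k<sm) k≢m

  downFrom-decreasing : ∀ n → AllPairs _>_ (downFrom n)
  downFrom-decreasing n = AllPairsₚ.applyDownFrom⁺₁ id n λ j<i _ → j<i

  compare : ∀ ps qs → length ps ≡ length qs → Pointwise _≤_ qs ps ⊎ Exceeds ps qs
  compare []       []       _ = inj₁ []
  compare (p ∷ ps) (q ∷ qs) e with q ≤? p | compare ps qs (ℕₚ.suc-injective e)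
  ... | no  q≰p | _       = inj₂ (now (ℕₚ.≰⇒> q≰p))
  ... | yes q≤p | inj₂ x  = inj₂ (later x)
  ... | yes q≤p | inj₁ le = inj₁ (q≤p ∷ le)

  Pointwise-bounded : ∀ {m ps qs} → Pointwise _≤_ qs ps → All (_< m) ps → All (_< m) qs
  Pointwise-bounded []         []       = []
  Pointwise-bounded (q≤p ∷ le) (p ∷ pb) = ℕₚ.≤-<-trans q≤p p ∷ Pointwise-bounded le pb

  upperBound : ∀ xs → ∃ λ m → All (_< m) xs
  upperBound xs = suc (max 0 xs) , All.map s≤s (xs≤max 0 xs)

  applyUpTo-cong : ∀ {a} {A : Set a} {f g : ℕ → A} n → (∀ i → i < n → f i ≡ g i) → applyUpTo f n ≡ applyUpTo g n
  applyUpTo-cong zero    p = refl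
  applyUpTo-cong (suc n) p = cong₂ _∷_ (p 0 (s≤s z≤n)) (applyUpTo-cong n λ i i<n → p (suc i) (s≤s i<n))

  length-filter-map : ∀ {a b p q} {A : Set a} {B : Set b} {P : Pred B p} {Q : Pred A q}
    (P? : Decidable P) (Q? : Decidable Q) (f : A → B) → (∀ x → P (f x) → Q x) → (∀ x → Q x → P (f x)) →
    ∀ xs → length (filter P? (map f xs)) ≡ length (filter Q? xs)
  length-filter-map P? Q? f to from []       = refl
  length-filter-map P? Q? f to from (x ∷ xs) with P? (f x) | Q? x
  ... | yes _  | yes _  = cong suc (length-filter-map P? Q? f to from xs)
  ... | no  _  | no  _  = length-filter-map P? Q? f to from xs
  ... | yes p  | no  ¬q = contradiction (to x p) ¬q
  ... | no  ¬p | yes q  = contradiction (from x q) ¬p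

  private
    pad : List ℕ → ℕ → List ℕ
    pad xs r = xs ++ replicate r 0

    length-pad : ∀ xs r → length (pad xs r) ≡ length xs + r
    length-pad xs r = trans (Listₚ.length-++ xs) (cong (ℕ._+_ (length xs)) (Listₚ.length-replicate r))

    All-pad : ∀ {p} {P : Pred ℕ p} {xs} r → P 0 → All P xs → All P (pad xs r)
    All-pad r p0 ps = Allₚ.++⁺ ps (Allₚ.replicate⁺ r p0)

    entry-pad : ∀ xs r i → entry (pad xs r) i ≡ entry xs i
    entry-pad []       zero    i       = refl
    entry-pad []       (suc r) zero    = refl
    entry-pad []       (suc r) (suc i) = entry-pad [] r i
    entry-pad (x ∷ xs) r       zero    = refl
    entry-pad (x ∷ xs) r       (suc i) = entry-pad xs r i

    filter-replicate : ∀ j r → filter (j <?_) (replicate r 0) ≡ []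
    filter-replicate j r = Listₚ.filter-none (j <?_) (Allₚ.replicate⁺ r λ ())

  -- Frobenius coordinates, peeling off the first row and the first column of
  -- the list of row lengths at each step.
  data Frobenius : List ℕ → List ℕ → List ℕ → Set where
    []   : Frobenius [] [] []
    hook : ∀ {xs ps qs p} r → All (_≤ p) xs → Frobenius xs ps qs →
           Frobenius (suc p ∷ map suc (xs ++ replicate r 0)) (p ∷ ps) (length xs + r ∷ qs)

  Frobenius-length : ∀ {xs ps qs} → Frobenius xs ps qs → length ps ≡ length qs
  Frobenius-length []           = refl
  Frobenius-length (hook r _ F) = cong suc (Frobenius-length F)

  arms-bounded : ∀ {xs ps qs m} → Frobenius xs ps qs → All (_≤ m) xs → All (_< m) ps
  arms-bounded []              _         = []
  arms-bounded (hook r x≤p F) (p<m ∷ _) =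
    p<m ∷ All.map (λ q<p → ℕₚ.<-trans q<p p<m) (arms-bounded F x≤p)

  arms-decreasing : ∀ {xs ps qs} → Frobenius xs ps qs → AllPairs _>_ ps
  arms-decreasing []             = []
  arms-decreasing (hook r x≤p F) = arms-bounded F x≤p ∷ arms-decreasing F

  legs-bounded : ∀ {xs ps qs} → Frobenius xs ps qs → All (_< length xs) qs
  legs-bounded []                      = []
  legs-bounded (hook {xs = xs} r _ F) =
    subst (length xs + r <_) (sym length≡) ℕₚ.≤-refl ∷
    All.map (λ q< → ℕₚ.<-≤-trans q< (ℕₚ.≤-trans (ℕₚ.m≤m+n _ r) (subst (length xs + r ≤_) (sym length≡) (ℕₚ.n≤1+n _)))) (legs-bounded F)
    where
    length≡ : suc (length (map suc (pad xs r))) ≡ suc (length xs + r)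
    length≡ = cong suc (trans (Listₚ.length-map suc (pad xs r)) (length-pad xs r))

  legs-decreasing : ∀ {xs ps qs} → Frobenius xs ps qs → AllPairs _>_ qs
  legs-decreasing []           = []
  legs-decreasing (hook r _ F) =
    All.map (λ q< → ℕₚ.<-≤-trans q< (ℕₚ.m≤m+n _ r)) (legs-bounded F) ∷ legs-decreasing F

  private
    -- Removal of the first column. In a weakly decreasing list the rows of length 1 come last; they
    -- turn into the r zeros.
    shrink : ∀ ys → AllPairs _≥_ ys → All (0 <_) ys →
             ∃₂ λ xs r → ys ≡ map suc (pad xs r) × AllPairs _≥_ xs × All (0 <_) xs × length xs ≤ length ys
    shrink []             _        _        = [] , 0 , refl , [] , [] , z≤n
    shrink (suc zero ∷ ys) (y≥ ∷ s) (_ ∷ pos) with shrink ys s pos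
    ... | []     , r , refl , _ = [] , suc r , refl , [] , [] , z≤n
    ... | x ∷ xs , r , refl , _ , (0<x ∷ _) , _ with y≥
    ...   | s≤s x≤0 ∷ _ = contradiction x≤0 (ℕₚ.<⇒≱ 0<x)
    shrink (suc (suc y) ∷ ys) (y≥ ∷ s) (_ ∷ pos) with shrink ys s pos
    ... | xs , r , refl , s′ , pos′ , le =
      suc y ∷ xs , r , refl , (All.map ℕₚ.≤-pred (Allₚ.++⁻ˡ xs (Allₚ.map⁻ y≥)) ∷ s′) , s≤s z≤n ∷ pos′ , s≤s le

  -- What remains after peeling off a hook is not a sublist of the input, so the recursion runs on a
  -- bound n for the number of rows.
  frobenius : ∀ xs → AllPairs _≥_ xs → All (0 <_) xs → ∃₂ λ ps qs → Frobenius xs ps qs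
  frobenius xs = go (length xs) xs ℕₚ.≤-refl
    where
    go : ∀ n xs → length xs ≤ n → AllPairs _≥_ xs → All (0 <_) xs → ∃₂ λ ps qs → Frobenius xs ps qs
    go n       []           _        _        _         = _ , _ , []
    go (suc n) (suc p ∷ ys) (s≤s le) (p≥ ∷ s) (_ ∷ pos) with shrink ys s pos
    ... | xs , r , refl , s′ , pos′ , le′ with go n xs (ℕₚ.≤-trans le′ le) s′ pos′
    ...   | _ , _ , F = _ , _ , hook r (All.map ℕₚ.≤-pred (Allₚ.++⁻ˡ xs (Allₚ.map⁻ p≥))) F

  frobeniusOf : ∀ μ → ∃₂ λ ps qs → Frobenius (parts μ) ps qs
  frobeniusOf μ = frobenius (parts μ) (Linkedₚ.Linked⇒AllPairs (λ p q → ℕₚ.≤-trans q p) (sorted μ)) (positive μ)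

  -- Total on all pairs of lists: the maximum and the truncated subtraction enforce a partition
  -- whatever the input. On strictly decreasing coordinates of equal length the maximum is p and the
  -- subtraction is exact.
  fromFrobenius : List ℕ → List ℕ → List ℕ
  fromFrobenius []       _        = []
  fromFrobenius (_ ∷ _)  []       = []
  fromFrobenius (p ∷ ps) (q ∷ qs) =
    let xs = fromFrobenius ps qs in suc (max p xs) ∷ map suc (xs ++ replicate (q ∸ length xs) 0)

  private
    replicate-sorted : ∀ r → AllPairs _≥_ (replicate r 0)
    replicate-sorted zero    = []
    replicate-sorted (suc r) = Allₚ.replicate⁺ r z≤n ∷ replicate-sorted r

    fromFrobenius-sorted : ∀ ps qs → AllPairs _≥_ (fromFrobenius ps qs)
    fromFrobenius-sorted []       _        = []
    fromFrobenius-sorted (_ ∷ _)  []       = []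
    fromFrobenius-sorted (p ∷ ps) (q ∷ qs) =
      Allₚ.map⁺ (All.map s≤s (All-pad r z≤n (xs≤max p xs))) ∷
      AllPairsₚ.map⁺ (AllPairs.map s≤s (AllPairsₚ.++⁺ (fromFrobenius-sorted ps qs) (replicate-sorted r)
        (All.universal (λ _ → Allₚ.replicate⁺ r z≤n) xs)))
      where
      xs = fromFrobenius ps qs
      r = q ∸ length xs

    fromFrobenius-positive : ∀ ps qs → All (0 <_) (fromFrobenius ps qs)
    fromFrobenius-positive []       _        = []
    fromFrobenius-positive (_ ∷ _)  []       = []
    fromFrobenius-positive (p ∷ ps) (q ∷ qs) = s≤s z≤n ∷ Allₚ.map⁺ (All.universal (λ _ → s≤s z≤n) _)

  partitionOf : List ℕ × List ℕ → Partition
  partitionOf (ps , qs) = record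
    { parts = fromFrobenius ps qs
    ; sorted = Linkedₚ.AllPairs⇒Linked (fromFrobenius-sorted ps qs)
    ; positive = fromFrobenius-positive ps qs }

  private
    max-dominant : ∀ {p xs} → All (_≤ p) xs → max p xs ≡ p
    max-dominant {p} {xs} x≤p = ℕₚ.≤-antisym (max≤v⁺ ℕₚ.≤-refl x≤p) (⊥≤max p xs)

  Frobenius-unique : ∀ {xs ps qs} → Frobenius xs ps qs → fromFrobenius ps qs ≡ xs
  Frobenius-unique [] = refl
  Frobenius-unique (hook {xs} {p = p} r x≤p F) rewrite Frobenius-unique F =
    cong₂ (λ m r → suc m ∷ map suc (pad xs r)) (max-dominant x≤p) (ℕₚ.m+n∸m≡n (length xs) r)

  private
    parts-bounded : ∀ {xs ps qs m} → Frobenius xs ps qs → All (_< m) ps → All (_≤ m) xs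
    parts-bounded []             _         = []
    parts-bounded (hook r x≤p F) (p<m ∷ _) =
      p<m ∷ Allₚ.map⁺ (All.map (λ x≤p → ℕₚ.≤-trans (s≤s x≤p) p<m) (All-pad r z≤n x≤p))

    length-bounded : ∀ {xs ps qs m} → Frobenius xs ps qs → All (_< m) qs → length xs ≤ m
    length-bounded []                     _         = z≤n
    length-bounded {m = m} (hook {xs = xs} r _ F) (q<m ∷ _) =
      subst (λ n → suc n ≤ m) (sym (trans (Listₚ.length-map suc (pad xs r)) (length-pad xs r))) q<m

  fromFrobenius-Frobenius : ∀ {ps qs} → length ps ≡ length qs → AllPairs _>_ ps → AllPairs _>_ qs →
                            Frobenius (fromFrobenius ps qs) ps qs
  fromFrobenius-Frobenius {[]}     {[]}     _ _          _          = []
  fromFrobenius-Frobenius {p ∷ ps} {q ∷ qs} e (p> ∷ ps>) (q> ∷ qs>) =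
    subst (λ m → Frobenius (suc m ∷ map suc (pad xs r)) (p ∷ ps) (q ∷ qs)) (sym (max-dominant x≤p))
      (subst (λ q → Frobenius (suc p ∷ map suc (pad xs r)) (p ∷ ps) (q ∷ qs))
        (ℕₚ.m+[n∸m]≡n (length-bounded F q>)) (hook r x≤p F))
    where
    xs = fromFrobenius ps qs
    r = q ∸ length xs
    F = fromFrobenius-Frobenius (ℕₚ.suc-injective e) ps> qs>
    x≤p = parts-bounded F p>

  private
    entry-suc-< : ∀ zs i k → suc k < entry (map suc zs) i → k < entry zs i
    entry-suc-< (z ∷ zs) zero    k (s≤s p) = p
    entry-suc-< (z ∷ zs) (suc i) k p       = entry-suc-< zs i k p

    entry-suc-<⁻ : ∀ zs i k → k < entry zs i → suc k < entry (map suc zs) i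
    entry-suc-<⁻ (z ∷ zs) zero    k p = s≤s p
    entry-suc-<⁻ (z ∷ zs) (suc i) k p = entry-suc-<⁻ zs i k p

    entry-suc-∸ : ∀ zs i k → entry (map suc zs) i ∸ suc k ≡ entry zs i ∸ k
    entry-suc-∸ []       i       k = sym (ℕₚ.0∸n≡0 k)
    entry-suc-∸ (z ∷ zs) zero    k = refl
    entry-suc-∸ (z ∷ zs) (suc i) k = entry-suc-∸ zs i k

    entry-≤ : ∀ {m xs} → All (_≤ m) xs → ∀ i → entry xs i ≤ m
    entry-≤ []         i       = z≤n
    entry-≤ (x≤m ∷ _)  zero    = x≤m
    entry-≤ (_ ∷ x≤m)  (suc i) = entry-≤ x≤m i

    entry-beyond : ∀ xs {i} → length xs ≤ i → entry xs i ≡ 0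
    entry-beyond []       _         = refl
    entry-beyond (x ∷ xs) (s≤s le)  = entry-beyond xs le

    diagonal : List ℕ → ℕ
    diagonal xs = length (filter (λ i → i <? entry xs i) (upTo (length xs)))

    filter-upTo-+ : ∀ {p} {P : Pred ℕ p} (P? : Decidable P) n r → (∀ i → n ≤ i → ¬ P i) →
                    filter P? (upTo (n + r)) ≡ filter P? (upTo n)
    filter-upTo-+ P? n zero    _  = cong (filter P? ∘ upTo) (ℕₚ.+-identityʳ n)
    filter-upTo-+ P? n (suc r) ¬P = begin
      filter P? (upTo (n + suc r))               ≡⟨ cong (filter P? ∘ upTo) (ℕₚ.+-suc n r) ⟩
      filter P? (upTo (suc (n + r)))             ≡⟨ cong (filter P?) (Listₚ.upTo-∷ʳ (n + r)) ⟨
      filter P? (upTo (n + r) ++ [ n + r ])      ≡⟨ Listₚ.filter-++ P? (upTo (n + r)) [ n + r ] ⟩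
      filter P? (upTo (n + r)) ++ filter P? [ n + r ]
        ≡⟨ cong₂ _++_ (filter-upTo-+ P? n r ¬P) (Listₚ.filter-none P? (¬P (n + r) (ℕₚ.m≤m+n n r) ∷ [])) ⟩
      filter P? (upTo n) ++ []                   ≡⟨ Listₚ.++-identityʳ _ ⟩
      filter P? (upTo n)                         ∎
      where open ≡.≡-Reasoning

  -- Diagonal box i+1 of the shape is diagonal box i of the peeled shape; the zero rows used as
  -- padding have none.
  Frobenius-diagonal : ∀ {xs ps qs} → Frobenius xs ps qs → diagonal xs ≡ length ps
  Frobenius-diagonal [] = refl
  Frobenius-diagonal (hook {xs} {ps} {p = p} r x≤p F) = cong suc (begin
    length (filter P? (applyUpTo suc (length (map suc zs))))
      ≡⟨ cong (length ∘ filter P?) (trans (cong (applyUpTo suc) (Listₚ.length-map suc zs)) (sym (Listₚ.map-upTo suc (length zs)))) ⟩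
    length (filter P? (map suc (upTo (length zs))))
      ≡⟨ length-filter-map P? Q? suc
           (λ i p → subst (i <_) (entry-pad xs r i) (entry-suc-< zs i i p))
           (λ i p → entry-suc-<⁻ zs i i (subst (i <_) (sym (entry-pad xs r i)) p)) (upTo (length zs)) ⟩
    length (filter Q? (upTo (length zs)))
      ≡⟨ cong (λ n → length (filter Q? (upTo n))) (length-pad xs r) ⟩
    length (filter Q? (upTo (length xs + r)))
      ≡⟨ cong length (filter-upTo-+ Q? (length xs) r λ i le i< → ℕₚ.n≮0 (subst (i <_) (entry-beyond xs le) i<)) ⟩
    diagonal xs
      ≡⟨ Frobenius-diagonal F ⟩
    length ps ∎)
    where
    open ≡.≡-Reasoning
    zs = pad xs r
    P? = λ i → i <? entry (suc p ∷ map suc zs) i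
    Q? = λ i → i <? entry xs i

  Frobenius-diag : ∀ μ {ps qs} → Frobenius (parts μ) ps qs → diag μ ≡ length ps
  Frobenius-diag μ F = Frobenius-diagonal F

  private
    diagonal-< : ∀ {xs ps qs} → Frobenius xs ps qs → ∀ i → i < length ps → i < entry xs i
    diagonal-< (hook r _ F) zero    _          = s≤s z≤n
    diagonal-< (hook {xs} r _ F) (suc i) (s≤s i<d) =
      entry-suc-<⁻ (pad xs r) i i (subst (i <_) (sym (entry-pad xs r i)) (diagonal-< F i i<d))

    arms′ : ∀ {xs ps qs} → Frobenius xs ps qs → applyUpTo (λ i → entry xs i ∸ suc i) (length ps) ≡ ps
    arms′ [] = refl
    arms′ (hook {xs} {ps} {p = p} r _ F) = cong (p ∷_) (trans
      (applyUpTo-cong (length ps) λ i _ → trans (entry-suc-∸ (pad xs r) i (suc i)) (cong (_∸ suc i) (entry-pad xs r i)))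
      (arms′ F))

    column : List ℕ → ℕ → ℕ
    column xs j = length (filter (j <?_) xs)

    column-suc : ∀ xs r j → column (map suc (pad xs r)) (suc j) ≡ column xs j
    column-suc xs r j = begin
      length (filter (suc j <?_) (map suc (pad xs r)))
        ≡⟨ length-filter-map (suc j <?_) (j <?_) suc (λ _ → ℕₚ.≤-pred) (λ _ → s≤s) (pad xs r) ⟩
      length (filter (j <?_) (pad xs r))
        ≡⟨ cong length (Listₚ.filter-++ (j <?_) xs (replicate r 0)) ⟩
      length (filter (j <?_) xs ++ filter (j <?_) (replicate r 0))
        ≡⟨ cong (λ zs → length (filter (j <?_) xs ++ zs)) (filter-replicate j r) ⟩
      length (filter (j <?_) xs ++ [])
        ≡⟨ cong length (Listₚ.++-identityʳ (filter (j <?_) xs)) ⟩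
      column xs j ∎
      where open ≡.≡-Reasoning

    column-zero : ∀ zs → column (map suc zs) 0 ≡ length zs
    column-zero zs = trans (cong length (Listₚ.filter-all (0 <?_) (Allₚ.map⁺ (All.universal (λ _ → s≤s z≤n) zs)))) (Listₚ.length-map suc zs)

    legs′ : ∀ {xs ps qs} → Frobenius xs ps qs → applyUpTo (λ i → column xs i ∸ suc i) (length ps) ≡ qs
    legs′ [] = refl
    legs′ (hook {xs} {ps} {p = p} r x≤p F) = cong₂ _∷_
      (trans (column-zero (pad xs r)) (length-pad xs r))
      (trans (applyUpTo-cong (length ps) λ i i<d → cong (_∸ suc (suc i)) (trans
               (cong length (Listₚ.filter-accept (suc i <?_) {xs = map suc (pad xs r)} (s≤s (ℕₚ.<-≤-trans (diagonal-< F i i<d) (entry-≤ x≤p i)))))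
               (cong suc (column-suc xs r i))))
             (legs′ F))

  Frobenius-arms : ∀ μ {ps qs} → Frobenius (parts μ) ps qs → applyUpTo (arm μ) (length ps) ≡ ps
  Frobenius-arms μ F = arms′ F

  Frobenius-legs : ∀ μ {ps qs} → Frobenius (parts μ) ps qs → applyUpTo (leg μ) (length ps) ≡ qs
  Frobenius-legs μ F = legs′ F

  private
    entry-map-suc-mono : ∀ {ys zs} → length ys ≤ length zs → (∀ i → entry ys i ≤ entry zs i) →
                         ∀ i → entry (map suc ys) i ≤ entry (map suc zs) i
    entry-map-suc-mono {[]}     {_}      _        _  i       = z≤n
    entry-map-suc-mono {y ∷ ys} {z ∷ zs} _        le zero    = s≤s (le 0)
    entry-map-suc-mono {y ∷ ys} {z ∷ zs} (s≤s l≤) le (suc i) = entry-map-suc-mono {ys} {zs} l≤ (le ∘ suc) i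

  -- Peel one hook from each shape: the arms compare the first rows, the legs compare the numbers of
  -- rows below, and what lies inside is compared by induction.
  Frobenius-⊆ : ∀ {xs ps qs xs′ ps′ qs′} → Frobenius xs ps qs → Frobenius xs′ ps′ qs′ →
    Pointwise _≤_ ps′ ps → Pointwise _≤_ qs′ qs → ∀ i → entry xs′ i ≤ entry xs i
  Frobenius-⊆ []               []                []         []         i       = z≤n
  Frobenius-⊆ (hook _ _ _)     (hook _ _ _)      (p≤ ∷ _)   _          zero    = s≤s p≤
  Frobenius-⊆ (hook {xs} r _ F) (hook {xs′} r′ _ F′) (_ ∷ ps≤) (q≤ ∷ qs≤) (suc i) =
    entry-map-suc-mono {pad xs′ r′} {pad xs r} (ℕₚ.≤-trans (ℕₚ.≤-reflexive (length-pad xs′ r′)) (ℕₚ.≤-trans q≤ (ℕₚ.≤-reflexive (sym (length-pad xs r)))))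
      (λ i → ℕₚ.≤-trans (ℕₚ.≤-reflexive (entry-pad xs′ r′ i))
        (ℕₚ.≤-trans (Frobenius-⊆ F F′ ps≤ qs≤ i) (ℕₚ.≤-reflexive (sym (entry-pad xs r i))))) i

  -- For k = 0 these are the numbers μ_i - i + 1, with i counted from 1, that label the rows of the
  -- Jacobi-Trudi matrix; k counts the rows already removed.
  contents : ℕ → List ℕ → List ℤ
  contents k []       = []
  contents k (x ∷ xs) = (+ x ℤ.- + k) ∷ contents (suc k) xs

  tabulate-contents : ∀ k xs → tabulate {n = length xs} (λ i → + entry xs (toℕ i) ℤ.- + (k + toℕ i)) ≡ contents k xs
  tabulate-contents k []       = refl
  tabulate-contents k (x ∷ xs) = cong₂ _∷_ (cong (λ j → + x ℤ.- + j) (ℕₚ.+-identityʳ k))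
    (trans (Listₚ.tabulate-cong λ i → cong (λ j → + entry xs (toℕ i) ℤ.- + j) (ℕₚ.+-suc k (toℕ i)))
           (tabulate-contents (suc k) xs))

  private
    contents-suc : ∀ k xs → contents (suc k) (map suc xs) ≡ contents k xs
    contents-suc k []       = refl
    contents-suc k (x ∷ xs) = cong₂ _∷_
      (trans (ℤₚ.[+m]-[+n]≡m⊖n (suc x) (suc k)) (trans (ℤₚ.[1+m]⊖[1+n]≡m⊖n x k) (sym (ℤₚ.[+m]-[+n]≡m⊖n x k))))
      (contents-suc (suc k) xs)

    contents-++ : ∀ k xs ys → contents k (xs ++ ys) ≡ contents k xs ++ contents (k + length xs) ys
    contents-++ k []       ys = cong (λ k → contents k ys) (sym (ℕₚ.+-identityʳ k))
    contents-++ k (x ∷ xs) ys = cong ((+ x ℤ.- + k) ∷_) (trans (contents-++ (suc k) xs ys)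
      (cong (λ k′ → contents (suc k) xs ++ contents k′ ys) (sym (ℕₚ.+-suc k (length xs)))))

    contents-replicate : ∀ k r → contents k (replicate r 0) ≡ map (λ j → ℤ.- (+ j)) (applyUpTo (ℕ._+_ k) r)
    contents-replicate k zero    = refl
    contents-replicate k (suc r) = cong₂ _∷_
      (trans (ℤₚ.+-identityˡ _) (cong (λ j → ℤ.- (+ j)) (sym (ℕₚ.+-identityʳ k))))
      (trans (contents-replicate (suc k) r)
        (cong (map (λ j → ℤ.- (+ j))) (applyUpTo-cong r λ i _ → sym (ℕₚ.+-suc k i))))

    Maya-pad : ∀ {n hs us} r → Maya n hs us → Maya (n + r) hs (us ++ applyUpTo (ℕ._+_ n) r)
    Maya-pad {n} {hs} {us} zero    m = ≡.subst₂ (λ k us → Maya k hs us) (sym (ℕₚ.+-identityʳ n)) (sym (Listₚ.++-identityʳ us)) m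
    Maya-pad {n} {hs} {us} (suc r) m = ≡.subst₂ (λ k us → Maya k hs us) (sym (ℕₚ.+-suc n r))
      (trans (Listₚ.++-assoc us _ _) (cong (us ++_) (Listₚ.applyUpTo-∷ʳ (ℕ._+_ n) r))) (bead (Maya-pad r m))

  -- The arms are the positive contents lowered by 1; the legs are the gaps among the nonpositive
  -- ones. Attaching a hook places r beads above the old positions, one for each row of length 1
  -- below the first row, and then a hole at the leg of the hook. The contents appear in the order
  -- of the rows, so no permutation sign arises.
  Frobenius-contents : ∀ {xs ps qs} → Frobenius xs ps qs → ∃ λ us →
    Maya (length xs) qs us × contents 0 xs ≡ map (λ p → + suc p) ps ++ map (λ j → ℤ.- (+ j)) us
  Frobenius-contents [] = [] , empty , refl
  Frobenius-contents (hook {xs} {ps} {qs} {p} r _ F) with Frobenius-contents F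
  ... | us , m , eq = _ ,
    subst (λ n → Maya (suc n) (length xs + r ∷ qs) (us ++ applyUpTo (ℕ._+_ (length xs)) r))
      (sym (trans (Listₚ.length-map suc (pad xs r)) (length-pad xs r))) (hole (Maya-pad r m)) ,
    cong₂ _∷_ (ℤₚ.+-identityʳ (+ suc p)) (begin
      contents 1 (map suc (pad xs r))
        ≡⟨ contents-suc 0 (pad xs r) ⟩
      contents 0 (pad xs r)
        ≡⟨ contents-++ 0 xs (replicate r 0) ⟩
      contents 0 xs ++ contents (length xs) (replicate r 0)
        ≡⟨ cong₂ _++_ eq (contents-replicate (length xs) r) ⟩
      (map (λ p → + suc p) ps ++ map neg us) ++ map neg (applyUpTo (ℕ._+_ (length xs)) r)
        ≡⟨ Listₚ.++-assoc (map (λ p → + suc p) ps) _ _ ⟩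
      map (λ p → + suc p) ps ++ map neg us ++ map neg (applyUpTo (ℕ._+_ (length xs)) r)
        ≡⟨ cong (map (λ p → + suc p) ps ++_) (Listₚ.map-++ neg us _) ⟨
      map (λ p → + suc p) ps ++ map neg (us ++ applyUpTo (ℕ._+_ (length xs)) r) ∎)
    where
    open ≡.≡-Reasoning
    neg : ℕ → ℤ
    neg j = ℤ.- (+ j)

  Partition-≡ : ∀ {μ ν} → parts μ ≡ parts ν → μ ≡ ν
  Partition-≡ {μ} {ν} refl = cong₂ (λ s p → record { parts = parts μ ; sorted = s ; positive = p })
    (Linked.irrelevant ℕₚ.≤-irrelevant (sorted μ) (sorted ν)) (All.irrelevant ℕₚ.≤-irrelevant (positive μ) (positive ν))

open Partitions

-- The Giambelli formula.

module Giambelli {c ℓ} (R : CommutativeRing c ℓ) (χ : ℕ → CommutativeRing.Carrier R) where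
  open CommutativeRing R hiding (zero)
  open IntegerSolver R
  open ListSum R
  open Contraction R
  open Determinants R
  open Moments R
  open SetoidReasoning setoid

  -- For χ i = h_{i+1} this is the Schur function of the hook (k | l), by
  -- h_{k+1} e_{l+1} = s_(k|l+1) + s_(k+1|l) and e_{l+1} = s_(0|l).
  hookSchur : ℕ → ℕ → Carrier
  hookSchur k zero    = χ k
  hookSchur k (suc l) = - 1# * hookSchur (suc k) l + χ k * hookSchur 0 l

  hookFunction : (α β : ℕ → Carrier) → ℕ → ℕ → Carrier
  hookFunction α β p q = factorial α p λ k → factorial β q (hookSchur k)

  module _ (a : ℤ → Carrier) where

    shift : (ℤ → Carrier) → ℤ → Carrier
    shift f n = f (ℤ.suc n) + a n * f n

    jacobiTrudi : (ℤ → Carrier) → ℕ → ℤ → Carrier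
    jacobiTrudi x₀ zero    n = x₀ n
    jacobiTrudi x₀ (suc q) n = shift (jacobiTrudi x₀ q) n - a (ℤ.- (+ q)) * jacobiTrudi x₀ q n

  -- jacobiTrudi a x₀ q n is the entry h_{n+q;τ^{-q}a} of the Jacobi–Trudi matrix.
  -- Column operations turn it into giambelli q n, which is a hook function for
  -- n > 0 and a multiple of a unit vector for n ≤ 0.
  module _ (a : ℤ → Carrier) (x₀ : ℤ → Carrier) (x₀-zero : x₀ (+ 0) ≈ 1#) (x₀-neg : ∀ n → x₀ -[1+ n ] ≈ 0#)
           (x₀-pos : ∀ p → x₀ (+ suc p) ≈ factorial (λ i → a (+ suc i)) p χ) where
    private
      x = jacobiTrudi a x₀
      v : ℕ → ℤ
      v j = ℤ.- (+ j)
      α β : ℕ → Carrier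
      α i = a (+ suc i)
      β i = - a (v i)

    giambelli : ℕ → ℤ → Carrier
    giambelli zero    n = x₀ n
    -- The multiple of `x₀` cancels, at n = 0, the value `giambelli q (+ 1)` that `shift` brings
    -- there; at negative n it contributes nothing.
    giambelli (suc q) n = (a (v q) * giambelli q n - shift a (giambelli q) n) + giambelli q (+ 1) * x₀ n

    private
      y = giambelli

      remainder : ℕ → ℤ → Carrier
      remainder q n = y q n - sgn q * x q n

      InSpan-shift : ∀ {q g} s → InSpan x q g → InSpan x (suc q) (λ n → s * g n - shift a g n)
      InSpan-shift s (zeroₛ p) = zeroₛ λ n → trans
        (+-cong (*-congˡ (p n)) (-‿cong (+-cong (p (ℤ.suc n)) (*-congˡ (p n)))))
        (solve 2 (λ s a → s :* con (+ 0) :- (con (+ 0) :+ a :* con (+ 0)) := con (+ 0)) refl s (a n))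
      InSpan-shift s (addₛ {g = g} {g′} {r} t r<q sp p) =
        addₛ (t * (s - a (v r))) (ℕₚ.m<n⇒m<1+n r<q)
          (addₛ (- t) (s≤s r<q) (InSpan-shift s sp) λ n → refl) λ n → trans
        (+-cong (*-congˡ (p n)) (-‿cong (+-cong (p (ℤ.suc n)) (*-congˡ (p n)))))
        (solve 8 (λ s t a b x x′ g g′ →
             s :* (t :* x :+ g) :- ((t :* x′ :+ g′) :+ a :* (t :* x :+ g))
          := (t :* (s :- b)) :* x :+ ((:- t) :* ((x′ :+ a :* x) :- b :* x) :+ (s :* g :- (g′ :+ a :* g))))
          refl s t (a n) (a (v r)) (x r n) (x r (ℤ.suc n)) (g n) (g (ℤ.suc n)))

      remainder-InSpan : ∀ q → InSpan x q (remainder q)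
      remainder-InSpan zero    = zeroₛ λ n → solve 1 (λ x → x :- con (+ 1) :* x := con (+ 0)) refl _
      remainder-InSpan (suc q) = addₛ (y q (+ 1)) (s≤s z≤n) (InSpan-shift (a (v q)) (remainder-InSpan q)) λ n →
        solve 9 (λ b y y′ a c x₀ s x x′ →
             ((b :* y :- (y′ :+ a :* y)) :+ c :* x₀) :- (:- s) :* ((x′ :+ a :* x) :- b :* x)
          := c :* x₀ :+ (b :* (y :- s :* x) :- ((y′ :- s :* x′) :+ a :* (y :- s :* x))))
          refl (a (v q)) (y q n) (y q (ℤ.suc n)) (a n) (y q (+ 1)) (x₀ n) (sgn q) (x q n) (x q (ℤ.suc n))

      units : ∀ q → (y q (v q) ≈ sgn q) × (∀ {j} → j ≢ q → y q (v j) ≈ 0#)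
      units zero = x₀-zero , λ { {zero} j≢ → contradiction ≡.refl j≢ ; {suc j} _ → x₀-neg j }
      units (suc q) with units q
      ... | diagonal , off = diagonal′ , off′ _
        where
        ℤ-suc : ∀ j → ℤ.suc -[1+ j ] ≡ v j
        ℤ-suc zero    = ≡.refl
        ℤ-suc (suc j) = ≡.refl
        below : ∀ j {u w} → y q (v j) ≈ u → a (v q) * y q -[1+ j ] - a -[1+ j ] * y q -[1+ j ] ≈ w → y (suc q) -[1+ j ] ≈ w - u
        below j {u} {w} p r = begin
          (a (v q) * y q -[1+ j ] - (y q (ℤ.suc -[1+ j ]) + a -[1+ j ] * y q -[1+ j ])) + y q (+ 1) * x₀ -[1+ j ]
            ≈⟨ +-cong (+-congˡ (-‿cong (+-congʳ (trans (reflexive (≡.cong (y q) (ℤ-suc j))) p)))) (*-congˡ (x₀-neg j)) ⟩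
          (a (v q) * y q -[1+ j ] - (u + a -[1+ j ] * y q -[1+ j ])) + y q (+ 1) * 0#
            ≈⟨ solve 4 (λ x u z c → (x :- (u :+ z)) :+ c :* con (+ 0) := (x :- z) :- u) refl _ u _ _ ⟩
          (a (v q) * y q -[1+ j ] - a -[1+ j ] * y q -[1+ j ]) - u
            ≈⟨ +-congʳ r ⟩
          w - u ∎
        vanish : ∀ {s t z} → z ≈ 0# → s * z - t * z ≈ 0#
        vanish {s} {t} z≈0 = trans (+-cong (*-congˡ z≈0) (-‿cong (*-congˡ z≈0)))
          (solve 2 (λ s t → s :* con (+ 0) :- t :* con (+ 0) := con (+ 0)) refl s t)
        diagonal′ : y (suc q) -[1+ q ] ≈ - sgn q
        diagonal′ = trans (below q diagonal (vanish (off λ ()))) (+-identityˡ _)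
        off′ : ∀ j → j ≢ suc q → y (suc q) (v j) ≈ 0#
        off′ zero _ with q ℕ.≟ 0
        ... | yes ≡.refl = trans (+-congˡ (*-congˡ x₀-zero))
              (solve 3 (λ a y y′ → (a :* y :- (y′ :+ a :* y)) :+ y′ :* con (+ 1) := con (+ 0)) refl _ _ _)
        ... | no  q≢0    = trans (+-cong (+-cong (*-congˡ y0) (-‿cong (+-congˡ (*-congˡ y0)))) (*-congˡ x₀-zero))
              (solve 3 (λ a y b → (a :* con (+ 0) :- (y :+ b :* con (+ 0))) :+ y :* con (+ 1) := con (+ 0)) refl _ _ _)
          where y0 = off (q≢0 ∘ ≡.sym)
        off′ (suc j) j≢ = trans (below j (off (j≢ ∘ ≡.cong suc)) cancel) (-‿inverseʳ 0#)
          where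
          cancel : a (v q) * y q -[1+ j ] - a -[1+ j ] * y q -[1+ j ] ≈ 0#
          cancel with suc j ℕ.≟ q
          ... | yes ≡.refl = -‿inverseʳ _
          ... | no  sj≢q   = vanish (off sj≢q)

    giambelli-hook : ∀ q p → giambelli q (+ suc p) ≈ hookFunction α β p q
    giambelli-hook zero    p = x₀-pos p
    giambelli-hook (suc q) p = begin
      (a (v q) * y q (+ suc p) - (y q (+ suc (suc p)) + α p * y q (+ suc p))) + y q (+ 1) * x₀ (+ suc p)
        ≈⟨ +-cong (+-cong (*-congˡ (giambelli-hook q p)) (-‿cong (+-cong (giambelli-hook q (suc p)) (*-congˡ (giambelli-hook q p)))))
                  (*-cong (giambelli-hook q 0) (x₀-pos p)) ⟩
      (a (v q) * F - ((F′ - α p * F) + α p * F)) + ω 0 * X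
        ≈⟨ solve 6 (λ b f f′ c o x → (b :* f :- ((f′ :- c :* f) :+ c :* f)) :+ o :* x
                                   := con -[1+ 0 ] :* f′ :+ con (+ 1) :* (o :* x :+ b :* f)) refl _ F F′ _ _ X ⟩
      - 1# * F′ + 1# * (ω 0 * X + a (v q) * F)
        ≈⟨ +-congˡ (*-congˡ (factorial-linear α (ω 0) (a (v q)) χ ω p)) ⟨
      - 1# * F′ + 1# * factorial α p (λ k → ω 0 * χ k + a (v q) * ω k)
        ≈⟨ factorial-linear α (- 1#) 1# (ω ∘ suc) (λ k → ω 0 * χ k + a (v q) * ω k) p ⟨
      factorial α p (λ k → - 1# * ω (suc k) + 1# * (ω 0 * χ k + a (v q) * ω k))
        ≈⟨ factorial-cong {α} (λ _ → refl) (λ k → trans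
             (solve 5 (λ w w₀ x a z → con -[1+ 0 ] :* w :+ con (+ 1) :* (w₀ :* x :+ a :* z)
                                   := (con -[1+ 0 ] :* w :+ x :* w₀) :- (:- a) :* z) refl _ (ω 0) (χ k) (a (v q)) (ω k))
             (+-congʳ (sym (factorial-linear β (- 1#) (χ k) (hookSchur (suc k)) (hookSchur 0) q)))) p ⟩
      hookFunction α β p (suc q) ∎
      where
      ω : ℕ → Carrier
      ω k = factorial β q (hookSchur k)
      F F′ X : Carrier
      F  = factorial α p ω
      F′ = factorial α p (ω ∘ suc)
      X  = factorial α p χ

    giambelliFormula : ∀ {n ps qs us} → Maya n qs us → length ps ≡ length qs →
      Δ x (upTo n) (map (λ p → + suc p) ps ++ map v us) ≈ Δ (hookFunction α β) ps qs
    giambelliFormula {n} {ps} {qs} {us} m e = begin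
      Δ x (upTo n) (map (λ p → + suc p) ps ++ map v us)
        ≈⟨ Δ-unitriangular (λ q n → solve 2 (λ y x → y := x :+ (y :- x)) refl _ _) remainder-InSpan n _ ⟨
      Δ y (downFrom n) (map (λ p → + suc p) ps ++ map v us)
        ≈⟨ Δ-Maya y v (λ j → proj₁ (units j)) (λ {j} {q} → proj₂ (units q)) m _ (≡.trans (Listₚ.length-map _ ps) e) ⟩
      Δ y qs (map (λ p → + suc p) ps)
        ≈⟨ trans (Δ-transpose y qs _) (Δ-map (flip y) (λ p → + suc p) ps qs) ⟩
      Δ (λ p q → y q (+ suc p)) ps qs
        ≈⟨ Δ-cong (λ p q → giambelli-hook q p) ps qs ⟩
      Δ (hookFunction α β) ps qs ∎

  factorial-Σ : ∀ {k} {K : Set k} α p (ks : List K) (c : K → Carrier) (f : K → ℕ → Carrier) →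
    factorial α p (λ i → Σ[ ks ] (λ k → c k * f k i)) ≈ Σ[ ks ] (λ k → c k * factorial α p (f k))
  factorial-Σ α p []       c f = trans
    (factorial-cong {α} (λ _ → refl) (λ _ → solve 0 (con (+ 0) := con (+ 0) :* con (+ 0) :+ con (+ 0) :* con (+ 0)) refl) p)
    (trans (factorial-linear α 0# 0# (λ _ → 0#) (λ _ → 0#) p) (solve 1 (λ x → con (+ 0) :* x :+ con (+ 0) :* x := con (+ 0)) refl _))
  factorial-Σ α p (k ∷ ks) c f = trans
    (factorial-cong {α} (λ _ → refl) (λ i → +-congˡ (sym (*-identityˡ _))) p)
    (trans (factorial-linear α (c k) 1# (f k) _ p) (+-congˡ (trans (*-identityˡ _) (factorial-Σ α p ks c f))))

  expansion : ∀ {α β α′ β′ C C′} → IsTransition α α′ C → IsTransition β β′ C′ → ∀ {m ps qs} →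
    All (_< m) ps → All (_< m) qs →
    Δ (hookFunction α β) ps qs ≈
      Σ[ sublists (length ps) (downFrom m) ] λ κ → Σ[ sublists (length qs) (downFrom m) ] λ ν →
        (Δ C ps κ * Δ C′ qs ν) * Δ (hookFunction α′ β′) κ ν
  expansion {α} {β} {α′} {β′} {C} {C′} T T′ {m} {ps} {qs} ps<m qs<m = begin
    Δ (hookFunction α β) ps qs
      ≈⟨ cauchyBinet (hookFunction α β) C (hookFunction α′ β) (downFrom m) ps
           (All.map (λ {p} p<m q → factorial-transition T p m _ p<m) ps<m) qs ⟩
    Σ[ sublists (length ps) (downFrom m) ] (λ κ → Δ C ps κ * Δ (hookFunction α′ β) κ qs)
      ≈⟨ Σ-cong (sublists (length ps) (downFrom m)) (λ κ _ → trans (*-congˡ (columns κ)) (trans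
           (sym (Σ-*ˡ (sublists (length qs) (downFrom m)) _ _))
           (Σ-cong (sublists (length qs) (downFrom m)) λ ν _ → sym (*-assoc _ _ _)))) ⟩
    _ ∎
    where
    columns : ∀ κ → Δ (hookFunction α′ β) κ qs ≈
      Σ[ sublists (length qs) (downFrom m) ] (λ ν → Δ C′ qs ν * Δ (hookFunction α′ β′) κ ν)
    columns κ = begin
      Δ (hookFunction α′ β) κ qs
        ≈⟨ Δ-transpose (hookFunction α′ β) κ qs ⟩
      Δ (flip (hookFunction α′ β)) qs κ
        ≈⟨ cauchyBinet (flip (hookFunction α′ β)) C′ (flip (hookFunction α′ β′)) (downFrom m) qs
             (All.map (λ {q} q<m p → trans
               (factorial-cong {α′} (λ _ → refl) (λ k → factorial-transition T′ q m (hookSchur k) q<m) p)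
               (factorial-Σ α′ p (downFrom m) (C′ q) (λ q′ k → factorial β′ q′ (hookSchur k)))) qs<m) κ ⟩
      Σ[ sublists (length qs) (downFrom m) ] (λ ν → Δ C′ qs ν * Δ (flip (hookFunction α′ β′)) ν κ)
        ≈⟨ Σ-cong (sublists (length qs) (downFrom m)) (λ ν _ → *-congˡ (Δ-transpose (flip (hookFunction α′ β′)) ν κ)) ⟩
      Σ[ sublists (length qs) (downFrom m) ] (λ ν → Δ C′ qs ν * Δ (hookFunction α′ β′) κ ν) ∎

-- The elements s_{μ;a} as coefficient series in Frobenius coordinates.

module SchurSeries {c ℓ} (K : CommutativeRing c ℓ) where
  open CommutativeRing K hiding (zero)
  open SymmetricFunctions K
  open SeriesRing K
  open HookCoefficients K
  open IntegerSolver K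
  open import Algebra.Definitions.RawMonoid +-rawMonoid using (sum)
  open import Algebra.Definitions.RawMonoid (RawRing.+-rawMonoid Λ-rawRing) using () renaming (sum to sumΛ)
  open import Algebra.Definitions.RawSemiring (RawRing.rawSemiring rawRing) using (_^_)
  open import Algebra.Properties.Ring ring
  open SetoidReasoning setoid

  module K where
    open Contraction K public
    open Moments K public
    open Determinants K public

  module S where
    open CommutativeRing seriesRing public
    open IntegerSolver seriesRing public
    open ListSum seriesRing public
    open Contraction seriesRing public
    open Moments seriesRing public
    open Determinants seriesRing public

  ι : Carrier → Series
  ι x = x •ₛ 1ₛ

  ι-⊛ : ∀ x f → ι x ⊛ f ≈ₛ x •ₛ f
  ι-⊛ x f α = trans (•-⊛ x 1ₛ f α) (*-congˡ (⊛-identityˡ f α))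

  ι-cong : ∀ {x y} → x ≈ y → ι x ≈ₛ ι y
  ι-cong p α = *-congʳ p

  ι-isHomomorphic : IsHomomorphic rawRing seriesRing ι
  ι-isHomomorphic = record
    { +-homo = λ x y α → distribʳ _ x y
    ; *-homo = λ x y α → trans (*-assoc x y _) (sym (ι-⊛ x (ι y) α))
    ; -‿homo = λ x α → sym (-‿distribˡ-* x _)
    ; 0-homo = λ α → zeroˡ _
    ; 1-homo = λ α → *-identityˡ _
    }

  coeff-isHomomorphic : IsHomomorphic Λ-rawRing seriesRing coeff
  coeff-isHomomorphic = record
    { +-homo = λ _ _ _ → refl ; *-homo = λ _ _ _ → refl ; -‿homo = λ _ _ → refl
    ; 0-homo = λ _ → refl ; 1-homo = λ _ → refl }

  χ : ℕ → Series
  χ i = coeff (h (suc i))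

  open Giambelli seriesRing χ

  scalars : Sequence → ℕ → Series
  scalars a i = ι (a (+ suc i))

  entries : Sequence → ℤ → Series
  entries a n = coeff (hₐ n a)

  factorial-coefficient : ∀ (α : ℕ → Carrier) p (φ : ℕ → Series) β →
    S.factorial (ι ∘ α) p φ β ≈ K.factorial α p (λ i → φ i β)
  factorial-coefficient α zero    φ β = refl
  factorial-coefficient α (suc p) φ β = +-cong (factorial-coefficient α p (φ ∘ suc) β)
    (-‿cong (trans (ι-⊛ (α p) _ β) (*-congˡ (factorial-coefficient α p φ β))))

  private
    conv : ℕ → (ℕ → Carrier) → (ℕ → Carrier) → Carrier
    conv k E φ = sum {suc k} λ i → E (k ∸ toℕ i) * φ (toℕ i)

    conv-step : ∀ x {E E′} → E′ 0 ≈ E 0 → (∀ j → E′ (suc j) ≈ E (suc j) - x * E j) →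
                ∀ k φ → conv (suc k) E′ φ ≈ conv (suc k) E φ - x * conv k E φ
    conv-step x {E} {E′} p q zero    φ = trans (+-cong (*-congʳ (q 0)) (+-congʳ (*-congʳ p)))
      (solve 5 (λ e x e₀ a b → (e :- x :* e₀) :* a :+ (e₀ :* b :+ con (+ 0)) := (e :* a :+ (e₀ :* b :+ con (+ 0))) :- x :* (e₀ :* a :+ con (+ 0)))
        refl (E 1) x (E 0) (φ 0) (φ 1))
    conv-step x {E} {E′} p q (suc k) φ = trans (+-cong (*-congʳ (q (suc k))) (conv-step x {E} {E′} p q k (φ ∘ suc)))
      (solve 6 (λ e x f a u v → (e :- x :* f) :* a :+ (u :- x :* v) := (e :* a :+ u) :- x :* (f :* a :+ v))
        refl (E (suc (suc k))) x (E (suc k)) (φ 0) _ _)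

    -- Vieta: the coefficients of (u - a_1)...(u - a_p) are the signed elementary polynomials in the
    -- definition of h_{p+1;a}. Hence h_{p+1;a} is the functional u^i ↦ h_{i+1} applied to (u|a)^p.
    factorial-e : ∀ a p φ → K.factorial (λ i → a (+ suc i)) p φ ≈ conv p (λ j → ((- 1#) ^ j) * e[ j ] (first a p)) φ
    factorial-e a zero    φ = solve 1 (λ x → x := (con (+ 1) :* con (+ 1)) :* x :+ con (+ 0)) refl (φ 0)
    factorial-e a (suc p) φ = begin
      K.factorial α p (φ ∘ suc) - α p * K.factorial α p φ
        ≈⟨ +-cong (factorial-e a p (φ ∘ suc)) (-‿cong (*-congˡ (factorial-e a p φ))) ⟩
      conv p E (φ ∘ suc) - α p * conv p E φ
        ≈⟨ +-congʳ (trans (+-congʳ (trans (*-congʳ vanishes) (zeroˡ _))) (+-identityˡ _)) ⟨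
      conv (suc p) E φ - α p * conv p E φ
        ≈⟨ conv-step (α p) {E} {E′} refl step p φ ⟨
      conv (suc p) E′ φ ∎
      where
      α E E′ : ℕ → Carrier
      α i  = a (+ suc i)
      E j  = ((- 1#) ^ j) * e[ j ] (first a p)
      E′ j = ((- 1#) ^ j) * e[ j ] (first a (suc p))
      vanishes : E (suc p) ≈ 0#
      vanishes = trans (*-congˡ (e-vanishes (suc p) (first a p)
        (s≤s (ℕₚ.≤-reflexive (Listₚ.length-applyUpTo (λ i → a (+ suc i)) p))))) (zeroʳ _)
      step : ∀ j → E′ (suc j) ≈ E (suc j) - α p * E j
      step j = trans
        (*-congˡ (trans (reflexive (≡.cong e[ suc j ] (first-suc a p))) (e-snoc j (first a p) (α p))))
        (solve 4 (λ s e x f → (con -[1+ 0 ] :* s) :* (e :+ x :* f) := (con -[1+ 0 ] :* s) :* e :- x :* (s :* f)) refl _ _ _ _)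

    coeff-sum : ∀ {n} (t : Fin n → Λ) β →
      coeff (sumΛ t) β ≈ sum (λ i → coeff (t i) β)
    coeff-sum {zero}  t β = refl
    coeff-sum {suc n} t β = +-congˡ (coeff-sum (t ∘ Fin.suc) β)

  entries-factorial : ∀ a p → entries a (+ suc p) ≈ₛ S.factorial (scalars a) p χ
  entries-factorial a p β = begin
    entries a (+ suc p) β
      ≈⟨ coeff-sum {suc p} (λ i → (((- 1#) ^ (p ∸ toℕ i)) * e[ p ∸ toℕ i ] (first a p)) • h (suc (toℕ i))) β ⟩
    conv p (λ j → ((- 1#) ^ j) * e[ j ] (first a p)) (λ i → χ i β)
      ≈⟨ factorial-e a p (λ i → χ i β) ⟨
    K.factorial (λ i → a (+ suc i)) p (λ i → χ i β)
      ≈⟨ factorial-coefficient (λ i → a (+ suc i)) p χ β ⟨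
    S.factorial (scalars a) p χ β ∎

  private
    entries-cong : ∀ {a b} → (∀ i → a i ≡ b i) → ∀ n → entries a n ≈ₛ entries b n
    entries-cong         p -[1+ n ]  = S.refl
    entries-cong         p (+ zero)  = S.refl
    entries-cong {a} {b} p (+ suc n) = S.trans (entries-factorial a n) (S.trans
      (S.factorial-cong (λ i → ι-cong (reflexive (p (+ suc i)))) (λ _ → S.refl) n)
      (S.sym (entries-factorial b n)))

    entries-τ : ∀ a k → entries (τ -[1+ 0 ] a) (ℤ.suc k) ≈ₛ
                        (entries a (ℤ.suc k) +ₛ ι (a k) ⊛ entries a k) S.- ι (a (+ 0)) ⊛ entries a k
    entries-τ a -[1+ suc k ] = S.solve 2 (λ x y → S.con (+ 0) S.:= (S.con (+ 0) S.:+ x S.:* S.con (+ 0)) S.:- y S.:* S.con (+ 0)) S.refl _ _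
    entries-τ a -[1+ zero ]  = S.solve 2 (λ x y → S.con (+ 1) S.:= (S.con (+ 1) S.:+ x S.:* S.con (+ 0)) S.:- y S.:* S.con (+ 0)) S.refl _ _
    entries-τ a (+ zero)     = S.trans (S.trans (entries-factorial (τ -[1+ 0 ] a) 0) (S.sym (entries-factorial a 0)))
      (S.solve 2 (λ x y → x S.:= (x S.:+ y) S.:- y) S.refl _ _)
    entries-τ a (+ suc p)    = S.trans (entries-factorial (τ -[1+ 0 ] a) (suc p)) (S.trans
      (S.factorial-first (scalars (τ -[1+ 0 ] a)) p χ) (S.trans
      (S.solve 4 (λ x y z w → x S.:- y S.:* z S.:= ((x S.:- w S.:* z) S.:+ w S.:* z) S.:- y S.:* z) S.refl _ _ _ (ι (a (+ suc p))))
      (S.sym (S.+-cong (S.+-cong (entries-factorial a (suc p)) (S.*-congˡ {ι (a (+ suc p))} (entries-factorial a p)))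
                       (S.-‿cong (S.*-congˡ {ι (a (+ 0))} (entries-factorial a p)))))))

  jacobiTrudi-entries : ∀ a q n → jacobiTrudi (ι ∘ a) (entries a) q n ≈ₛ entries (τ (ℤ.- (+ q)) a) (n ℤ.+ + q)
  jacobiTrudi-entries a zero n = S.trans
    (entries-cong (λ i → ≡.cong a (≡.sym (ℤₚ.+-identityʳ i))) n)
    (S.reflexive (≡.cong (entries (τ (+ 0) a)) (≡.sym (ℤₚ.+-identityʳ n))))
  jacobiTrudi-entries a (suc q) n = S.trans
    (S.+-cong (S.+-cong (S.trans (jacobiTrudi-entries a q (ℤ.suc n)) (S.reflexive (≡.cong (entries a′) (ℤₚ.+-assoc (+ 1) n (+ q)))))
                        (S.*-cong (ι-cong (reflexive (≡.cong a (≡.sym n+q-q)))) (jacobiTrudi-entries a q n)))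
              (S.-‿cong (S.*-cong (ι-cong (reflexive (≡.cong a (≡.sym (ℤₚ.+-identityˡ _))))) (jacobiTrudi-entries a q n))))
    (S.trans (S.sym (entries-τ a′ (n ℤ.+ + q))) (S.trans
      (entries-cong (λ i → ≡.cong a (≡.trans (ℤₚ.+-assoc i -[1+ 0 ] (ℤ.- (+ q)))
          (≡.cong (λ j → i ℤ.+ j) (≡.sym (ℤₚ.neg-distrib-+ (+ 1) (+ q)))))) (ℤ.suc (n ℤ.+ + q)))
      (S.reflexive (≡.cong (entries (τ (ℤ.- (+ suc q)) a)) suc-n+q))))
    where
    a′ = τ (ℤ.- (+ q)) a
    n+q-q : (n ℤ.+ + q) ℤ.+ ℤ.- (+ q) ≡ n
    n+q-q = ≡.trans (ℤₚ.+-assoc n (+ q) _) (≡.trans (≡.cong (λ j → n ℤ.+ j) (ℤₚ.+-inverseʳ (+ q))) (ℤₚ.+-identityʳ n))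
    suc-n+q : ℤ.suc (n ℤ.+ + q) ≡ n ℤ.+ + suc q
    suc-n+q = ≡.trans (≡.sym (ℤₚ.+-assoc (+ 1) n (+ q))) (≡.trans
      (≡.cong (λ m → m ℤ.+ + q) (ℤₚ.+-comm (+ 1) n)) (ℤₚ.+-assoc n (+ 1) (+ q)))

  det-cong : ∀ {n} {M N : Fin n → Fin n → Series} → (∀ i j → M i j ≈ₛ N i j) → det S.rawRing M ≈ₛ det S.rawRing N
  det-cong {n} {M} {N} p = S.trans (S.det≈Δ M n id id) (S.trans (S.Δ-cong p (tabulate id) (tabulate id)) (S.sym (S.det≈Δ N n id id)))

  s-jacobiTrudi : ∀ μ a → coeff (s μ a) ≈ₛ S.Δ (jacobiTrudi (ι ∘ a) (entries a)) (upTo ℓ[ μ ]) (contents 0 (parts μ))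
  s-jacobiTrudi μ a = S.trans
    (det-homo Λ-rawRing seriesRing coeff-isHomomorphic {ℓ[ μ ]} λ i j →
      hₐ (content (toℕ i) ℤ.+ + toℕ j) (τ (ℤ.- (+ toℕ j)) a))
    (S.trans (det-cong {ℓ[ μ ]} λ i j → S.sym (jacobiTrudi-entries a (toℕ j) (content (toℕ i))))
    (S.trans (S.det-columns (jacobiTrudi (ι ∘ a) (entries a)) ℓ[ μ ] (content ∘ toℕ))
    (S.reflexive (≡.cong (S.Δ (jacobiTrudi (ι ∘ a) (entries a)) (upTo ℓ[ μ ])) (tabulate-contents 0 (parts μ))))))
    where
    content : ℕ → ℤ
    content i = + row μ i ℤ.- + i

  frobeniusSchur : Sequence → List ℕ → List ℕ → Series
  frobeniusSchur a = S.Δ (hookFunction (scalars a) (scalars (dual a)))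

  s-frobenius : ∀ μ a {ps qs} → Frobenius (parts μ) ps qs → coeff (s μ a) ≈ₛ frobeniusSchur a ps qs
  s-frobenius μ a {ps} {qs} F with Frobenius-contents F
  ... | us , m , rows = S.trans (s-jacobiTrudi μ a) (S.trans
    (S.reflexive (≡.cong (S.Δ (jacobiTrudi (ι ∘ a) (entries a)) (upTo ℓ[ μ ])) rows)) (S.trans
    (giambelliFormula (ι ∘ a) (entries a) S.refl (λ _ → S.refl) (entries-factorial a) m (Frobenius-length F))
    (S.Δ-cong (λ p q → S.factorial-cong {scalars a} (λ _ → S.refl)
      (λ k → S.factorial-cong {χ = hookSchur k} dual-scalars (λ _ → S.refl) q) p) ps qs)))
    where
    dual-scalars : ∀ i → -ₛ ι (a (ℤ.- (+ i))) ≈ₛ ι (dual a (+ suc i))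
    dual-scalars i = S.trans (S.sym (IsHomomorphic.-‿homo ι-isHomomorphic (a (ℤ.- (+ i)))))
      (ι-cong (-‿cong (reflexive (≡.cong a (≡.sym (≡.trans (ℤₚ.[1+m]⊖[1+n]≡m⊖n 0 i) (≡.trans (≡.sym (ℤₚ.[+m]-[+n]≡m⊖n 0 i)) (ℤₚ.+-identityˡ _))))))))

  ι-isTransition : ∀ {α β C} → K.IsTransition α β C → S.IsTransition (ι ∘ α) (ι ∘ β) (λ p q → ι (C p q))
  ι-isTransition T = record
    { C00 = S.trans (ι-cong T.C00) (1-homo)
    ; Cs0 = λ p → S.trans (ι-cong (T.Cs0 p)) (difference _ _ _)
    ; Css = λ p q → S.trans (ι-cong (T.Css p q)) (S.trans (+-homo _ _) (S.+-congˡ (difference _ _ _)))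
    ; C<  = λ p<q → S.trans (ι-cong (T.C< p<q)) 0-homo
    }
    where
    module T = K.IsTransition T
    open IsHomomorphic ι-isHomomorphic
    difference : ∀ x y z → ι ((x - y) * z) ≈ₛ (ι x S.- ι y) ⊛ ι z
    difference x y z = S.trans (*-homo (x - y) z) (S.*-congʳ {ι z} (S.trans (+-homo x (- y)) (S.+-congˡ (-‿homo y))))

  -- The coefficient of the partition with Frobenius coordinates (κ | ν) in the
  -- expansion of the one with Frobenius coordinates (ps | qs).
  coefficient : Sequence → Sequence → List ℕ → List ℕ → List ℕ → List ℕ → Carrier
  coefficient a b ps qs κ ν = K.Δ (hookCoef a b) ps κ * K.Δ (hookCoef (dual a) (dual b)) qs ν

  frobeniusSchur-expansion : ∀ a b {m ps qs} → All (_< m) ps → All (_< m) qs → frobeniusSchur a ps qs ≈ₛ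
    (S.Σ[ sublists (length ps) (downFrom m) ] λ κ → S.Σ[ sublists (length qs) (downFrom m) ] λ ν →
      coefficient a b ps qs κ ν •ₛ frobeniusSchur b κ ν)
  frobeniusSchur-expansion a b {m} {ps} {qs} ps<m qs<m = S.trans
    (expansion (ι-isTransition (hookCoef-isTransition a b)) (ι-isTransition (hookCoef-isTransition (dual a) (dual b))) ps<m qs<m)
    (S.Σ-cong (sublists (length ps) (downFrom m)) λ κ _ → S.Σ-cong (sublists (length qs) (downFrom m)) λ ν _ → S.trans
      (S.*-congʳ {frobeniusSchur b κ ν} (S.trans
        (S.sym (S.*-cong (Δ-homo K seriesRing ι-isHomomorphic (hookCoef a b) ps κ)
                         (Δ-homo K seriesRing ι-isHomomorphic (hookCoef (dual a) (dual b)) qs ν)))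
        (S.sym (IsHomomorphic.*-homo ι-isHomomorphic _ _))))
      (ι-⊛ _ (frobeniusSchur b κ ν)))

-- Leading coefficients of s_{μ;b}.

infix 4 _<ₗ_
_<ₗ_ : List ℕ → List ℕ → Set
_<ₗ_ = Lex-< _≡_ _<_

private
  suc-minus : ∀ m k → + suc m ℤ.- + suc k ≡ + m ℤ.- + k
  suc-minus m k = ≡.trans (ℤₚ.[+m]-[+n]≡m⊖n (suc m) (suc k))
    (≡.trans (ℤₚ.[1+m]⊖[1+n]≡m⊖n m k) (≡.sym (ℤₚ.[+m]-[+n]≡m⊖n m k)))

  minus-suc : ∀ m k → ℤ.suc (+ m ℤ.- + suc k) ≡ + m ℤ.- + k
  minus-suc m k = ≡.trans (≡.sym (ℤₚ.+-assoc (+ 1) (+ m) (ℤ.- (+ suc k)))) (suc-minus m k)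

  minus-suc-< : ∀ m k → + m ℤ.- + suc k ℤ.< + m ℤ.- + k
  minus-suc-< m k = ℤₚ.+-monoʳ-< (+ m) (ℤₚ.neg-mono-< (ℤ.+<+ (ℕₚ.n<1+n k)))

contents-≤ : ∀ {x xs} k → All (_≤ x) xs → All (ℤ._≤ + x ℤ.- + k) (contents k xs)
contents-≤     k []         = []
contents-≤ {x} k (y≤x ∷ p) = ℤₚ.+-monoˡ-≤ (ℤ.- (+ k)) (ℤ.+≤+ y≤x) ∷
  All.map (λ q → ℤₚ.≤-trans q (ℤₚ.<⇒≤ (minus-suc-< x k))) (contents-≤ (suc k) p)

module LinearIndependence {c ℓ} (K : CommutativeRing c ℓ) where
  open CommutativeRing K hiding (zero)
  open SymmetricFunctions K
  open SeriesRing K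
  open SchurSeries K
  open Giambelli seriesRing χ using (shift; jacobiTrudi)
  open import Algebra.Properties.CommutativeMonoid.Sum +-commutativeMonoid using (sum-cong-≋; sum-replicate-zero)
  open import Algebra.Definitions.RawMonoid +-rawMonoid using (sum)
  open import Algebra.Properties.Ring ring

  private
    module SR = SetoidReasoning S.setoid
    module KS = IntegerSolver K

  -- A series in x_2, x_3, … regarded as a series in x_1, x_2, ….
  lift : Series → Series
  lift f []          = f []
  lift f (zero ∷ α)  = f α
  lift f (suc _ ∷ α) = 0#

  x₁ : Series
  x₁ []                = 0#
  x₁ (zero ∷ α)        = 0#
  x₁ (suc zero ∷ α)    = 1ₛ α
  x₁ (suc (suc _) ∷ α) = 0#

  private
    sum-zero : ∀ {n} {t : Fin n → Carrier} → (∀ i → t i ≈ 0#) → sum t ≈ 0#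
    sum-zero {n} p = trans (sum-cong-≋ p) (sum-replicate-zero n)

  lift-⊛ : ∀ f g n α → (lift f ⊛ g) (n ∷ α) ≈ (f ⊛ (λ β → g (n ∷ β))) α
  lift-⊛ f g n α = trans (+-congˡ (sum-zero {n} λ i → ⊛-zeroˡ (λ β → g (n ∸ suc (toℕ i) ∷ β)) α)) (+-identityʳ _)

  lift-isHomomorphic : IsHomomorphic S.rawRing seriesRing lift
  lift-isHomomorphic = record { +-homo = +-homo ; *-homo = *-homo ; -‿homo = -‿homo ; 0-homo = 0-homo ; 1-homo = 1-homo }
    where
    +-homo : ∀ f g → lift (f +ₛ g) ≈ₛ lift f +ₛ lift g
    +-homo f g []          = refl
    +-homo f g (zero ∷ α)  = refl
    +-homo f g (suc _ ∷ α) = sym (+-identityʳ 0#)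
    *-homo : ∀ f g → lift (f ⊛ g) ≈ₛ lift f ⊛ lift g
    *-homo f g []          = refl
    *-homo f g (zero ∷ α)  = sym (lift-⊛ f (lift g) 0 α)
    *-homo f g (suc n ∷ α) = sym (trans (lift-⊛ f (lift g) (suc n) α) (S.zeroʳ f α))
    -‿homo : ∀ f → lift (-ₛ f) ≈ₛ -ₛ lift f
    -‿homo f []          = refl
    -‿homo f (zero ∷ α)  = refl
    -‿homo f (suc _ ∷ α) = sym -0#≈0#
    0-homo : lift 0ₛ ≈ₛ 0ₛ
    0-homo []          = refl
    0-homo (zero ∷ α)  = refl
    0-homo (suc _ ∷ α) = refl
    1-homo : lift 1ₛ ≈ₛ 1ₛ
    1-homo []          = refl
    1-homo (zero ∷ α)  = refl
    1-homo (suc _ ∷ α) = refl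

  open IsHomomorphic lift-isHomomorphic using () renaming
    (+-homo to lift-+; *-homo to lift-*; -‿homo to lift-neg)

  lift-ι : ∀ x → lift (ι x) ≈ₛ ι x
  lift-ι x []          = refl
  lift-ι x (zero ∷ α)  = refl
  lift-ι x (suc _ ∷ α) = sym (zeroʳ x)

  x₁-⊛-zero : ∀ f α → (x₁ ⊛ f) (0 ∷ α) ≈ 0#
  x₁-⊛-zero f α = trans (+-identityʳ _) (⊛-zeroˡ (λ β → f (0 ∷ β)) α)

  x₁-⊛-suc : ∀ f n α → (x₁ ⊛ f) (suc n ∷ α) ≈ f (n ∷ α)
  x₁-⊛-suc f n α = trans
    (+-cong (⊛-zeroˡ (λ β → f (suc n ∷ β)) α)
            (+-cong (⊛-identityˡ (λ β → f (n ∷ β)) α) (sum-zero {n} λ i → ⊛-zeroˡ (λ β → f (n ∸ suc (toℕ i) ∷ β)) α)))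
    (trans (+-identityˡ _) (+-identityʳ _))

  module _ (a : Sequence) where
    private
      u : (ℤ → Series) → ℤ → Series
      u = shift (ι ∘ a)

    -- If f n is the residue of H(u) P(u), then u f n is that of H(u) u P(u), and
    -- the factor of H(u) contributed by x_1 is u/(u - x_1).
    Branching : (ℤ → Series) → Set ℓ
    Branching f = ∀ n → u f n ≈ₛ x₁ ⊛ f n +ₛ lift (u f n)

    Branching-u : ∀ {f} → Branching f → Branching (u f)
    Branching-u {f} B n = SR.begin
      u f (ℤ.suc n) +ₛ ι (a n) ⊛ u f n
        SR.≈⟨ S.+-cong (B (ℤ.suc n)) (S.*-congˡ {ι (a n)} (B n)) ⟩
      (x₁ ⊛ f (ℤ.suc n) +ₛ lift (u f (ℤ.suc n))) +ₛ ι (a n) ⊛ (x₁ ⊛ f n +ₛ lift (u f n))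
        SR.≈⟨ S.solve 6 (λ x f f′ L a L′ → (x S.:* f S.:+ L) S.:+ a S.:* (x S.:* f′ S.:+ L′)
                                        S.:= x S.:* (f S.:+ a S.:* f′) S.:+ (L S.:+ a S.:* L′)) S.refl x₁ _ (f n) _ (ι (a n)) _ ⟩
      x₁ ⊛ u f n +ₛ (lift (u f (ℤ.suc n)) +ₛ ι (a n) ⊛ lift (u f n))
        SR.≈⟨ S.+-congˡ {x₁ ⊛ u f n} (S.trans (lift-+ (u f (ℤ.suc n)) (ι (a n) ⊛ u f n)) (S.+-congˡ {lift (u f (ℤ.suc n))}
                 (S.trans (lift-* (ι (a n)) (u f n)) (S.*-congʳ {lift (u f n)} (lift-ι (a n)))))) ⟨
      x₁ ⊛ u f n +ₛ lift (u (u f) n) SR.∎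

    Branching-step : ∀ {f g} x → (∀ n → g n ≈ₛ u f n S.- ι x ⊛ f n) → Branching f → Branching g
    Branching-step {f} {g} x g≈ B n = SR.begin
      g (ℤ.suc n) +ₛ ι (a n) ⊛ g n
        SR.≈⟨ ug ⟩
      u (u f) n S.- ι x ⊛ u f n
        SR.≈⟨ S.+-cong (Branching-u B n) (S.-‿cong (S.*-congˡ {ι x} (B n))) ⟩
      (x₁ ⊛ u f n +ₛ lift (u (u f) n)) S.- ι x ⊛ (x₁ ⊛ f n +ₛ lift (u f n))
        SR.≈⟨ S.solve 6 (λ x f L c f′ L′ → (x S.:* f S.:+ L) S.:- c S.:* (x S.:* f′ S.:+ L′)
                                       S.:= x S.:* (f S.:- c S.:* f′) S.:+ (L S.:- c S.:* L′)) S.refl x₁ _ _ (ι x) (f n) _ ⟩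
      x₁ ⊛ (u f n S.- ι x ⊛ f n) +ₛ (lift (u (u f) n) S.- ι x ⊛ lift (u f n))
        SR.≈⟨ S.+-cong (S.*-congˡ {x₁} (g≈ n)) (S.trans (lift-cong ug) (S.trans (lift-+ (u (u f) n) (-ₛ (ι x ⊛ u f n)))
                (S.+-congˡ {lift (u (u f) n)} (S.trans (lift-neg (ι x ⊛ u f n)) (S.-‿cong (S.trans (lift-* (ι x) (u f n)) (S.*-congʳ {lift (u f n)} (lift-ι x)))))))) ⟨
      x₁ ⊛ g n +ₛ lift (u g n) SR.∎
      where
      lift-cong : ∀ {f g} → f ≈ₛ g → lift f ≈ₛ lift g
      lift-cong p []          = p []
      lift-cong p (zero ∷ α)  = p α
      lift-cong p (suc _ ∷ α) = refl
      ug : u g n ≈ₛ u (u f) n S.- ι x ⊛ u f n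
      ug = S.trans (S.+-cong (g≈ (ℤ.suc n)) (S.*-congˡ {ι (a n)} (g≈ n)))
        (S.solve 6 (λ p x f a q g → (p S.:- x S.:* f) S.:+ a S.:* (q S.:- x S.:* g) S.:= (p S.:+ a S.:* q) S.:- x S.:* (f S.:+ a S.:* g)) S.refl _ (ι x) (f (ℤ.suc n)) (ι (a n)) _ (f n))

    -- Columns of Jacobi-Trudi type: each is u - c_q times the one before. The class is closed under
    -- dropping the first column and under multiplying all columns by u, which is what the removal
    -- of a variable does to the matrix.
    record IsColumns (c : ℕ → Carrier) (f : ℕ → ℤ → Series) : Set ℓ where
      field
        step      : ∀ q n → f (suc q) n ≈ₛ u (f q) n S.- ι (c q) ⊛ f q n
        branching : Branching (f 0)

    IsColumns-tail : ∀ {c f} → IsColumns c f → IsColumns (c ∘ suc) (f ∘ suc)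
    IsColumns-tail {c} C = record { step = C.step ∘ suc ; branching = Branching-step (c 0) (C.step 0) C.branching }
      where module C = IsColumns C

    IsColumns-u : ∀ {c f} → IsColumns c f → IsColumns c (u ∘ f)
    IsColumns-u {c} {f} C = record
      { step = λ q n → S.trans (S.+-cong (C.step q (ℤ.suc n)) (S.*-congˡ {ι (a n)} (C.step q n)))
          (S.solve 6 (λ p x f a q g → (p S.:- x S.:* f) S.:+ a S.:* (q S.:- x S.:* g) S.:= (p S.:+ a S.:* q) S.:- x S.:* (f S.:+ a S.:* g))
            S.refl _ (ι (c q)) (f q (ℤ.suc n)) (ι (a n)) _ (f q n))
      ; branching = Branching-u C.branching }
      where module C = IsColumns C

    private
      Δ-upTo-suc : ∀ (f : ℕ → ℤ → Series) N ns → S.Δ f (upTo (suc N)) ns ≈ₛ (f 0 S.⌟ S.Δ (f ∘ suc) (upTo N)) ns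
      Δ-upTo-suc f N = S.⌟-congʳ λ ns → S.trans
        (S.reflexive (≡.cong (λ l → S.Δ f l ns) (≡.sym (Listₚ.map-upTo suc N)))) (S.Δ-map f suc (upTo N) ns)

    branch : (ℕ → ℤ → Series) → ℕ → ℤ → Series
    branch f q n = lift (u (f q) n)

    -- By branching, f_{q+1} = (u - c_q) f_q equals (x_1 - c_q) f_q plus a series without x_1. The
    -- multiple of the preceding column drops out of the determinant.
    Δ-branch : ∀ N {c f} → IsColumns c f → ∀ ns →
      (f 0 S.⌟ S.Δ (f ∘ suc) (upTo N)) ns ≈ₛ (f 0 S.⌟ S.Δ (branch f) (upTo N)) ns
    Δ-branch zero    C ns = S.refl
    Δ-branch (suc N) {c} {f} C ns = SR.begin
      (f 0 S.⌟ S.Δ (f ∘ suc) (upTo (suc N))) ns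
        SR.≈⟨ S.⌟-congʳ {f = f 0} (λ ns → S.trans (Δ-upTo-suc (f ∘ suc) N ns) (Δ-branch N (IsColumns-tail C) ns)) ns ⟩
      (f 0 S.⌟ f 1 S.⌟ D) ns
        SR.≈⟨ S.⌟-congʳ {f = f 0} (λ ns → S.trans (S.⌟-congˡ {Φ = D} f1 ns) (S.⌟-linearˡ x (f 0) (branch f 0) D ns)) ns ⟩
      (f 0 S.⌟ (λ ns → x ⊛ (f 0 S.⌟ D) ns +ₛ (branch f 0 S.⌟ D) ns)) ns
        SR.≈⟨ S.⌟-linearʳ x (f 0) (f 0 S.⌟ D) (branch f 0 S.⌟ D) ns ⟩
      x ⊛ (f 0 S.⌟ f 0 S.⌟ D) ns +ₛ (f 0 S.⌟ branch f 0 S.⌟ D) ns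
        SR.≈⟨ S.+-congʳ (S.trans (S.*-congˡ {x} (S.⌟-square (f 0) D ns)) (S.zeroʳ x)) ⟩
      0ₛ +ₛ (f 0 S.⌟ branch f 0 S.⌟ D) ns
        SR.≈⟨ S.+-identityˡ _ ⟩
      (f 0 S.⌟ branch f 0 S.⌟ D) ns
        SR.≈⟨ S.⌟-congʳ {f = f 0} (Δ-upTo-suc (branch f) N) ns ⟨
      (f 0 S.⌟ S.Δ (branch f) (upTo (suc N))) ns SR.∎
      where
      open IsColumns C
      D = S.Δ (branch (f ∘ suc)) (upTo N)
      x = x₁ S.- ι (c 0)
      f1 : ∀ n → f 1 n ≈ₛ x ⊛ f 0 n +ₛ branch f 0 n
      f1 n = S.trans (step 0 n) (S.trans (S.+-congʳ (branching n))
        (S.solve 4 (λ x f L c → (x S.:* f S.:+ L) S.:- c S.:* f S.:= (x S.:- c) S.:* f S.:+ L) S.refl x₁ (f 0 n) _ (ι (c 0))))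

    slice : ℕ → (ℤ → Series) → ℤ → Series
    slice l f n β = f n (l ∷ β)

    ⌟-slice : ∀ f (Φ : List ℤ → Series) l ns α → ((f S.⌟ (lift ∘ Φ)) ns) (l ∷ α) ≈ (slice l f S.⌟ Φ) ns α
    ⌟-slice f Φ l []       α = refl
    ⌟-slice f Φ l (n ∷ ns) α = +-cong
      (trans (⊛-comm (f n) (lift (Φ ns)) (l ∷ α)) (trans (lift-⊛ (Φ ns) (f n) l α) (⊛-comm (Φ ns) (slice l f n) α)))
      (-‿cong (⌟-slice f (Φ ∘ (n ∷_)) l ns α))

    -- After `Δ-branch` all columns but the first are lifts, so the whole power of x_1 comes from
    -- the first column. The complementary minors use the columns `u ∘ f`, again of the same type,
    -- in one variable fewer.
    Δ-slice : ∀ N {c f} → IsColumns c f → ∀ ns l α →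
      S.Δ f (upTo (suc N)) ns (l ∷ α) ≈ (slice l (f 0) S.⌟ S.Δ (u ∘ f) (upTo N)) ns α
    Δ-slice N {c} {f} C ns l α = trans
      (S.trans (Δ-upTo-suc f N ns) (S.trans (Δ-branch N C ns)
        (S.⌟-congʳ {f = f 0} (λ ns → S.sym (Δ-homo seriesRing seriesRing lift-isHomomorphic (u ∘ f) (upTo N) ns)) ns)) (l ∷ α))
      (⌟-slice (f 0) (S.Δ (u ∘ f) (upTo N)) l ns α)

    -- Applying u^k to the zeroth column gives at n a polynomial in the h_i whose top term is
    -- h_{n+k}. So x_1 has exponent at most n+k there, and x_1^{n+k} has coefficient 1.
    record Leading (k : ℕ) (f : ℤ → Series) : Set ℓ where
      field
        vanish : ∀ {n} l → n ℤ.< + l ℤ.- + k → slice l f n ≈ₛ 0ₛ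
        lead   : ∀ l → slice l f (+ l ℤ.- + k) ≈ₛ 1ₛ

    Leading-u : ∀ {k f} → Leading k f → Leading (suc k) (u f)
    Leading-u {k} {f} L = record
      { vanish = λ {n} l n< β → trans
          (+-cong (L.vanish l (≡.subst (ℤ.suc n ℤ.<_) (minus-suc l k) (ℤₚ.+-monoʳ-< (+ 1) n<)) β)
                  (trans (ι-⊛ (a n) (f n) (l ∷ β)) (*-congˡ (L.vanish l (ℤₚ.<-trans n< (minus-suc-< l k)) β))))
          (trans (+-identityˡ _) (zeroʳ _))
      ; lead = λ l β → trans
          (+-cong (trans (reflexive (≡.cong (λ n → f n (l ∷ β)) (minus-suc l k))) (L.lead l β))
                  (trans (ι-⊛ _ (f (+ l ℤ.- + suc k)) (l ∷ β)) (*-congˡ (L.vanish l (minus-suc-< l k) β))))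
          (trans (+-congˡ (zeroʳ _)) (+-identityʳ _)) }
      where module L = Leading L

    private
      later-rows : ∀ {x xs} k → All (_≤ x) xs → All (ℤ._< + x ℤ.- + k) (contents (suc k) xs)
      later-rows {x} k p = All.map (λ q → ℤₚ.≤-<-trans q (minus-suc-< x k)) (contents-≤ (suc k) p)

      -- At the exponent x of x_1 the first column is a unit vector: its entry in the first row is
      -- 1, and the later rows have contents below x - k.
      Δ-first : ∀ {k c f} x {xs} → IsColumns c f → Leading k (f 0) → All (_≤ x) xs → ∀ α →
        S.Δ f (upTo (suc (length xs))) (contents k (x ∷ xs)) (x ∷ α) ≈
        S.Δ (u ∘ f) (upTo (length xs)) (contents (suc k) xs) α
      Δ-first {k} {f = f} x {xs} C L x≥ α = trans (Δ-slice (length xs) C (contents k (x ∷ xs)) x α) (trans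
        (S.+-cong (S.*-congʳ {Φ (contents (suc k) xs)} (Leading.lead L x))
                  (S.-‿cong (S.⌟-zeroˡ {Φ = Φ ∘ ((+ x ℤ.- + k) ∷_)} (All.map (Leading.vanish L x) (later-rows k x≥)))) α)
        (trans (+-congˡ -0#≈0#) (trans (+-identityʳ _) (⊛-identityˡ _ α))))
        where Φ = S.Δ (u ∘ f) (upTo (length xs))

    Δ-leading : ∀ {k c f} xs → IsColumns c f → Leading k (f 0) → AllPairs _≥_ xs →
                S.Δ f (upTo (length xs)) (contents k xs) xs ≈ 1#
    Δ-leading []       C L _        = refl
    Δ-leading (x ∷ xs) C L (x≥ ∷ s) = trans (Δ-first x C L x≥ xs) (Δ-leading xs (IsColumns-u C) (Leading-u L) s)

    Δ-beyond : ∀ {k c f xs ys} → IsColumns c f → Leading k (f 0) → AllPairs _≥_ xs → All (0 <_) ys →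
               xs <ₗ ys → S.Δ f (upTo (length xs)) (contents k xs) ys ≈ 0#
    Δ-beyond C L _ _ (base ())
    -- The empty determinant is the series 1, whose coefficient vanishes because the first exponent
    -- is positive.
    Δ-beyond C L _ (s≤s _ ∷ _) halt = refl
    Δ-beyond {k} {f = f} {x ∷ xs} {y ∷ ys} C L (x≥ ∷ _) _ (this x<y) = trans
      (Δ-slice (length xs) C (contents k (x ∷ xs)) y ys)
      (S.⌟-zeroˡ {Φ = S.Δ (u ∘ f) (upTo (length xs))}
        (All.map (λ n≤ → Leading.vanish L y (ℤₚ.≤-<-trans n≤ (ℤₚ.+-monoˡ-< (ℤ.- (+ k)) (ℤ.+<+ x<y)))) (contents-≤ k (ℕₚ.≤-refl ∷ x≥))) ys)
    Δ-beyond {xs = x ∷ xs} {ys = _ ∷ ys} C L (x≥ ∷ s) (_ ∷ pos) (next ≡.refl xs<ys) =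
      trans (Δ-first x C L x≥ ys) (Δ-beyond (IsColumns-u C) (Leading-u L) s pos xs<ys)

    private
      h-shift : ∀ i r α → coeff (h (suc i)) (suc r ∷ α) ≡ coeff (h i) (r ∷ α)
      h-shift i r α = ≡.cong (λ b → if b then 1# else 0#)
        (≡.trans (isYes≗does (suc (r ℕ.+ sumℕ α) ≟ suc i)) (≡.sym (isYes≗does (r ℕ.+ sumℕ α ≟ i))))

      entries-stable : ∀ n α → entries a n (0 ∷ α) ≈ entries a n α
      entries-stable n = stable (hₐ n a)

      factorial-at : ∀ p α → entries a (+ suc p) α ≈ K.factorial (λ i → a (+ suc i)) p (λ i → χ i α)
      factorial-at p α = trans (entries-factorial a p α) (factorial-coefficient (λ i → a (+ suc i)) p χ α)

      -- The coefficient of h_{i+1} at exponent r+1 of x_1 is that of h_i at exponent r, so raising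
      -- every index by one, as u does, is undone by lowering the exponent of x_1.
      entries-branching : ∀ n r α → u (entries a) n (suc r ∷ α) ≈ entries a n (r ∷ α)
      entries-branching -[1+ suc n ] r α = trans (+-identityˡ _) (trans (ι-⊛ _ 0ₛ (suc r ∷ α)) (zeroʳ _))
      entries-branching -[1+ zero ]  r α = trans (+-identityˡ _) (trans (ι-⊛ _ 0ₛ (suc r ∷ α)) (zeroʳ _))
      entries-branching (+ zero)     r α = trans
        (+-cong (factorial-at 0 (suc r ∷ α)) (trans (ι-⊛ _ 1ₛ (suc r ∷ α)) (zeroʳ _))) (trans (+-identityʳ _) (reflexive (h-shift 0 r α)))
      entries-branching (+ suc p)    r α = trans
        (+-cong (factorial-at (suc p) (suc r ∷ α)) (trans (ι-⊛ _ (entries a (+ suc p)) (suc r ∷ α)) (*-congˡ (factorial-at p (suc r ∷ α)))))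
        (trans (KS.solve 2 (λ x y → (x KS.:- y) KS.:+ y KS.:= x) refl _ _)
          (trans (K.factorial-cong {λ i → a (+ suc i)} (λ _ → refl) (λ i → reflexive (h-shift (suc i) r α)) p) (sym (factorial-at p (r ∷ α)))))

    jacobiTrudi-isColumns : IsColumns (λ q → a (ℤ.- (+ q))) (jacobiTrudi (ι ∘ a) (entries a))
    jacobiTrudi-isColumns = record { step = λ q n → S.refl ; branching = branching }
      where
      branching : Branching (entries a)
      branching n []          = sym (trans (+-congʳ (zeroˡ _)) (+-identityˡ _))
      branching n (zero ∷ α)  = trans
        (+-cong (entries-stable (ℤ.suc n) α) (trans (ι-⊛ _ (entries a n) (0 ∷ α)) (trans (*-congˡ (entries-stable n α)) (sym (ι-⊛ _ (entries a n) α)))))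
        (sym (trans (+-congʳ (x₁-⊛-zero (entries a n) α)) (+-identityˡ _)))
      branching n (suc r ∷ α) = trans (entries-branching n r α) (sym (trans (+-congʳ (x₁-⊛-suc (entries a n) r α)) (+-identityʳ _)))

    private
      factorial-top : ∀ α p φ → (∀ i → i < p → φ i ≈ 0#) → K.factorial α p φ ≈ φ p
      factorial-top α zero    φ z = refl
      factorial-top α (suc p) φ z = trans
        (+-cong (factorial-top α p (φ ∘ suc) λ i i<p → z (suc i) (s≤s i<p))
                (-‿cong (*-congˡ (trans (factorial-top α p φ λ i i<p → z i (ℕₚ.m<n⇒m<1+n i<p)) (z p ℕₚ.≤-refl)))))
        (KS.solve 2 (λ x a → x KS.:- a KS.:* KS.con (+ 0) KS.:= x) refl _ _)

      h-below : ∀ {i l} → i < l → ∀ β → coeff (h i) (l ∷ β) ≈ 0#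
      h-below {i} {l} i<l β = bounded (h i) (l ∷ β) (ℕₚ.<-≤-trans i<l (ℕₚ.m≤m+n l _))

      h-top : ∀ l β → coeff (h l) (l ∷ β) ≡ 1ₛ β
      h-top zero    β = ≡.refl
      h-top (suc l) β = ≡.trans (h-shift l l β) (h-top l β)

      entries-below : ∀ {n} l → n ℤ.< + l → ∀ β → entries a n (l ∷ β) ≈ 0#
      entries-below { -[1+ n ]} l _                β = refl
      entries-below {+ zero}    zero    (ℤ.+<+ ()) β
      entries-below {+ zero}    (suc l) _          β = refl
      entries-below {+ suc p}   l (ℤ.+<+ p<l)      β = trans (factorial-at p (l ∷ β))
        (trans (factorial-top _ p _ λ i i<p → h-below (ℕₚ.<-trans (s≤s i<p) p<l) β) (h-below p<l β))

      entries-top : ∀ l β → entries a (+ l) (l ∷ β) ≈ 1ₛ β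
      entries-top zero    β = refl
      entries-top (suc p) β = trans (factorial-at p (suc p ∷ β))
        (trans (factorial-top _ p _ λ i i<p → h-below (s≤s i<p) β) (reflexive (h-top (suc p) β)))

    entries-leading : Leading 0 (entries a)
    entries-leading = record
      { vanish = λ {n} l n< → entries-below l (≡.subst (n ℤ.<_) (ℤₚ.+-identityʳ (+ l)) n<)
      ; lead   = λ l β → trans (reflexive (≡.cong (λ n → entries a n (l ∷ β)) (ℤₚ.+-identityʳ (+ l)))) (entries-top l β) }

  s-leading : ∀ μ a → coeff (s μ a) (parts μ) ≈ 1#
  s-leading μ a = trans (s-jacobiTrudi μ a (parts μ))
    (Δ-leading a (parts μ) (jacobiTrudi-isColumns a) (entries-leading a) (Linkedₚ.Linked⇒AllPairs (λ p q → ℕₚ.≤-trans q p) (sorted μ)))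

  s-beyond : ∀ μ ν a → parts μ <ₗ parts ν → coeff (s μ a) (parts ν) ≈ 0#
  s-beyond μ ν a μ<ν = trans (s-jacobiTrudi μ a (parts ν))
    (Δ-beyond a (jacobiTrudi-isColumns a) (entries-leading a) (Linkedₚ.Linked⇒AllPairs (λ p q → ℕₚ.≤-trans q p) (sorted μ)) (positive ν) μ<ν)

-- Finite sums indexed by partitions.

_≟ₚ_ : DecidableEquality Partition
μ ≟ₚ ν = map′ Partition-≡ (≡.cong parts) (Listₚ.≡-dec _≟_ (parts μ) (parts ν))

open DecMembership _≟ₚ_ using (_∈?_)

maximal : ∀ μ μs → ∃ λ m → m ∈ μ ∷ μs × All (λ κ → κ ≡ m ⊎ parts κ <ₗ parts m) (μ ∷ μs)
maximal μ []       = μ , here ≡.refl , inj₁ ≡.refl ∷ []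
maximal μ (ν ∷ μs) with maximal ν μs
... | m , m∈ , below with <-compare ≡.sym ℕₚ.<-cmp (parts μ) (parts m)
...   | tri< μ<m _ _ = m , there m∈ , inj₂ μ<m ∷ below
...   | tri≈ _ μ≈m _ = m , there m∈ , inj₁ (Partition-≡ (Pointwise-≡⇒≡ μ≈m)) ∷ below
...   | tri> _ _ m<μ = μ , here ≡.refl , inj₁ ≡.refl ∷ All.map lower below
  where
  lower : ∀ {κ} → κ ≡ m ⊎ parts κ <ₗ parts m → κ ≡ μ ⊎ parts κ <ₗ parts μ
  lower (inj₁ ≡.refl) = inj₂ m<μ
  lower (inj₂ κ<m)    = inj₂ (<-transitive ≡.isEquivalence (≡.resp₂ _<_) ℕₚ.<-trans κ<m m<μ)

Unique-map : ∀ {a b} {A : Set a} {B : Set b} (f : A → B) (g : B → A) {xs} →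
             (∀ {x} → x ∈ xs → g (f x) ≡ x) → Unique xs → Unique (map f xs)
Unique-map f g r []         = []
Unique-map f g r (x≢ ∷ u) =
  Allₚ.map⁺ (All.tabulate λ {y} y∈ fx≡fy → All.lookup x≢ y∈ (≡.trans (≡.sym (r (here ≡.refl))) (≡.trans (≡.cong g fx≡fy) (r (there y∈))))) ∷
  Unique-map f g (r ∘ there) u

module Removal {c ℓ} (R : CommutativeRing c ℓ) where
  open CommutativeRing R hiding (zero)
  open ListSum R
  open IntegerSolver R

  module _ {a} {A : Set a} where

    record Remove (x : A) (xs : List A) : Set (a ⊔ c ⊔ ℓ) where
      field
        rest    : List A
        unique  : Unique rest
        shorter : suc (length rest) ≡ length xs
        sound   : ∀ {y} → y ∈ rest → y ∈ xs × y ≢ x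
        total   : ∀ {y} → y ∈ xs → y ≢ x → y ∈ rest
        sum     : ∀ t → Σ[ xs ] t ≈ t x + Σ[ rest ] t

    remove : ∀ {x xs} → x ∈ xs → Unique xs → Remove x xs
    remove {xs = x ∷ xs} (here ≡.refl) (x≢ ∷ u) = record
      { rest = xs ; unique = u ; shorter = ≡.refl
      ; sound = λ y∈ → there y∈ , λ y≡x → All.lookup x≢ y∈ (≡.sym y≡x)
      ; total = λ { (here y≡x) y≢x → contradiction y≡x y≢x ; (there y∈) _ → y∈ }
      ; sum = λ _ → refl }
    remove {x} {w ∷ xs} (there x∈) (w≢ ∷ u) = record
      { rest = w ∷ R.rest ; unique = All.tabulate (λ y∈ → All.lookup w≢ (proj₁ (R.sound y∈))) ∷ R.unique
      ; shorter = ≡.cong suc R.shorter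
      ; sound = λ { (here ≡.refl) → here ≡.refl , All.lookup w≢ x∈
                  ; (there y∈) → there (proj₁ (R.sound y∈)) , proj₂ (R.sound y∈) }
      ; total = λ { (here y≡w) _ → here y≡w ; (there y∈) y≢x → there (R.total y∈ y≢x) }
      ; sum = λ t → trans (+-congˡ (R.sum t)) (solve 3 (λ w x s → w :+ (x :+ s) := x :+ (w :+ s)) refl _ _ _) }
      where module R = Remove (remove x∈ u)

    Σ-support : ∀ xs {ys} → Unique xs → Unique ys → (∀ {x} → x ∈ xs → x ∈ ys) → ∀ t →
                (∀ {y} → y ∈ ys → y ∉ xs → t y ≈ 0#) → Σ[ xs ] t ≈ Σ[ ys ] t
    Σ-support []       {ys} _        v _   t z = sym (Σ-zero ys λ y y∈ → z y∈ λ ())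
    Σ-support (x ∷ xs)      (x≢ ∷ u) v xs⊆ t z = trans
      (+-congˡ (Σ-support xs u R.unique
        (λ y∈ → R.total (xs⊆ (there y∈)) λ y≡x → All.lookup x≢ y∈ (≡.sym y≡x)) t
        (λ y∈ y∉ → z (proj₁ (R.sound y∈)) λ { (here y≡x) → proj₂ (R.sound y∈) y≡x ; (there y∈xs) → y∉ y∈xs })))
      (sym (R.sum t))
      where module R = Remove (remove (xs⊆ (here ≡.refl)) v)

    Σ-cartesianProduct : ∀ {b} {B : Set b} (xs : List A) (ys : List B) t →
      Σ[ cartesianProduct xs ys ] t ≈ Σ[ xs ] (λ x → Σ[ ys ] (λ y → t (x , y)))
    Σ-cartesianProduct []       ys t = refl
    Σ-cartesianProduct (x ∷ xs) ys t = trans (Σ-++ (map (x ,_) ys) _ t)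
      (+-cong (Σ-map (x ,_) ys t) (Σ-cartesianProduct xs ys t))

arms legs : Partition → List ℕ
arms μ = applyUpTo (arm μ) (diag μ)
legs μ = applyUpTo (leg μ) (diag μ)

arms-≡ : ∀ μ {ps qs} → Frobenius (parts μ) ps qs → arms μ ≡ ps
arms-≡ μ F = ≡.trans (≡.cong (applyUpTo (arm μ)) (Frobenius-diag μ F)) (Frobenius-arms μ F)

legs-≡ : ∀ μ {ps qs} → Frobenius (parts μ) ps qs → legs μ ≡ qs
legs-≡ μ F = ≡.trans (≡.cong (applyUpTo (leg μ)) (Frobenius-diag μ F)) (Frobenius-legs μ F)

-- Passes from the lists found by peeling hooks to those computed from `arm` and `leg`, in which the
-- result is stated.
coordinates : ∀ μ → Frobenius (parts μ) (arms μ) (legs μ)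
coordinates μ with frobeniusOf μ
... | _ , _ , F = ≡.subst₂ (Frobenius (parts μ)) (≡.sym (arms-≡ μ F)) (≡.sym (legs-≡ μ F)) F

length-arms : ∀ μ → length (arms μ) ≡ diag μ
length-arms μ = Listₚ.length-applyUpTo (arm μ) (diag μ)

length-legs : ∀ μ → length (legs μ) ≡ diag μ
length-legs μ = Listₚ.length-applyUpTo (leg μ) (diag μ)

partitionOf-coordinates : ∀ μ → partitionOf (arms μ , legs μ) ≡ μ
partitionOf-coordinates μ = Partition-≡ (Frobenius-unique (coordinates μ))

-- Existence and uniqueness of the expansion.

module Expansions {c ℓ} (K : CommutativeRing c ℓ) where
  open CommutativeRing K hiding (zero)
  open SymmetricFunctions K
  open SeriesRing K
  open HookCoefficients K
  open SchurSeries K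
  open LinearIndependence K
  open Removal seriesRing
  private module KS = IntegerSolver K

  combination : (Partition → Carrier) → Sequence → List Partition → Series
  combination d b μs = S.Σ[ μs ] λ ν → d ν •ₛ coeff (s ν b)

  -- Let m be the lexicographically largest partition in the list. At the monomial x^m all the other
  -- terms have coefficient zero, so d m vanishes; then m is removed and the argument repeated on a
  -- shorter list.
  linearlyIndependent : ∀ {b d μs} → Unique μs → combination d b μs ≈ₛ 0ₛ → ∀ {ν} → ν ∈ μs → d ν ≈ 0#
  linearlyIndependent {b} {d} u = go _ u ≡.refl
    where
    go : ∀ n {μs} → Unique μs → length μs ≡ n → combination d b μs ≈ₛ 0ₛ → ∀ {ν} → ν ∈ μs → d ν ≈ 0#
    go (suc n) {μ ∷ μs} u e z {ν} ν∈ with maximal μ μs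
    ... | m , m∈ , below = result
      where
      open Remove (remove m∈ u)
      t : Partition → Series
      t κ = d κ •ₛ coeff (s κ b)
      lower : ∀ κ → κ ∈ rest → coeff (s κ b) (parts m) ≈ 0#
      lower κ κ∈ with All.lookup below (proj₁ (sound κ∈))
      ... | inj₁ κ≡m = contradiction κ≡m (proj₂ (sound κ∈))
      ... | inj₂ κ<m = s-beyond κ m b κ<m
      Σ-lower : ∀ κs → (∀ κ → κ ∈ κs → coeff (s κ b) (parts m) ≈ 0#) → combination d b κs (parts m) ≈ 0#
      Σ-lower []       p = refl
      Σ-lower (κ ∷ κs) p = trans
        (+-cong (trans (*-congˡ (p κ (here ≡.refl))) (zeroʳ _)) (Σ-lower κs λ κ → p κ ∘ there)) (+-identityˡ _)
      dm≈0 : d m ≈ 0#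
      dm≈0 = trans (sym (trans (+-cong (trans (*-congˡ (s-leading m b)) (*-identityʳ _)) (Σ-lower rest lower)) (+-identityʳ _)))
                   (trans (sym (sum t (parts m))) (z (parts m)))
      rest≈0 : combination d b rest ≈ₛ 0ₛ
      rest≈0 α = trans (sym (trans (+-congʳ (trans (*-congʳ dm≈0) (zeroˡ _))) (+-identityˡ _))) (trans (sym (sum t α)) (z α))
      result : d ν ≈ 0#
      result with ν ≟ₚ m
      ... | yes ≡.refl = dm≈0
      ... | no  ν≢m    = go n unique (ℕₚ.suc-injective (≡.trans shorter e)) rest≈0 (total ν∈ ν≢m)

  private
    coeff-foldr : ∀ d b μs → coeff (foldr (λ ν g → d ν • s ν b +Λ g) 0Λ μs) ≈ₛ combination d b μs
    coeff-foldr d b []       = S.refl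
    coeff-foldr d b (μ ∷ μs) = S.+-congˡ {d μ •ₛ coeff (s μ b)} (coeff-foldr d b μs)

  -- The two supports may differ. Both expansions are extended by zero coefficients to the union
  -- without repetitions, and linear independence is applied to their difference.
  Expands-unique : ∀ {f b d d′} → Expands f b d → Expands f b d′ → ∀ ν → d ν ≈ d′ ν
  Expands-unique {f} {b} {d} {d′} E E′ ν = result
    where
    module E = Expands E
    module E′ = Expands E′
    μs : List Partition
    μs = deduplicate _≟ₚ_ (E.support ++ E′.support)
    unique : Unique μs
    unique = deduplicate-! _≟ₚ_ (E.support ++ E′.support)
    extend : ∀ {d} (E : Expands f b d) → (∀ {κ} → κ ∈ Expands.support E → κ ∈ μs) → coeff f ≈ₛ combination d b μs
    extend {d} E ⊆μs = S.trans expands (S.trans (coeff-foldr d b support)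
      (Σ-support support distinct unique ⊆μs _ λ _ κ∉ α → trans (*-congʳ (vanishes _ κ∉)) (zeroˡ _)))
      where open Expands E
    ⊆ˡ : ∀ {κ} → κ ∈ E.support → κ ∈ μs
    ⊆ˡ = ∈ₚ.∈-deduplicate⁺ _≟ₚ_ ∘ ∈ₚ.∈-++⁺ˡ
    ⊆ʳ : ∀ {κ} → κ ∈ E′.support → κ ∈ μs
    ⊆ʳ = ∈ₚ.∈-deduplicate⁺ _≟ₚ_ ∘ ∈ₚ.∈-++⁺ʳ E.support
    difference : ∀ κs → combination (λ κ → d κ - d′ κ) b κs ≈ₛ combination d b κs S.- combination d′ b κs
    difference []       α = sym (-‿inverseʳ 0#)
    difference (κ ∷ κs) α = trans (+-congˡ (difference κs α))
      (KS.solve 5 (λ x y z p q → (x KS.:- y) KS.:* z KS.:+ (p KS.:- q) KS.:= (x KS.:* z KS.:+ p) KS.:- (y KS.:* z KS.:+ q)) refl _ _ _ _ _)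
    zero′ : combination (λ κ → d κ - d′ κ) b μs ≈ₛ 0ₛ
    zero′ α = trans (difference μs α)
      (trans (+-congʳ (trans (sym (extend E ⊆ˡ α)) (extend E′ ⊆ʳ α))) (-‿inverseʳ _))
    result : d ν ≈ d′ ν
    result with ν ∈? μs
    ... | yes ν∈ = trans (KS.solve 2 (λ x y → x KS.:= (x KS.:- y) KS.:+ y) refl _ _)
                     (trans (+-congʳ (linearlyIndependent {b} {λ κ → d κ - d′ κ} unique zero′ ν∈)) (+-identityˡ _))
    ... | no  ν∉ = trans (E.vanishes ν (ν∉ ∘ ⊆ˡ)) (sym (E′.vanishes ν (ν∉ ∘ ⊆ʳ)))

  module _ (a b : Sequence) (μ : Partition) where

    expansionCoefficient : Partition → Carrier
    expansionCoefficient ν =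
      if ⌊ diag ν ≟ diag μ ⌋ then coefficient a b (arms μ) (legs μ) (arms ν) (legs ν) else 0#

    private
      expansionCoefficient-yes : ∀ ν → diag ν ≡ diag μ →
        expansionCoefficient ν ≡ coefficient a b (arms μ) (legs μ) (arms ν) (legs ν)
      expansionCoefficient-yes ν e with diag ν ≟ diag μ
      ... | yes _ = ≡.refl
      ... | no ¬e = contradiction e ¬e

      -- A coordinate of ν that exceeds the corresponding one of μ kills one of the two minors. This
      -- serves both the containment ν ⊆ μ and the finiteness of the support.
      vanishing : ∀ ν → expansionCoefficient ν ≈ 0# ⊎
        (diag ν ≡ diag μ × Pointwise _≤_ (arms ν) (arms μ) × Pointwise _≤_ (legs ν) (legs μ))
      vanishing ν with diag ν ≟ diag μ
      ... | no  _ = inj₁ refl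
      ... | yes e with compare (arms μ) (arms ν) (≡.trans (length-arms μ) (≡.trans (≡.sym e) (≡.sym (length-arms ν))))
                     | compare (legs μ) (legs ν) (≡.trans (length-legs μ) (≡.trans (≡.sym e) (≡.sym (length-legs ν))))
      ...   | inj₁ p≤ | inj₁ q≤ = inj₂ (e , p≤ , q≤)
      ...   | inj₂ p> | _       = inj₁ (trans (*-congʳ (K.Δ-Exceeds (hookCoef a b) (hookCoef-> a b)
                (arms-decreasing (coordinates μ)) (arms-decreasing (coordinates ν)) p>)) (zeroˡ _))
      ...   | inj₁ _  | inj₂ q> = inj₁ (trans (*-congˡ (K.Δ-Exceeds (hookCoef (dual a) (dual b)) (hookCoef-> (dual a) (dual b))
                (legs-decreasing (coordinates μ)) (legs-decreasing (coordinates ν)) q>)) (zeroʳ _))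

    expansionCoefficient-⊆ : ∀ ν → ¬ (ν ⊆ μ × diag ν ≡ diag μ) → expansionCoefficient ν ≈ 0#
    expansionCoefficient-⊆ ν ¬p with vanishing ν
    ... | inj₁ z             = z
    ... | inj₂ (e , p≤ , q≤) = contradiction (Frobenius-⊆ (coordinates μ) (coordinates ν) p≤ q≤ , e) ¬p

    expansionCoefficient-det : ∀ ν d → diag ν ≡ d → diag μ ≡ d → expansionCoefficient ν ≈
      det rawRing {d} (λ i j → hookCoef a b (arm μ (toℕ i)) (arm ν (toℕ j)))
      * det rawRing {d} (λ i j → hookCoef (dual a) (dual b) (leg μ (toℕ i)) (leg ν (toℕ j)))
    expansionCoefficient-det ν d νd μd = trans
      (reflexive (expansionCoefficient-yes ν (≡.trans νd (≡.sym μd))))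
      (sym (*-cong (minor (hookCoef a b) arm) (minor (hookCoef (dual a) (dual b)) leg)))
      where
      minor : ∀ (C : ℕ → ℕ → Carrier) (coord : Partition → ℕ → ℕ) →
        det rawRing {d} (λ i j → C (coord μ (toℕ i)) (coord ν (toℕ j))) ≈
        K.Δ C (applyUpTo (coord μ) (diag μ)) (applyUpTo (coord ν) (diag ν))
      minor C coord = trans (K.det≈Δ C d (coord μ ∘ toℕ) (coord ν ∘ toℕ))
        (reflexive (≡.cong₂ (K.Δ C) (list μ μd) (list ν νd)))
        where
        list : ∀ κ → diag κ ≡ d → tabulate {n = d} (coord κ ∘ toℕ) ≡ applyUpTo (coord κ) (diag κ)
        list κ κd = ≡.trans (tabulate-toℕ (coord κ) d) (≡.cong (applyUpTo (coord κ)) (≡.sym κd))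

    private
      bound : ∃ λ m → All (_< m) (arms μ ++ legs μ)
      bound = upperBound (arms μ ++ legs μ)

      m : ℕ
      m = proj₁ bound

      arms<m : All (_< m) (arms μ)
      arms<m = Allₚ.++⁻ˡ (arms μ) (proj₂ bound)

      legs<m : All (_< m) (legs μ)
      legs<m = Allₚ.++⁻ʳ (arms μ) (proj₂ bound)

      armLists legLists : List (List ℕ)
      armLists = sublists (length (arms μ)) (downFrom m)
      legLists = sublists (length (legs μ)) (downFrom m)

      pairs : List (List ℕ × List ℕ)
      pairs = cartesianProduct armLists legLists

      pair-Frobenius : ∀ {κ ν} → κ ∈ armLists → ν ∈ legLists → Frobenius (parts (partitionOf (κ , ν))) κ ν
      pair-Frobenius κ∈ ν∈ = fromFrobenius-Frobenius
        (≡.trans (sublists-length (length (arms μ)) (downFrom m) κ∈) (≡.trans (≡.trans (length-arms μ) (≡.sym (length-legs μ)))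
          (≡.sym (sublists-length (length (legs μ)) (downFrom m) ν∈))))
        (sublists-AllPairs (length (arms μ)) (downFrom-decreasing m) κ∈)
        (sublists-AllPairs (length (legs μ)) (downFrom-decreasing m) ν∈)

      -- All partitions with as many diagonal boxes as μ and with coordinates below m. Many
      -- coefficients among them vanish; keeping them leaves the index set equal to that of the
      -- Cauchy-Binet sum.
      support : List Partition
      support = map partitionOf pairs

      distinct : Unique support
      distinct = Unique-map partitionOf (λ ν → arms ν , legs ν)
        (λ { {κ , ν} ∈pairs → let F = pair-Frobenius (proj₁ (∈ₚ.∈-cartesianProduct⁻ armLists legLists ∈pairs)) (proj₂ (∈ₚ.∈-cartesianProduct⁻ armLists legLists ∈pairs)) in
             ≡.cong₂ _,_ (arms-≡ (partitionOf (κ , ν)) F) (legs-≡ (partitionOf (κ , ν)) F) })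
        (Uniqueₚ.cartesianProduct⁺ (sublists-unique (length (arms μ)) (Uniqueₚ.downFrom⁺ m)) (sublists-unique (length (legs μ)) (Uniqueₚ.downFrom⁺ m)))

      vanishes : ∀ ν → ν ∉ support → expansionCoefficient ν ≈ 0#
      vanishes ν ν∉ with vanishing ν
      ... | inj₁ z             = z
      ... | inj₂ (e , p≤ , q≤) = contradiction (≡.subst (_∈ support) (partitionOf-coordinates ν)
        (∈ₚ.∈-map⁺ partitionOf (∈ₚ.∈-cartesianProduct⁺
          (member (≡.trans (length-arms ν) (≡.trans e (≡.sym (length-arms μ)))) (arms-decreasing (coordinates ν)) (Pointwise-bounded p≤ arms<m))
          (member (≡.trans (length-legs ν) (≡.trans e (≡.sym (length-legs μ)))) (legs-decreasing (coordinates ν)) (Pointwise-bounded q≤ legs<m))))) ν∉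
        where
        member : ∀ {κ n} → length κ ≡ n → AllPairs _>_ κ → All (_< m) κ → κ ∈ sublists n (downFrom m)
        member ≡.refl = decreasing∈sublists m

      term : ∀ {κ ν} → κ ∈ armLists → ν ∈ legLists →
        coefficient a b (arms μ) (legs μ) κ ν •ₛ frobeniusSchur b κ ν ≈ₛ
        expansionCoefficient (partitionOf (κ , ν)) •ₛ coeff (s (partitionOf (κ , ν)) b)
      term {κ} {ν} κ∈ ν∈ α = sym (*-cong
        (reflexive (≡.trans (expansionCoefficient-yes ρ diag≡) (≡.cong₂ (coefficient a b (arms μ) (legs μ)) (arms-≡ ρ F) (legs-≡ ρ F))))
        (s-frobenius ρ b F α))
        where
        ρ = partitionOf (κ , ν)
        F = pair-Frobenius κ∈ ν∈
        diag≡ : diag ρ ≡ diag μ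
        diag≡ = ≡.trans (Frobenius-diag ρ F) (≡.trans (sublists-length (length (arms μ)) (downFrom m) κ∈) (length-arms μ))

    expansion-expands : Expands (s μ a) b expansionCoefficient
    expansion-expands = record
      { support = support ; distinct = distinct ; vanishes = vanishes
      ; expands = S.trans (s-frobenius μ a (coordinates μ)) (S.trans (frobeniusSchur-expansion a b arms<m legs<m) (S.trans
          (S.Σ-cong armLists λ κ κ∈ → S.Σ-cong legLists λ ν ν∈ → term κ∈ ν∈) (S.trans
          (S.sym (S.trans (S.Σ-map partitionOf pairs _) (Σ-cartesianProduct armLists legLists _)))
          (S.sym (coeff-foldr expansionCoefficient b support))))) }

theorem7 : ∀ {c ℓ} (K : CommutativeRing c ℓ) →
    let open CommutativeRing K
        open SymmetricFunctions K in
    (a b : Sequence) (μ : Partition) →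
      Σ (Partition → Carrier) (λ coef → Expands (s μ a) b coef)
      × (∀ (coef : Partition → Carrier) → Expands (s μ a) b coef →
           (∀ ν → ¬ (ν ⊆ μ × diag ν ≡ diag μ) → coef ν ≈ 0#)
         × (∀ ν (d : ℕ) → diag ν ≡ d → diag μ ≡ d →
              coef ν ≈
                det rawRing {d} (λ i j → hookCoef a b (arm μ (toℕ i)) (arm ν (toℕ j)))
                * det rawRing {d} (λ i j → hookCoef (dual a) (dual b) (leg μ (toℕ i)) (leg ν (toℕ j)))))
theorem7 K a b μ =
  (expansionCoefficient a b μ , expansion-expands a b μ) , λ coef E →
    (λ ν ν⊈μ → trans (Expands-unique E (expansion-expands a b μ) ν) (expansionCoefficient-⊆ a b μ ν ν⊈μ)) ,
    (λ ν d νd μd → trans (Expands-unique E (expansion-expands a b μ) ν) (expansionCoefficient-det a b μ ν d νd μd))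
  where
  open CommutativeRing K using (trans)
  open Expansions K
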